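{- The map $\mathsf{forget}\colon\overline{\mathfrak{M}_1}\to\mathfrak{T}$ is a bijection, where $\overline{\mathfrak{M}_1}$ is the set of meanders with shallow top (of all orders $n\ge1$), $\mathfrak{T}$ is the set of finite black-rooted fat-trees with one special edge marked at every black vertex, and $\mathsf{forget}$ is the map that sends the meander given by $(\pi,\rho)$ to the tree $\Gamma(\pi,\rho)$, rooted at the black vertex containing $1$, with the smallest-labeled edge at every black vertex marked as special, and with edge labels erased.
   Context: For a positive integer $n$, a partition $\pi$ of $\{1,\ldots,n\}$ is non-crossing if there are no two distinct blocks $V,W$ and numbers $a<b<c<d$ with $a,c\in V$, $b,d\in W$. $\mathrm{NC}(n)$ is the set of non-crossing partitions of $\{1,\ldots,n\}$, ordered by $\pi\le\rho$ iff every block of $\pi$ is contained in a block of $\rho$; $d_H$ is the graph distance in the Hasse diagram of $(\mathrm{NC}(n),\le)$ (undirected graph on $\mathrm{NC}(n)$, with edges given by the covering relation). $\mathrm{Int}(n)\subseteq\mathrm{NC}(n)$ is the set of interval partitions: every block is of the form $\{p,p+1,\ldots,q\}$. Meanders with shallow top: $\overline{\mathfrak{M}_1}(n)=\{(\pi,\rho)\in\mathrm{Int}(n)\times\mathrm{NC}(n)\mid d_H(\pi,\rho)=n-1\}$ (the pair $(\pi,\rho)$ encodes the meander $M(\pi,\rho)$), and $\overline{\mathfrak{M}_1}=\bigcup_{n\ge1}\overline{\mathfrak{M}_1}(n)$. The graph $\Gamma(\pi,\rho)$: for $\pi,\rho\in\mathrm{NC}(n)$ it is the planar bipartite graph with one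 black vertex for each block of $\pi$, one white vertex for each block of $\rho$, and $n$ edges labeled $1,\ldots,n$, the edge labeled $i$ joining the block of $\pi$ containing $i$ to the block of $\rho$ containing $i$. It is drawn in the plane with the black vertices in the upper half-plane and white vertices in the lower half-plane, the edges $1,\ldots,n$ crossing the horizontal line in this order from left to right. Thus if the edges at a black vertex have labels $i_1<i_2<\cdots<i_k$, their counterclockwise cyclic order is $(i_1,i_2,\ldots,i_k)$, while at a white vertex this is their clockwise cyclic order. It is known that $\Gamma(\pi,\rho)$ is a tree if and only if $d_H(\pi,\rho)=n-1$. A fat-tree is a tree together with an embedding in the plane, i.e. with a (counterclockwise) cyclic order on the edges emanating from each vertex. $\mathfrak{T}$ is the set of (isomorphism classes of) finite rooted fat-trees with the following additional data: the vertices are properly colored black and white (every edge has one black and one white endpoint), with the root colored black; and for every black vertex, one of the edges emanating from it is marked as special (so every black vertex has at least one edge). Isomorphisms preserve root, colors, cyclic orders and special edges. The map $\mathsf{forget}$: given $(\pi,\rho)\in\overline{\mathfrak{M}_1}$, take the tree $\Gamma(\pi,\rho)$ with its cyclic orders coming from the planar embedding of $\Gamma(\pi,\rho)$ in which the black vertices lie in the upper half-plane, the white vertices lie in the lower half-plane, and the edges labeled $1,\ldots,n$ cross the horizontal line in this order from left to right, mark as the root the black vertex corresponding to the block of $\pi$ containing $1$, mark as special at every black vertex the edge with the smallest label, and forget the labels of the edges. -}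

module Defs where

open import Data.Empty using (⊥; ⊥-elim)
open import Data.Fin.Base using (Fin; zero; suc; _≤_; _<_)
open import Data.Fin.Properties using (_≟_; <-cmp; <-trans; <-asym)
open import Data.List.Base using (List; []; _∷_)
open import Data.List.Relation.Unary.Unique.Propositional using (Unique)
open import Data.Nat.Base as ℕ using (ℕ; zero; suc; _∸_)
open import Data.Product.Base using (Σ-syntax; ∃; ∃-syntax; _×_; _,_; proj₁; proj₂)
open import Data.Sum.Base using (_⊎_; inj₁; inj₂)
open import Function.Base using (_∘_)
open import Function.Bundles using (_⇔_; _↔_; Inverse)
open import Function.Definitions using (StrictlySurjective)
open import Relation.Binary.Definitions using (tri<; tri≈; tri>)
open import Relation.Binary.PropositionalEquality using (_≡_; _≢_; sym)
open import Relation.Nullary using (¬_; yes; no)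
open import Relation.Unary using (Decidable)
import Relation.Binary.Construct.NonStrictToStrict as ToStrict

-- The blocks are indexed by Fin #blocks, and block V is { i | block i ≡ V }.
-- The indexing carries no information: partitions are compared with _≈_
-- below.  The points 1, …, n are the elements of Fin n, shifted by one.

record Partition (n : ℕ) : Set where
  field
    #blocks  : ℕ
    block    : Fin n → Fin #blocks
    nonempty : StrictlySurjective _≡_ block

open Partition public

IsNonCrossing : ∀ {n} → Partition n → Set
IsNonCrossing π = ∀ {V W a b c d} → V ≢ W → a < b → b < c → c < d →
  block π a ≡ V → block π c ≡ V → block π b ≡ W → block π d ≡ W → ⊥

IsInterval : ∀ {n} → Partition n → Set
IsInterval {n} π = ∀ V → Σ[ p ∈ Fin n ] Σ[ q ∈ Fin n ] ∀ i → block π i ≡ V ⇔ (p ≤ i × i ≤ q)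

record NC (n : ℕ) : Set where
  field
    partition   : Partition n
    nonCrossing : IsNonCrossing partition

open NC public

module _ {n : ℕ} where

  infix 4 _≈_ _⊑_ _⋖_

  _≈_ : NC n → NC n → Set
  π ≈ ρ = ∀ i j → block (partition π) i ≡ block (partition π) j ⇔
                  block (partition ρ) i ≡ block (partition ρ) j

  _⊑_ : NC n → NC n → Set
  π ⊑ ρ = ∀ V → ∃[ W ] ∀ i → block (partition π) i ≡ V → block (partition ρ) i ≡ W

  open ToStrict _≈_ _⊑_ public using () renaming (_<_ to _⊏_)

  _⋖_ : NC n → NC n → Set
  π ⋖ ρ = π ⊏ ρ × ¬ (∃[ σ ] (π ⊏ σ × σ ⊏ ρ))

  -- Partitions are identified up to _≈_, so a walk of length 0 joins
  -- partitions that are ≈ rather than ≡; _⋖_ respects _≈_.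

  data HasseWalk : NC n → NC n → ℕ → Set where
    stop : ∀ {π ρ} → π ≈ ρ → HasseWalk π ρ 0
    step : ∀ {π σ ρ k} → π ⋖ σ ⊎ σ ⋖ π → HasseWalk σ ρ k → HasseWalk π ρ (suc k)

  HasseDistance : NC n → NC n → ℕ → Set
  HasseDistance π ρ k = HasseWalk π ρ k × (∀ l → HasseWalk π ρ l → k ℕ.≤ l)

record ShallowTop (n : ℕ) : Set where
  field
    top         : NC n
    bottom      : NC n
    topInterval : IsInterval (partition top)
    distance    : HasseDistance top bottom (n ∸ 1)

open ShallowTop public

-- The union over all orders n ≥ 1; (m , M) is a meander of order n = suc m.

𝔐₁ : Set
𝔐₁ = Σ[ m ∈ ℕ ] ShallowTop (suc m)

infix 4 _≈ᴹ_

data _≈ᴹ_ : 𝔐₁ → 𝔐₁ → Set where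
  same : ∀ {m} {M N : ShallowTop (suc m)} →
         top M ≈ top N → bottom M ≈ bottom N → (m , M) ≈ᴹ (m , N)

-- C a b c means that a, b, c are distinct elements of P, met in this order
-- when going around the cycle.

record IsCyclicOrder {E : Set} (P : E → Set) (C : E → E → E → Set) : Set where
  field
    support : ∀ {a b c} → C a b c → P a × P b × P c
    cyclic  : ∀ {a b c} → C a b c → C b c a
    asym    : ∀ {a b c} → C a b c → ¬ C c b a
    transit : ∀ {a b c d} → C a b c → C a c d → C a b d
    total   : ∀ {a b c} → P a → P b → P c → a ≢ b → b ≢ c → a ≢ c → C a b c ⊎ C c b a

module _ {n : ℕ} (P : Fin n → Set) where

  -- The cyclic order (i₁, …, iₖ) on P = { i₁ < … < iₖ }.

  Increasing : Fin n → Fin n → Fin n → Set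
  Increasing a b c = (P a × P b × P c) ×
    ((a < b × b < c) ⊎ (b < c × c < a) ⊎ (c < a × a < b))

  Decreasing : Fin n → Fin n → Fin n → Set
  Decreasing a b c = Increasing c b a

  increasing : IsCyclicOrder P Increasing
  increasing = record
    { support = proj₁ ; cyclic = cyc ; asym = asy ; transit = tra ; total = tot }
    where
    cyc : ∀ {a b c} → Increasing a b c → Increasing b c a
    cyc ((p , q , r) , inj₁ (u , v))        = (q , r , p) , inj₂ (inj₂ (u , v))
    cyc ((p , q , r) , inj₂ (inj₁ (u , v))) = (q , r , p) , inj₁ (u , v)
    cyc ((p , q , r) , inj₂ (inj₂ (u , v))) = (q , r , p) , inj₂ (inj₁ (u , v))

    asy : ∀ {a b c} → Increasing a b c → ¬ Increasing c b a
    asy (_ , inj₁ (u , v))        (_ , inj₁ (w , x))        = <-asym u x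
    asy (_ , inj₁ (u , v))        (_ , inj₂ (inj₁ (w , x))) = <-asym u w
    asy (_ , inj₁ (u , v))        (_ , inj₂ (inj₂ (w , x))) = <-asym v x
    asy (_ , inj₂ (inj₁ (u , v))) (_ , inj₁ (w , x))        = <-asym u w
    asy (_ , inj₂ (inj₁ (u , v))) (_ , inj₂ (inj₁ (w , x))) = <-asym v x
    asy (_ , inj₂ (inj₁ (u , v))) (_ , inj₂ (inj₂ (w , x))) = <-asym u x
    asy (_ , inj₂ (inj₂ (u , v))) (_ , inj₁ (w , x))        = <-asym v x
    asy (_ , inj₂ (inj₂ (u , v))) (_ , inj₂ (inj₁ (w , x))) = <-asym v w
    asy (_ , inj₂ (inj₂ (u , v))) (_ , inj₂ (inj₂ (w , x))) = <-asym u w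

    tra : ∀ {a b c d} → Increasing a b c → Increasing a c d → Increasing a b d
    tra ((p , q , _) , s) ((_ , _ , r) , t) = (p , q , r) , go s t
      where
      go : ∀ {a b c d : Fin n} →
           (a < b × b < c) ⊎ (b < c × c < a) ⊎ (c < a × a < b) →
           (a < c × c < d) ⊎ (c < d × d < a) ⊎ (d < a × a < c) →
           (a < b × b < d) ⊎ (b < d × d < a) ⊎ (d < a × a < b)
      go (inj₁ (u , v))        (inj₁ (w , x))        = inj₁ (u , <-trans v x)
      go (inj₁ (u , v))        (inj₂ (inj₁ (w , x))) = ⊥-elim (<-asym (<-trans u v) (<-trans w x))
      go (inj₁ (u , v))        (inj₂ (inj₂ (w , x))) = inj₂ (inj₂ (w , u))
      go (inj₂ (inj₁ (u , v))) (inj₁ (w , x))        = ⊥-elim (<-asym v w)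
      go (inj₂ (inj₁ (u , v))) (inj₂ (inj₁ (w , x))) = inj₂ (inj₁ (<-trans u w , x))
      go (inj₂ (inj₁ (u , v))) (inj₂ (inj₂ (w , x))) = ⊥-elim (<-asym v x)
      go (inj₂ (inj₂ (u , v))) (inj₁ (w , x))        = ⊥-elim (<-asym u w)
      go (inj₂ (inj₂ (u , v))) (inj₂ (inj₁ (w , x))) = inj₂ (inj₂ (x , v))
      go (inj₂ (inj₂ (u , v))) (inj₂ (inj₂ (w , x))) = ⊥-elim (<-asym u x)

    tot : ∀ {a b c} → P a → P b → P c → a ≢ b → b ≢ c → a ≢ c →
          Increasing a b c ⊎ Increasing c b a
    tot {a} {b} {c} p q r a≢b b≢c a≢c with <-cmp a b | <-cmp b c | <-cmp a c
    ... | tri≈ _ e _ | _          | _          = ⊥-elim (a≢b e)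
    ... | tri< _ _ _ | tri≈ _ e _ | _          = ⊥-elim (b≢c e)
    ... | tri> _ _ _ | tri≈ _ e _ | _          = ⊥-elim (b≢c e)
    ... | tri< u _ _ | tri< v _ _ | _          = inj₁ ((p , q , r) , inj₁ (u , v))
    ... | tri> _ _ u | tri> _ _ v | _          = inj₂ ((r , q , p) , inj₁ (v , u))
    ... | tri< _ _ _ | tri> _ _ _ | tri≈ _ e _ = ⊥-elim (a≢c e)
    ... | tri> _ _ _ | tri< _ _ _ | tri≈ _ e _ = ⊥-elim (a≢c e)
    ... | tri< u _ _ | tri> _ _ v | tri< w _ _ = inj₂ ((r , q , p) , inj₂ (inj₂ (w , v)))
    ... | tri< u _ _ | tri> _ _ v | tri> _ _ w = inj₁ ((p , q , r) , inj₂ (inj₂ (w , u)))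
    ... | tri> _ _ u | tri< v _ _ | tri< w _ _ = inj₂ ((r , q , p) , inj₂ (inj₁ (u , w)))
    ... | tri> _ _ u | tri< v _ _ | tri> _ _ w = inj₁ ((p , q , r) , inj₂ (inj₁ (v , w)))

  decreasing : IsCyclicOrder P Decreasing
  decreasing = record
    { support = λ s → let (r , q , p) = support s in p , q , r
    ; cyclic  = λ s → cyclic (cyclic s)
    ; asym    = asym
    ; transit = λ s t → cyclic (transit (cyclic (cyclic t)) (cyclic (cyclic s)))
    ; total   = λ p q r a≢b b≢c a≢c →
                  total r q p (b≢c ∘ sym) (a≢b ∘ sym) (a≢c ∘ sym)
    }
    where open IsCyclicOrder increasing

-- A finite properly coloured bipartite multigraph with a counterclockwise
-- cyclic order on the edges around each vertex.

record FatGraph : Set₁ where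
  field
    #black #white #edges : ℕ
    blackEnd : Fin #edges → Fin #black
    whiteEnd : Fin #edges → Fin #white
    blackCyc : Fin #black → Fin #edges → Fin #edges → Fin #edges → Set
    whiteCyc : Fin #white → Fin #edges → Fin #edges → Fin #edges → Set
    isCyclicOrderᵇ : ∀ v → IsCyclicOrder (λ e → blackEnd e ≡ v) (blackCyc v)
    isCyclicOrderʷ : ∀ v → IsCyclicOrder (λ e → whiteEnd e ≡ v) (whiteCyc v)

module _ (G : FatGraph) where
  open FatGraph G

  Vertex : Set
  Vertex = Fin #black ⊎ Fin #white

  Joins : Fin #edges → Vertex → Vertex → Set
  Joins e u v = (u ≡ inj₁ (blackEnd e) × v ≡ inj₂ (whiteEnd e))
              ⊎ (u ≡ inj₂ (whiteEnd e) × v ≡ inj₁ (blackEnd e))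

  data Walk : Vertex → Vertex → Set where
    stop : ∀ {v} → Walk v v
    step : ∀ {u v w} (e : Fin #edges) → Joins e u v → Walk v w → Walk u w

  edges : ∀ {u v} → Walk u v → List (Fin #edges)
  edges stop         = []
  edges (step e _ w) = e ∷ edges w

  -- The vertices visited, except the last one; on a closed walk this lists
  -- the base point once.

  vertices : ∀ {u v} → Walk u v → List Vertex
  vertices stop             = []
  vertices (step {u} _ _ w) = u ∷ vertices w

  -- Distinctness of the edges is not redundant: it excludes traversing one
  -- edge back and forth, whereas two parallel edges do form a cycle.

  IsCycle : ∀ {v} → Walk v v → Set
  IsCycle w = edges w ≢ [] × Unique (edges w) × Unique (vertices w)

  record IsTree : Set where
    field
      connected : ∀ u v → Walk u v
      acyclic   : ∀ {v} (w : Walk v v) → ¬ IsCycle w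

record MarkedFatGraph : Set₁ where
  field
    graph      : FatGraph
  open FatGraph graph public
  field
    root       : Fin #black
    special    : Fin #black → Fin #edges
    special-at : ∀ v → blackEnd (special v) ≡ v

open MarkedFatGraph public using (graph)

𝔗 : Set₁
𝔗 = Σ[ T ∈ MarkedFatGraph ] IsTree (graph T)

record Isomorphism (T U : MarkedFatGraph) : Set where
  private
    module T = MarkedFatGraph T
    module U = MarkedFatGraph U
  field
    onBlack : Fin T.#black ↔ Fin U.#black
    onWhite : Fin T.#white ↔ Fin U.#white
    onEdges : Fin T.#edges ↔ Fin U.#edges
  open Inverse onBlack public using () renaming (to to β)
  open Inverse onWhite public using () renaming (to to ω)
  open Inverse onEdges public using () renaming (to to ε)
  field
    blackEnd-≡ : ∀ e → U.blackEnd (ε e) ≡ β (T.blackEnd e)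
    whiteEnd-≡ : ∀ e → U.whiteEnd (ε e) ≡ ω (T.whiteEnd e)
    blackCyc-⇔ : ∀ v a b c → T.blackCyc v a b c ⇔ U.blackCyc (β v) (ε a) (ε b) (ε c)
    whiteCyc-⇔ : ∀ v a b c → T.whiteCyc v a b c ⇔ U.whiteCyc (ω v) (ε a) (ε b) (ε c)
    root-≡     : U.root ≡ β T.root
    special-≡  : ∀ v → U.special (β v) ≡ ε (T.special v)

infix 4 _≅_

_≅_ : 𝔗 → 𝔗 → Set
T ≅ U = Isomorphism (proj₁ T) (proj₁ U)

smallest : ∀ {n} {P : Fin n → Set} → Decidable P → ∃ P →
           ∃[ i ] (P i × (∀ j → P j → i ≤ j))
smallest {suc n} P? (i , Pi) with P? zero
... | yes P0 = zero , P0 , λ _ _ → ℕ.z≤n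
smallest {suc n} P? (zero  , P0) | no ¬P0 = ⊥-elim (¬P0 P0)
smallest {suc n} P? (suc i , Pi) | no ¬P0 with smallest (P? ∘ suc) (i , Pi)
... | k , Pk , min = suc k , Pk , λ { zero    P0 → ⊥-elim (¬P0 P0)
                                    ; (suc j) Pj → ℕ.s≤s (min j Pj) }

-- Black vertices lie above the line, so counterclockwise around them is left
-- to right along the line; around the white vertices below it is right to left.

Γ : ∀ {n} → NC n → NC n → FatGraph
Γ {n} π ρ = record
  { #black = #blocks (partition π)
  ; #white = #blocks (partition ρ)
  ; #edges = n
  ; blackEnd = block (partition π)
  ; whiteEnd = block (partition ρ)
  ; blackCyc = λ V → Increasing (λ i → block (partition π) i ≡ V)
  ; whiteCyc = λ W → Decreasing (λ i → block (partition ρ) i ≡ W)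
  ; isCyclicOrderᵇ = λ V → increasing (λ i → block (partition π) i ≡ V)
  ; isCyclicOrderʷ = λ W → decreasing (λ i → block (partition ρ) i ≡ W)
  }

markedΓ : 𝔐₁ → MarkedFatGraph
markedΓ (m , M) = record
  { graph      = Γ (top M) (bottom M)
  ; root       = block π zero
  ; special    = λ V → proj₁ (first V)
  ; special-at = λ V → proj₁ (proj₂ (first V))
  }
  where
  π = partition (top M)
  first : ∀ V → ∃[ i ] (block π i ≡ V × (∀ j → block π j ≡ V → i ≤ j))
  first V = smallest (λ i → block π i ≟ V) (nonempty π V)

-- forget takes values in 𝔗 because Γ is a tree whenever the distance is n ∸ 1.
-- The proof of this is an argument, so that a statement about forget has to
-- establish it first.

forget : (∀ M → IsTree (graph (markedΓ M))) → 𝔐₁ → 𝔗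
forget isTree M = markedΓ M , isTree M

{-# OPTIONS --safe #-}

-- For an interval partition π and a noncrossing ρ the components of Γ(π, ρ)
-- form a noncrossing partition σ of the labels.  Going from π to ρ through the
-- discrete partition, respectively through σ, takes 2n - |π| - |ρ|,
-- respectively |π| + |ρ| - 2|σ|, covers.  Distance n - 1 therefore forces
-- |σ| = 1 and |π| + |ρ| = n + 1, which means that Γ is a tree.
--
-- Injectivity: the label following i can be read off the marked fat-tree.  It
-- is the next edge at the black vertex of i, or, if that one is special, the
-- first special edge met on the contour of the tree starting at i.
--
-- Surjectivity: the edges of a marked fat-tree are labelled by induction on
-- their number.  A white leaf can be removed.  Without white leaves, counting
-- gives consecutive edges e, f at a white vertex such that e is last at its
-- black vertex and f is special at its own, which is not the root.  Merging e
-- and f into one edge gives a smaller tree, in a labelling of which the label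
-- of the merged edge is split into two consecutive ones.

module Submission where

open import Data.Empty using (⊥; ⊥-elim)
open import Data.Fin.Base as Fin using (Fin; zero; suc; fromℕ<; inject₁; punchIn; punchOut; splitAt; toℕ; _↑ˡ_; _↑ʳ_)
open import Data.Fin.Induction using (<-weakInduction)
open import Data.Fin.Permutation using (↔⇒≡)
open import Data.Fin.Properties using (_≟_; _<?_; <-cmp; all?; any?; injective⇒≤; join-splitAt; punchIn-injective; punchIn-punchOut; punchInᵢ≢i; punchOut-cong; punchOut-injective; punchOut-punchIn; splitAt-↑ˡ; splitAt-↑ʳ; splitAt⁻¹-↑ˡ; splitAt⁻¹-↑ʳ; suc-injective; toℕ-fromℕ<; toℕ-inject₁; toℕ-injective; toℕ<n)
open import Data.List.Base using ([]; _∷_)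
open import Data.List.Membership.Propositional using (_∈_)
open import Data.List.Relation.Unary.All as All using (All; []; _∷_)
open import Data.List.Relation.Unary.All.Properties using (¬Any⇒All¬)
open import Data.List.Relation.Unary.AllPairs using ([]; _∷_)
open import Data.List.Relation.Unary.Any as Any using (here; there)
open import Data.List.Relation.Unary.Unique.Propositional using (Unique)
open import Data.Nat.Base as ℕ using (ℕ; zero; suc; _<_; _≤_)
open import Data.Nat.Tactic.RingSolver using (solve-∀)
open import Data.Product.Base using (Σ-syntax; ∃; ∃-syntax; _×_; _,_; proj₁; proj₂)
open import Data.Sum.Base as Sum using (_⊎_; inj₁; inj₂; [_,_]′)
open import Data.Sum.Properties using (≡-dec)
open import Data.Unit.Base using (⊤; tt)
open import Data.Vec.Functional using (insertAt)
open import Data.Vec.Functional.Properties using (insertAt-lookup; insertAt-punchIn)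
open import Function.Base using (_∘_; id; flip)
open import Function.Bundles using (_⇔_; _↔_; Inverse; Equivalence; mk⇔; mk↔ₛ′)
open import Function.Construct.Composition using (_↔-∘_)
open import Function.Construct.Identity using (↔-id)
open import Function.Construct.Symmetry using (↔-sym)
open import Function.Definitions using (Injective; StrictlySurjective)
open import Function.Structures using (IsBijection)
open import Level using (0ℓ)
open import Relation.Binary.Core using (Rel)
open import Relation.Binary.Definitions using (Reflexive; Total; Transitive; Tri; tri<; tri≈; tri>)
open import Relation.Binary.PropositionalEquality using (_≡_; _≢_; refl; sym; trans; cong; cong₂; subst; subst₂)
open import Relation.Binary.Structures using (IsEquivalence)
open import Relation.Nullary using (¬_; Dec; yes; no; _×-dec_; ¬?)
open import Relation.Nullary.Decidable using (_⊎-dec_; _→-dec_; decidable-stable)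
open import Relation.Unary using (Decidable; Pred)
import Data.Nat.Properties as ℕₚ
open import Defs

-- Components of a multigraph

-- Connectedness is carried by predicates on labels: a predicate compatible with both partitions
-- that holds at one label holds at all. In this form it passes to joins of partitions and through
-- removing, merging and relabelling edges without any handling of walks, which occur only where
-- `IsTree` and `HasseDistance` are met. Being a tree then means connectedness together with n + 1
-- vertices.
--
-- Surjectivity also needs that the constructed pair is not closer than n - 1. On a walk with u
-- covers upwards and d downwards, u pairs of labels added to the top join everything, and so do d
-- pairs added to the bottom. Hence the top has at most u + 1 blocks, the bottom at most d + 1, and
-- n + 1 ≤ u + d + 2.
--
-- Both reductions in the labelling are such that undoing them places one new label directly beside
-- an old one, which leaves intervals and noncrossing under control. Labels are natural numbers of
-- which only the order counts; they are compressed to 1, ..., n at the end.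

record Merging {k : ℕ} (V W : Fin k) : Set where
  field
    size      : ℕ
    size-≡    : suc size ≡ k
    collapse  : Fin k → Fin size
    merges    : collapse V ≡ collapse W
    separates : ∀ {X Y} → collapse X ≡ collapse Y →
                X ≡ Y ⊎ (X ≡ V × Y ≡ W) ⊎ (X ≡ W × Y ≡ V)
    hits      : ∀ Z → ∃[ X ] collapse X ≡ Z

merging : ∀ {k} {V W : Fin k} → V ≢ W → Merging V W
merging {suc k} {V} {W} V≢W = record
  { size = k ; size-≡ = refl ; collapse = f
  ; merges = merges ; separates = separates _ _
  ; hits = λ Z → punchIn W Z , hits Z }
  where
  f : Fin (suc k) → Fin k
  f X with X ≟ W
  ... | yes _   = punchOut (V≢W ∘ sym)
  ... | no X≢W = punchOut (X≢W ∘ sym)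

  merges : f V ≡ f W
  merges with V ≟ W | W ≟ W
  ... | yes e | _     = ⊥-elim (V≢W e)
  ... | no _  | yes _ = punchOut-cong W refl
  ... | no _  | no ne = ⊥-elim (ne refl)

  separates : ∀ X Y → f X ≡ f Y → X ≡ Y ⊎ (X ≡ V × Y ≡ W) ⊎ (X ≡ W × Y ≡ V)
  separates X Y e with X ≟ W | Y ≟ W
  ... | yes p | yes q = inj₁ (trans p (sym q))
  ... | yes p | no q  = inj₂ (inj₂ (p , sym (punchOut-injective {i = W} _ _ e)))
  ... | no p  | yes q = inj₂ (inj₁ (punchOut-injective {i = W} _ _ e , q))
  ... | no p  | no q  = inj₁ (punchOut-injective {i = W} _ _ e)

  hits : ∀ Z → f (punchIn W Z) ≡ Z
  hits Z with punchIn W Z ≟ W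
  ... | yes e = ⊥-elim (punchInᵢ≢i W Z e)
  ... | no ne = trans (punchOut-cong W refl) (punchOut-punchIn W)

module _ {V m : ℕ} (s t : Fin m → Fin V) where

  Closed : (Fin m → Set) → (Fin V → Set) → Set
  Closed E P = ∀ e → E e → (P (s e) → P (t e)) × (P (t e) → P (s e))

  -- The ends of `e` stay connected when `e` is deleted. Invariant predicates replace paths;
  -- choosing for `P` the existence of a simple path recovers one.
  Redundant : Fin m → Set₁
  Redundant e = ∀ P → Closed (_≢ e) P → P (s e) → P (t e)

  -- `bound` and `exact` are the Euler count: there are at most as many vertices as components and
  -- edges together, with equality unless some edge is redundant.
  record Components : Set₁ where
    field
      #comps : ℕ
      comp   : Fin V → Fin #comps
      onto   : ∀ c → ∃[ v ] comp v ≡ c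
      joins  : ∀ e → comp (s e) ≡ comp (t e)
      sound  : ∀ P → Closed (λ _ → ⊤) P → ∀ {u v} → comp u ≡ comp v → P u → P v
      bound  : V ℕ.≤ #comps ℕ.+ m
      exact  : V ≡ #comps ℕ.+ m ⊎ (∃[ e ] Redundant e)

-- Edges are added one at a time: an edge inside a component formed by the earlier ones is
-- redundant, any other merges two components.
components : ∀ {V m} (s t : Fin m → Fin V) → Components s t
components {V} {zero} s t = record
  { #comps = V ; comp = id ; onto = λ c → c , refl ; joins = λ ()
  ; sound = λ { P _ refl p → p }
  ; bound = ℕₚ.≤-reflexive (sym (ℕₚ.+-identityʳ V))
  ; exact = inj₁ (sym (ℕₚ.+-identityʳ V)) }
components {V} {suc m} s t with components (s ∘ suc) (t ∘ suc)
... | C with Components.comp C (s zero) ≟ Components.comp C (t zero)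
...   | yes eq = record
  { #comps = #comps ; comp = comp ; onto = onto
  ; joins = λ { zero → eq ; (suc e) → joins e }
  ; sound = λ P cl → sound P (λ e _ → cl (suc e) _)
  ; bound = ℕₚ.≤-trans bound (ℕₚ.+-monoʳ-≤ #comps (ℕₚ.n≤1+n m))
  ; exact = inj₂ (zero , λ P cl → sound P (λ e _ → cl (suc e) λ ()) eq) }
  where open Components C
...   | no diff = record
  { #comps = size ; comp = collapse ∘ comp
  ; onto = λ c → let (X , p) = hits c ; (v , q) = onto X in
                 v , trans (cong collapse q) p
  ; joins = λ { zero → merges ; (suc e) → cong collapse (joins e) }
  ; sound = sound′
  ; bound = subst (V ℕ.≤_) arith bound
  ; exact = exact′ exact }
  where
  open Components C
  open Merging (merging diff)
  arith : #comps ℕ.+ m ≡ size ℕ.+ suc m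
  arith = trans (cong (ℕ._+ m) (sym size-≡)) (sym (ℕₚ.+-suc size m))
  sound′ : ∀ P → Closed s t (λ _ → ⊤) P →
           ∀ {u v} → collapse (comp u) ≡ collapse (comp v) → P u → P v
  sound′ P cl e p with separates e
  ... | inj₁ q              = sound P (λ e _ → cl (suc e) _) q p
  ... | inj₂ (inj₁ (q , r)) = sound P (λ e _ → cl (suc e) _) (sym r)
    (proj₁ (cl zero _) (sound P (λ e _ → cl (suc e) _) q p))
  ... | inj₂ (inj₂ (q , r)) = sound P (λ e _ → cl (suc e) _) (sym r)
    (proj₂ (cl zero _) (sound P (λ e _ → cl (suc e) _) q p))
  exact′ : V ≡ #comps ℕ.+ m ⊎ (∃[ e ] Redundant (s ∘ suc) (t ∘ suc) e) →
           V ≡ size ℕ.+ suc m ⊎ (∃[ e ] Redundant s t e)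
  exact′ (inj₁ q)       = inj₁ (trans q arith)
  exact′ (inj₂ (e , r)) = inj₂ (suc e , λ P cl →
    r P (λ e′ ne → cl (suc e′) λ { refl → ne refl }))

open Equivalence using (to; from)

-- The Hasse diagram of NC(n)

Between : ∀ {n} → Fin n → Fin n → Fin n → Set
Between a b x = a Fin.< x × x Fin.< b

module _ {n : ℕ} {A : Set} where

  -- Noncrossing as transport along a block: lying under the chord from `a` to `b` is shared by all
  -- points of another block. This makes it an invariant predicate, to which `sound` can be applied.
  Nested : (Fin n → A) → Set
  Nested f = ∀ {a b x y} → f a ≡ f b → f x ≡ f y → f x ≢ f a →
             Between a b x → Between a b y

  Convex : (Fin n → A) → Set
  Convex f = ∀ {x y z} → f x ≡ f y → Between x y z → f z ≡ f x

  Respects : (Fin n → A) → (Fin n → Set) → Set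
  Respects f P = ∀ {x y} → f x ≡ f y → P x → P y

nested : ∀ {n} (σ : NC n) → Nested (block (partition σ))
nested σ {a} {b} {x} {y} ab xy x≢a (a<x , x<b) with <-cmp a y | <-cmp y b
... | tri< a<y _ _ | tri< y<b _ _ = a<y , y<b
... | tri> _ _ y<a | _ = ⊥-elim (nonCrossing σ x≢a y<a a<x x<b (sym xy) refl refl (sym ab))
... | _ | tri> _ _ b<y = ⊥-elim (nonCrossing σ (x≢a ∘ sym) a<x x<b b<y refl (sym ab) refl (sym xy))
... | tri≈ _ refl _ | _ = ⊥-elim (x≢a xy)
... | _ | tri≈ _ refl _ = ⊥-elim (x≢a (trans xy (sym ab)))

nested⇒nonCrossing : ∀ {n} (π : Partition n) → Nested (block π) → IsNonCrossing π
nested⇒nonCrossing π nest V≢W a<b b<c c<d aV cV bW dW = ℕₚ.<-asym c<d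
  (proj₂ (nest (trans aV (sym cV)) (trans bW (sym dW))
               (λ e → V≢W (trans (sym aV) (trans (sym e) bW))) (a<b , b<c)))

interval⇒convex : ∀ {n} (π : Partition n) → IsInterval π → Convex (block π)
interval⇒convex π int {x} {y} {z} xy (x<z , z<y) with int (block π x)
... | p , q , iff = from (iff z)
  ( ℕₚ.≤-trans (proj₁ (to (iff x) refl)) (ℕₚ.<⇒≤ x<z)
  , ℕₚ.≤-trans (ℕₚ.<⇒≤ z<y) (proj₂ (to (iff y) (sym xy))))

module _ {n : ℕ} {A B C : Set} {f : Fin n → A} {g : Fin n → B} {h : Fin n → C}
         (convex : Convex f) (nest : Nested g)
         (f⇒h : ∀ {x y} → f x ≡ f y → h x ≡ h y)
         (g⇒h : ∀ {x y} → g x ≡ g y → h x ≡ h y)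
         (sound : ∀ P → Respects f P → Respects g P → Respects h P) where

  private
    -- Being under an arc of one block is preserved along `f`, since a convex block leaving the span
    -- contains an end of the arc. It is preserved along `g` by nestedness, or, for an arc of `f`,
    -- because only the block of the arc lies under it.
    chord : ∀ {p q u v} → f p ≡ f q ⊎ g p ≡ g q → h u ≡ h v → h u ≢ h p →
            Between p q u → Between p q v
    chord {p} {q} {u} {v} pq uv u≢p inu =
      proj₂ (sound P onF onG uv (refl , inu))
      where
      P : Fin n → Set
      P z = h z ≡ h u × Between p q z
      pq′ : h p ≡ h q
      pq′ = [ f⇒h , g⇒h ]′ pq
      onF : Respects f P
      onF {x} {y} xy (xu , p<x , x<q) with <-cmp p y | <-cmp y q
      ... | tri< p<y _ _ | tri< y<q _ _ = trans (sym (f⇒h xy)) xu , p<y , y<q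
      ... | tri> _ _ y<p | _ = ⊥-elim (u≢p (trans (sym xu) (f⇒h (trans xy (sym (convex (sym xy) (y<p , p<x)))))))
      ... | _ | tri> _ _ q<y = ⊥-elim (u≢p (trans (sym xu) (trans (f⇒h (sym (convex xy (x<q , q<y)))) (sym pq′))))
      ... | tri≈ _ refl _ | _ = ⊥-elim (u≢p (trans (sym xu) (f⇒h xy)))
      ... | _ | tri≈ _ refl _ = ⊥-elim (u≢p (trans (sym xu) (trans (f⇒h xy) (sym pq′))))
      onG : Respects g P
      onG {x} {y} xy (xu , inx) = trans (sym (g⇒h xy)) xu ,
        [ (λ e → ⊥-elim (u≢p (trans (sym xu) (f⇒h (convex e inx)))))
        , (λ e → nest e xy (λ xp → u≢p (trans (sym xu) (g⇒h xp))) inx) ]′ pq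

  -- A block of `f` or `g` leaving the span of `a` and `b` would have an arc over exactly one of
  -- them. As both lie in one class of `h`, `chord` excludes this.
  join-nested : Nested h
  join-nested {a} {b} {x} {y} ab xy x≢a inx =
    proj₂ (sound P (λ e → go (inj₁ e)) (λ e → go (inj₂ e)) xy (x≢a , inx))
    where
    P : Fin n → Set
    P z = h z ≢ h a × Between a b z
    go : ∀ {z w} → f z ≡ f w ⊎ g z ≡ g w → P z → P w
    go {z} {w} zw (z≢a , a<z , z<b) = w≢a , bet
      where
      zw′ : h z ≡ h w
      zw′ = [ f⇒h , g⇒h ]′ zw
      w≢a : h w ≢ h a
      w≢a e = z≢a (trans zw′ e)
      wz : f w ≡ f z ⊎ g w ≡ g z
      wz = Sum.map sym sym zw
      bet : Between a b w
      bet with <-cmp a w | <-cmp w b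
      ... | tri< a<w _ _ | tri< w<b _ _ = a<w , w<b
      ... | tri> _ _ w<a | _ = ⊥-elim (ℕₚ.<-asym z<b
              (proj₂ (chord wz ab (w≢a ∘ sym) (w<a , a<z))))
      ... | _ | tri> _ _ b<w = ⊥-elim (ℕₚ.<-asym a<z
              (proj₁ (chord zw (sym ab) (λ e → z≢a (trans (sym e) (sym ab))) (z<b , b<w))))
      ... | tri≈ _ refl _ | _ = ⊥-elim (w≢a refl)
      ... | _ | tri≈ _ refl _ = ⊥-elim (w≢a (sym ab))

module _ {n : ℕ} where

  private
    _at_ : (σ : NC n) → Fin n → Fin (#blocks (partition σ))
    σ at i = block (partition σ) i

  size : NC n → ℕ
  size σ = #blocks (partition σ)

  ⊑⇒refines : ∀ {σ τ : NC n} → σ ⊑ τ → ∀ {x y} → σ at x ≡ σ at y → τ at x ≡ τ at y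
  ⊑⇒refines {σ} s {x} {y} e with s (σ at y)
  ... | W , all = trans (all x e) (sym (all y refl))

  refines⇒⊑ : ∀ {σ τ : NC n} → (∀ {x y} → σ at x ≡ σ at y → τ at x ≡ τ at y) → σ ⊑ τ
  refines⇒⊑ {σ} {τ} r V with nonempty (partition σ) V
  ... | i , refl = τ at i , λ x e → r e

  ≈⇒⊑ : ∀ {σ τ : NC n} → σ ≈ τ → σ ⊑ τ
  ≈⇒⊑ {σ} {τ} e = refines⇒⊑ {σ} {τ} (λ {x} {y} → to (e x y))

  ≈-refl : ∀ {σ : NC n} → σ ≈ σ
  ≈-refl i j = mk⇔ id id

  ≈-sym : ∀ {σ τ : NC n} → σ ≈ τ → τ ≈ σ
  ≈-sym e i j = mk⇔ (from (e i j)) (to (e i j))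

  ≈-trans : ∀ {σ τ υ : NC n} → σ ≈ τ → τ ≈ υ → σ ≈ υ
  ≈-trans e f i j = mk⇔ (to (f i j) ∘ to (e i j)) (from (e i j) ∘ from (f i j))

  ⊑-trans : ∀ {σ τ υ : NC n} → σ ⊑ τ → τ ⊑ υ → σ ⊑ υ
  ⊑-trans {σ} {τ} {υ} s t = refines⇒⊑ {σ} {υ} (⊑⇒refines {τ} {υ} t ∘ ⊑⇒refines {σ} {τ} s)

  ⊏-respˡ : ∀ {σ τ υ : NC n} → σ ≈ τ → τ ⊏ υ → σ ⊏ υ
  ⊏-respˡ {σ} {τ} {υ} e (s , ne) = ⊑-trans {σ} {τ} {υ} (≈⇒⊑ {σ} {τ} e) s ,
    λ f → ne (≈-trans {τ} {σ} {υ} (≈-sym {σ} {τ} e) f)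

  ⊏-respʳ : ∀ {σ τ υ : NC n} → σ ≈ τ → υ ⊏ τ → υ ⊏ σ
  ⊏-respʳ {σ} {τ} {υ} e (s , ne) = ⊑-trans {υ} {τ} {σ} s (≈⇒⊑ {τ} {σ} (≈-sym {σ} {τ} e)) ,
    λ f → ne (≈-trans {υ} {σ} {τ} f e)

  walk-resp : ∀ {σ τ υ : NC n} {l} → σ ≈ τ → HasseWalk τ υ l → HasseWalk σ υ l
  walk-resp {σ} {τ} {υ} e (stop f) = stop (≈-trans {σ} {τ} {υ} e f)
  walk-resp {σ} {τ} e (step {σ = φ} (inj₁ (s , none)) w) =
    step (inj₁ (⊏-respˡ {σ} {τ} {φ} e s ,
      λ (x , p , q) → none (x , ⊏-respˡ {τ} {σ} {x} (≈-sym {σ} {τ} e) p , q))) w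
  walk-resp {σ} {τ} e (step {σ = φ} (inj₂ (s , none)) w) =
    step (inj₂ (⊏-respʳ {σ} {τ} {φ} e s ,
      λ (x , p , q) → none (x , p , ⊏-respʳ {τ} {σ} {x} (≈-sym {σ} {τ} e) q))) w

  walk-++ : ∀ {σ τ υ : NC n} {k l} → HasseWalk σ τ k → HasseWalk τ υ l → HasseWalk σ υ (k ℕ.+ l)
  walk-++ (stop e)   v = walk-resp e v
  walk-++ (step s w) v = step s (walk-++ w v)

  walk-reverse : ∀ {σ τ : NC n} {l} → HasseWalk σ τ l → HasseWalk τ σ l
  walk-reverse {σ} {τ} (stop e) = stop (≈-sym {σ} {τ} e)
  walk-reverse {σ} {τ} (step {k = k} s w) = subst (HasseWalk τ σ) (ℕₚ.+-comm k 1)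
    (walk-++ (walk-reverse w) (step {σ = σ} (Sum.swap s) (stop (≈-refl {σ}))))

  -- Consecutive elements of a `τ`-block in different `σ`-blocks. Consecutiveness keeps the union of
  -- these `σ`-blocks from crossing a third one.
  record Gap (σ τ : NC n) : Set where
    field
      i j     : Fin n
      i<j     : i Fin.< j
      together : τ at i ≡ τ at j
      apart   : σ at i ≢ σ at j
      none    : ∀ {k} → Between i j k → τ at k ≢ τ at i

  -- `l` bounds the distance from `i` to `j`. A point of their `τ`-block between them is separated
  -- by `σ` from one of the two, which gives a closer pair.
  gap : ∀ {σ τ : NC n} {i j} l → toℕ j ℕ.≤ toℕ i ℕ.+ l → i Fin.< j →
        τ at i ≡ τ at j → σ at i ≢ σ at j → Gap σ τ
  gap {i = i} {j} zero j≤i i<j _ _ =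
    ⊥-elim (ℕₚ.<⇒≱ i<j (subst (toℕ j ℕ.≤_) (ℕₚ.+-identityʳ (toℕ i)) j≤i))
  gap {σ} {τ} {i} {j} (suc l) j≤ i<j tog apart
    with any? (λ k → (i <? k) ×-dec (k <? j) ×-dec ((τ at k) ≟ (τ at i)))
  ... | no none = record
    { i = i ; j = j ; i<j = i<j ; together = tog ; apart = apart
    ; none = λ {k} (i<k , k<j) e → none (k , i<k , k<j , e) }
  ... | yes (k , i<k , k<j , e) with (σ at i) ≟ (σ at k)
  ...   | no ik = gap {σ} {τ} l (ℕₚ.≤-pred (ℕₚ.≤-trans k<j (subst (toℕ j ℕ.≤_) (ℕₚ.+-suc (toℕ i) l) j≤)))
                      i<k (sym e) ik
  ...   | yes ik = gap {σ} {τ} l (ℕₚ.≤-trans (subst (toℕ j ℕ.≤_) (ℕₚ.+-suc (toℕ i) l) j≤) (ℕₚ.+-monoˡ-≤ l i<k))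
                      k<j (trans e tog) (λ kj → apart (trans ik kj))

  module Fuse {σ τ : NC n} (σ⊑τ : σ ⊑ τ) (g : Gap σ τ) where
    open Gap g
    open Merging (merging apart) renaming (size to size′; size-≡ to size′-≡)

    private
      fine : ∀ {x y} → σ at x ≡ σ at y → τ at x ≡ τ at y
      fine = ⊑⇒refines {σ} {τ} σ⊑τ

      f : Fin n → Fin size′
      f x = collapse (σ at x)

      -- If the third block lies in another `τ`-block, `τ` is noncrossing. If it lies in that of
      -- `i`, its chord could separate `i` from `j` only with an end strictly between them, against
      -- `none`.
      across : ∀ {a b} → σ at a ≡ σ at b → σ at i ≢ σ at a → σ at j ≢ σ at a →
               (Between a b i → Between a b j) × (Between a b j → Between a b i)
      across {a} {b} ab i≢a j≢a with (τ at i) ≟ (τ at a)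
      ... | no ne = nested τ (fine ab) together ne
                  , nested τ (fine ab) (sym together) (λ e → ne (trans together e))
      ... | yes e = right , left
        where
        right : Between a b i → Between a b j
        right (a<i , i<b) with <-cmp j b
        ... | tri< j<b _ _ = ℕₚ.<-trans a<i i<j , j<b
        ... | tri≈ _ refl _ = ⊥-elim (j≢a (sym ab))
        ... | tri> _ _ b<j = ⊥-elim (none (i<b , b<j) (trans (sym (fine ab)) (sym e)))
        left : Between a b j → Between a b i
        left (a<j , j<b) with <-cmp a i
        ... | tri< a<i _ _ = a<i , ℕₚ.<-trans i<j j<b
        ... | tri≈ _ refl _ = ⊥-elim (i≢a refl)
        ... | tri> _ _ i<a = ⊥-elim (none (i<a , a<j) (sym e))

      cross : ∀ {a b p q} → σ at a ≡ σ at b → f p ≢ f a →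
              (σ at p ≡ σ at i × σ at q ≡ σ at j) ⊎ (σ at p ≡ σ at j × σ at q ≡ σ at i) →
              Between a b p → Between a b q
      cross {a} {b} {p} {q} ab p≢a (inj₁ (pi , qj)) inp =
        nested σ ab (sym qj) j≢a (proj₁ (across ab i≢a j≢a)
          (nested σ ab pi (λ e → p≢a (cong collapse e)) inp))
        where
        i≢a : σ at i ≢ σ at a
        i≢a e = p≢a (cong collapse (trans pi e))
        j≢a : σ at j ≢ σ at a
        j≢a e = p≢a (trans (cong collapse pi) (trans merges (cong collapse e)))
      cross {a} {b} {p} {q} ab p≢a (inj₂ (pj , qi)) inp =
        nested σ ab (sym qi) i≢a (proj₂ (across ab i≢a j≢a)
          (nested σ ab pj (λ e → p≢a (cong collapse e)) inp))
        where
        j≢a : σ at j ≢ σ at a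
        j≢a e = p≢a (cong collapse (trans pj e))
        i≢a : σ at i ≢ σ at a
        i≢a e = p≢a (trans (cong collapse pj) (trans (sym merges) (cong collapse e)))

      swap : ∀ {p q} →
              (σ at p ≡ σ at i × σ at q ≡ σ at j) ⊎ (σ at p ≡ σ at j × σ at q ≡ σ at i) →
              (σ at q ≡ σ at i × σ at p ≡ σ at j) ⊎ (σ at q ≡ σ at j × σ at p ≡ σ at i)
      swap (inj₁ (a , b)) = inj₂ (b , a)
      swap (inj₂ (a , b)) = inj₁ (b , a)

      f-nested : Nested f
      f-nested {a} {b} {x} {y} ab xy x≢a inx with separates ab | separates xy
      ... | inj₁ ab′ | inj₁ xy′ = nested σ ab′ xy′ (λ e → x≢a (cong collapse e)) inx
      ... | inj₁ ab′ | inj₂ split = cross ab′ x≢a split inx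
      -- Here `a` and `b` lie in the two fused blocks. With `y` outside their span, the chord
      -- between `x` and `y` would pass over only one of them, against `cross`.
      ... | inj₂ split | inj₁ xy′ = bet
        where
        bet : Between a b y
        bet with <-cmp a y | <-cmp y b
        ... | tri< a<y _ _ | tri< y<b _ _ = a<y , y<b
        ... | tri> _ _ y<a | _ = ⊥-elim (ℕₚ.<-asym (proj₂ inx)
          (proj₂ (cross {y} {x} (sym xy′) (λ e → x≢a (trans xy (sym e))) split (y<a , proj₁ inx))))
        ... | _ | tri> _ _ b<y = ⊥-elim (ℕₚ.<-asym (proj₁ inx)
          (proj₁ (cross {x} {y} xy′ (λ e → x≢a (trans (sym e) (sym ab))) (swap split) (proj₂ inx , b<y))))
        ... | tri≈ _ refl _ | _ = ⊥-elim (x≢a xy)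
        ... | _ | tri≈ _ refl _ = ⊥-elim (x≢a (trans xy (sym ab)))
      ... | inj₂ s₁ | inj₂ s₂ = ⊥-elim (x≢a (trans (toI s₂) (sym (toI s₁))))
        where
        toI : ∀ {p q} →
              (σ at p ≡ σ at i × σ at q ≡ σ at j) ⊎ (σ at p ≡ σ at j × σ at q ≡ σ at i) →
              f p ≡ f i
        toI (inj₁ (p , _)) = cong collapse p
        toI (inj₂ (p , _)) = trans (cong collapse p) (sym merges)

      π : Partition n
      π = record
        { #blocks = size′ ; block = f
        ; nonempty = λ Z → let (X , p) = hits Z ; (x , q) = nonempty (partition σ) X in
                           x , trans (cong collapse q) p }

    fused : NC n
    fused = record { partition = π ; nonCrossing = nested⇒nonCrossing π f-nested }

    size-fused : size σ ≡ suc (size fused)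
    size-fused = sym size′-≡

    σ⊑fused : σ ⊑ fused
    σ⊑fused = refines⇒⊑ {σ} {fused} (cong collapse)

    fused⊑ : ∀ (υ : NC n) → σ ⊑ υ → υ at i ≡ υ at j → fused ⊑ υ
    fused⊑ υ s e = refines⇒⊑ {fused} {υ} go
      where
      r : ∀ {x y} → σ at x ≡ σ at y → υ at x ≡ υ at y
      r = ⊑⇒refines {σ} {υ} s
      go : ∀ {x y} → f x ≡ f y → υ at x ≡ υ at y
      go xy with separates xy
      ... | inj₁ p              = r p
      ... | inj₂ (inj₁ (p , q)) = trans (r p) (trans e (sym (r q)))
      ... | inj₂ (inj₂ (p , q)) = trans (r p) (trans (sym e) (sym (r q)))

    σ⊏fused : σ ⊏ fused
    σ⊏fused = σ⊑fused , λ e → apart (from (e i j) merges)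

    -- An intermediate partition joining `i` and `j` is already above `fused`; one that does not
    -- join them is below `σ`.
    cover : σ ⋖ fused
    cover = σ⊏fused , between
      where
      between : ¬ (∃[ υ ] (σ ⊏ υ × υ ⊏ fused))
      between (υ , (σ⊑υ , σ≉υ) , υ⊑f , υ≉f) with (υ at i) ≟ (υ at j)
      ... | yes e = υ≉f λ x y → mk⇔ (⊑⇒refines {υ} {fused} υ⊑f)
                                    (⊑⇒refines {fused} {υ} (fused⊑ υ σ⊑υ e))
      ... | no ne = σ≉υ λ x y → mk⇔ r (back x y)
        where
        r : ∀ {x y} → σ at x ≡ σ at y → υ at x ≡ υ at y
        r = ⊑⇒refines {σ} {υ} σ⊑υ
        back : ∀ x y → υ at x ≡ υ at y → σ at x ≡ σ at y
        back x y xy with separates (⊑⇒refines {υ} {fused} υ⊑f xy)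
        ... | inj₁ p              = p
        ... | inj₂ (inj₁ (p , q)) = ⊥-elim (ne (trans (sym (r p)) (trans xy (r q))))
        ... | inj₂ (inj₂ (p , q)) = ⊥-elim (ne (trans (sym (r q)) (trans (sym xy) (r p))))

  gap? : ∀ (σ τ : NC n) → Gap σ τ ⊎ (∀ {x y} → τ at x ≡ τ at y → σ at x ≡ σ at y)
  gap? σ τ with any? (λ x → any? (λ y → (x <? y) ×-dec ((τ at x) ≟ (τ at y)) ×-dec ¬? ((σ at x) ≟ (σ at y))))
  ... | yes (x , y , x<y , t , s) = inj₁ (gap {σ} {τ} (toℕ y) (ℕₚ.m≤n+m (toℕ y) (toℕ x)) x<y t s)
  ... | no none = inj₂ back
    where
    back : ∀ {x y} → τ at x ≡ τ at y → σ at x ≡ σ at y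
    back {x} {y} t with (σ at x) ≟ (σ at y)
    ... | yes s = s
    ... | no s with <-cmp x y
    ...   | tri< x<y _ _ = ⊥-elim (none (x , y , x<y , t , s))
    ...   | tri≈ _ refl _ = refl
    ...   | tri> _ _ y<x = ⊥-elim (none (y , x , y<x , sym t , s ∘ sym))

  refines⇒size : ∀ {σ τ : NC n} → (∀ {x y} → σ at x ≡ σ at y → τ at x ≡ τ at y) → size τ ℕ.≤ size σ
  refines⇒size {σ} {τ} r = injective⇒≤ {f = λ V → σ at pt V} inj
    where
    pt : Fin (size τ) → Fin n
    pt V = proj₁ (nonempty (partition τ) V)
    inj : ∀ {V W} → σ at pt V ≡ σ at pt W → V ≡ W
    inj {V} {W} e = trans (sym (proj₂ (nonempty (partition τ) V)))
                          (trans (r e) (proj₂ (nonempty (partition τ) W)))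

  -- Fusing a gap is a cover that stays below `τ` and loses one block, so the length is the
  -- difference of the numbers of blocks. The recursion runs on `k`, the number of blocks of `σ`.
  ascend : ∀ k {σ τ : NC n} → size σ ≡ k → σ ⊑ τ →
           ∃[ l ] (HasseWalk σ τ l × size σ ≡ l ℕ.+ size τ)
  ascend k {σ} {τ} eq s with gap? σ τ
  ... | inj₂ back = 0 , stop (λ x y → mk⇔ (⊑⇒refines {σ} {τ} s) back) ,
    ℕₚ.≤-antisym (refines⇒size {τ} {σ} back) (refines⇒size {σ} {τ} (⊑⇒refines {σ} {τ} s))
  ascend zero {σ} {τ} eq s | inj₁ g with trans (sym eq) (Fuse.size-fused {σ} {τ} s g)
  ... | ()
  ascend (suc k) {σ} {τ} eq s | inj₁ g
    with ascend k (ℕₚ.suc-injective (trans (sym (Fuse.size-fused {σ} {τ} s g)) eq)) (Fuse.fused⊑ {σ} {τ} s g τ s (Gap.together g))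
  ... | l , w , e = suc l , step {σ = Fuse.fused {σ} {τ} s g} (inj₁ (Fuse.cover {σ} {τ} s g)) w ,
    trans (Fuse.size-fused {σ} {τ} s g) (cong suc e)

  -- Fusing a gap gives a partition strictly above `σ` and below `τ`, which must then be all of `τ`.
  -- So one cover costs one generating pair, and this is what bounds walks from below.
  generated : ∀ {σ τ : NC n} → σ ⋖ τ → ∃[ i ] ∃[ j ] (∀ P →
    Respects (σ at_) P → (P i → P j) → (P j → P i) → Respects (τ at_) P)
  generated {σ} {τ} ((s , ne) , none) with gap? σ τ
  ... | inj₂ back = ⊥-elim (ne λ x y → mk⇔ (⊑⇒refines {σ} {τ} s) back)
  ... | inj₁ g = i , j , go
    where
    open Gap g using (i; j; together; apart)
    open Fuse {σ} {τ} s g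
    open Merging (merging apart) using (separates)
    go : ∀ P → Respects (σ at_) P → (P i → P j) → (P j → P i) → Respects (τ at_) P
    go P resp ij ji {x} {y} xy px with (fused at x) ≟ (fused at y)
    ... | no diff = ⊥-elim (none (fused , σ⊏fused , fused⊑ τ s together ,
                                  λ e → diff (from (e x y) xy)))
    ... | yes eq with separates eq
    ...   | inj₁ p              = resp p px
    ...   | inj₂ (inj₁ (p , q)) = resp (sym q) (ij (resp p px))
    ...   | inj₂ (inj₂ (p , q)) = resp (sym q) (ji (resp p px))

  discrete : NC n
  discrete = record
    { partition = π
    ; nonCrossing = λ V≢W a<b b<c _ aV cV _ _ →
        ℕₚ.<-irrefl (cong toℕ (trans aV (sym cV))) (ℕₚ.<-trans a<b b<c) }
    where
    π : Partition n
    π = record { #blocks = n ; block = id ; nonempty = λ i → i , refl }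

  discrete⊑ : ∀ (σ : NC n) → discrete ⊑ σ
  discrete⊑ σ = refines⇒⊑ {discrete} {σ} (cong (σ at_))

-- Distance n - 1 and trees

Constant⇒≤1 : ∀ {k} → (∀ (c d : Fin k) → c ≡ d) → k ℕ.≤ 1
Constant⇒≤1 {zero}        _ = ℕ.z≤n
Constant⇒≤1 {suc zero}    _ = ℕₚ.≤-refl
Constant⇒≤1 {suc (suc k)} c with c zero (suc zero)
... | ()

EdgeConnected : ∀ {n B W} → (Fin n → Fin B) → (Fin n → Fin W) → Set₁
EdgeConnected black white =
  ∀ P → Respects black P → Respects white P → ∀ x y → P x → P y

module Bipartite {n B W : ℕ} (black : Fin n → Fin B) (white : Fin n → Fin W) where

  s t : Fin n → Fin (B ℕ.+ W)
  s e = black e ↑ˡ W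
  t e = B ↑ʳ white e

  open Components (components s t) public

  class : Fin n → Fin #comps
  class e = comp (s e)

  black⇒class : ∀ {x y} → black x ≡ black y → class x ≡ class y
  black⇒class = cong (λ V → comp (V ↑ˡ W))

  white⇒class : ∀ {x y} → white x ≡ white y → class x ≡ class y
  white⇒class {x} {y} e =
    trans (joins x) (trans (cong (λ V → comp (B ↑ʳ V)) e) (sym (joins y)))

  -- A predicate on edges becomes one on vertices by asking it of all edges at the vertex.
  -- Compatibility with both colours makes it invariant, so `sound` applies.
  class-sound : ∀ P → Respects black P → Respects white P → Respects class P
  class-sound P onB onW {x} {y} xy px = fromS y (sound (Q ∘ splitAt B) closed xy (toS x px))
    where
    Q : Fin B ⊎ Fin W → Set
    Q (inj₁ V) = ∀ e → black e ≡ V → P e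
    Q (inj₂ V) = ∀ e → white e ≡ V → P e
    toS : ∀ e → P e → Q (splitAt B (s e))
    toS e p rewrite splitAt-↑ˡ B (black e) W = λ e′ q → onB (sym q) p
    toT : ∀ e → P e → Q (splitAt B (t e))
    toT e p rewrite splitAt-↑ʳ B W (white e) = λ e′ q → onW (sym q) p
    fromS : ∀ e → Q (splitAt B (s e)) → P e
    fromS e q rewrite splitAt-↑ˡ B (black e) W = q e refl
    fromT : ∀ e → Q (splitAt B (t e)) → P e
    fromT e q rewrite splitAt-↑ʳ B W (white e) = q e refl
    closed : Closed s t (λ _ → ⊤) (Q ∘ splitAt B)
    closed e _ = toT e ∘ fromS e , toS e ∘ fromT e

  module _ (blacks : StrictlySurjective _≡_ black) (whites : StrictlySurjective _≡_ white) where

    on-edge : ∀ v → ∃[ e ] (s e ≡ v ⊎ t e ≡ v)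
    on-edge v with splitAt B v in eq
    ... | inj₁ V = let (e , p) = blacks V in
      e , inj₁ (trans (cong (_↑ˡ W) p) (splitAt⁻¹-↑ˡ eq))
    ... | inj₂ V = let (e , p) = whites V in
      e , inj₂ (trans (cong (B ↑ʳ_) p) (splitAt⁻¹-↑ʳ eq))

    class-onto : StrictlySurjective _≡_ class
    class-onto c with onto c
    ... | v , refl with on-edge v
    ...   | e , inj₁ refl = e , refl
    ...   | e , inj₂ refl = e , joins e

    -- Every vertex lies on an edge, and `h` takes the same value on all edges. A general `h` serves
    -- the components of the graph as well as those left after deleting an edge.
    connected⇒≤1 : EdgeConnected black white → ∀ {k} (h : Fin (B ℕ.+ W) → Fin k) →
                   StrictlySurjective _≡_ h → (∀ e → h (s e) ≡ h (t e)) → k ℕ.≤ 1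
    connected⇒≤1 conn h onto joins = Constant⇒≤1 λ c d →
      let (x , p) = edge c ; (y , q) = edge d in trans (sym p) (trans (sym (reach x y)) q)
      where
      edge : ∀ c → ∃[ e ] h (s e) ≡ c
      edge c with onto c
      ... | v , refl with on-edge v
      ...   | e , inj₁ refl = e , refl
      ...   | e , inj₂ refl = e , joins e
      reach : ∀ x y → h (s y) ≡ h (s x)
      reach x y = conn (λ e → h (s e) ≡ h (s x))
        (λ p q → trans (cong (λ V → h (V ↑ˡ W)) (sym p)) q)
        (λ {z} {w} p q → trans (joins w) (trans (cong (λ V → h (B ↑ʳ V)) (sym p)) (trans (sym (joins z)) q)))
        x y refl

    connected⇒#comps≤1 : EdgeConnected black white → #comps ℕ.≤ 1
    connected⇒#comps≤1 conn = connected⇒≤1 conn comp onto joins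

    connected⇒bound : EdgeConnected black white → B ℕ.+ W ℕ.≤ suc n
    connected⇒bound conn = ℕₚ.≤-trans bound (ℕₚ.+-monoˡ-≤ n (connected⇒#comps≤1 conn))

module _ {n : ℕ} (π ρ : NC n) where
  private
    open module BP = Bipartite (block (partition π)) (block (partition ρ))

  join : IsInterval (partition π) → NC n
  join interval = record
    { partition = σ
    ; nonCrossing = nested⇒nonCrossing σ
        (join-nested (interval⇒convex (partition π) interval) (nested ρ)
          black⇒class white⇒class class-sound) }
    where
    σ : Partition n
    σ = record
      { #blocks = #comps ; block = class
      ; nonempty = class-onto (nonempty (partition π)) (nonempty (partition ρ)) }

  walk-through-join : IsInterval (partition π) → ∃[ l ] (HasseWalk π ρ l ×
                      size π ℕ.+ size ρ ≡ l ℕ.+ (#comps ℕ.+ #comps))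
  walk-through-join interval
    with ascend _ {π} {join interval} refl (refines⇒⊑ {σ = π} {join interval} black⇒class)
       | ascend _ {ρ} {join interval} refl (refines⇒⊑ {σ = ρ} {join interval} white⇒class)
  ... | k , v , p | l , w , q = k ℕ.+ l , walk-++ v (walk-reverse w) ,
    trans (cong₂ ℕ._+_ p q) (arith k #comps l)
    where
    arith : ∀ a b c → (a ℕ.+ b) ℕ.+ (c ℕ.+ b) ≡ (a ℕ.+ c) ℕ.+ (b ℕ.+ b)
    arith = solve-∀

walk-through-discrete : ∀ {n} (π ρ : NC n) → ∃[ l ] (HasseWalk π ρ l ×
                        n ℕ.+ n ≡ l ℕ.+ (size π ℕ.+ size ρ))
walk-through-discrete {n} π ρ
  with ascend n {discrete} {π} refl (discrete⊑ π) | ascend n {discrete} {ρ} refl (discrete⊑ ρ)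
... | k , v , p | l , w , q = k ℕ.+ l , walk-++ (walk-reverse v) w ,
  trans (cong₂ ℕ._+_ p q) (arith k (size π) l (size ρ))
  where
  arith : ∀ a b c d → (a ℕ.+ b) ℕ.+ (c ℕ.+ d) ≡ (a ℕ.+ c) ℕ.+ (b ℕ.+ d)
  arith = solve-∀

module _ {m : ℕ} (π ρ : NC (suc m)) (interval : IsInterval (partition π)) where
  private
    open module BP = Bipartite (block (partition π)) (block (partition ρ))
    blacks = nonempty (partition π)
    whites = nonempty (partition ρ)

    1≤#comps : 1 ℕ.≤ #comps
    1≤#comps = ℕₚ.≤-trans (ℕ.s≤s ℕ.z≤n) (toℕ<n (class zero))

  module _ (far : ∀ l → HasseWalk π ρ l → m ℕ.≤ l) where
    private
      sum≤ : size π ℕ.+ size ρ ℕ.≤ suc (suc m)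
      sum≤ = let (l , w , e) = walk-through-discrete π ρ in ℕₚ.+-cancelˡ-≤ m _ _ (begin
        m ℕ.+ (size π ℕ.+ size ρ) ≤⟨ ℕₚ.+-monoˡ-≤ _ (far l w) ⟩
        l ℕ.+ (size π ℕ.+ size ρ) ≡⟨ sym e ⟩
        suc m ℕ.+ suc m           ≡⟨ sym (ℕₚ.+-suc m (suc m)) ⟩
        m ℕ.+ suc (suc m)         ∎)
        where open ℕₚ.≤-Reasoning
      comps+≤ : m ℕ.+ (#comps ℕ.+ #comps) ℕ.≤ size π ℕ.+ size ρ
      comps+≤ = let (l , w , e) = walk-through-join π ρ interval in
        subst (m ℕ.+ (#comps ℕ.+ #comps) ℕ.≤_) (sym e) (ℕₚ.+-monoˡ-≤ _ (far l w))

    -- The two walks bound the number of blocks by `m` + 2 from above and by `m` + 2 `#comps` from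
    -- below. As `#comps` is at least 1, the bounds meet.
    far⇒count : size π ℕ.+ size ρ ≡ suc (suc m)
    far⇒count = ℕₚ.≤-antisym sum≤ (begin
      suc (suc m)               ≡⟨ ℕₚ.+-comm 2 m ⟩
      m ℕ.+ 2                   ≤⟨ ℕₚ.+-monoʳ-≤ m (ℕₚ.+-mono-≤ 1≤#comps 1≤#comps) ⟩
      m ℕ.+ (#comps ℕ.+ #comps) ≤⟨ comps+≤ ⟩
      size π ℕ.+ size ρ         ∎)
      where open ℕₚ.≤-Reasoning

    far⇒connected : EdgeConnected (block (partition π)) (block (partition ρ))
    far⇒connected P onB onW x y = class-sound P onB onW (single (class x) (class y))
      where
      twice : #comps ℕ.+ #comps ℕ.≤ 2
      twice = ℕₚ.+-cancelˡ-≤ m _ _ (ℕₚ.≤-trans comps+≤ (ℕₚ.≤-trans sum≤ (ℕₚ.≤-reflexive (ℕₚ.+-comm 2 m))))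
      single : ∀ (c d : Fin #comps) → c ≡ d
      single = one #comps twice
        where
        one : ∀ k → k ℕ.+ k ℕ.≤ 2 → ∀ (c d : Fin k) → c ≡ d
        one (suc zero)    _ zero zero = refl
        one (suc (suc k)) (ℕ.s≤s h) with subst (ℕ._≤ 1) (ℕₚ.+-suc (suc k) (suc k)) h
        ... | ℕ.s≤s ()

-- On a walk with u covers upwards and d covers downwards, u pairs generate the
-- target from the source, and d pairs the source from the target.

Extends : ∀ {n} → NC n → NC n → ℕ → Set₁
Extends {n} σ τ u = Σ[ i ∈ (Fin u → Fin n) ] Σ[ j ∈ (Fin u → Fin n) ] (∀ P →
  Respects (block (partition σ)) P →
  (∀ e → (P (i e) → P (j e)) × (P (j e) → P (i e))) → Respects (block (partition τ)) P)

walk-extends : ∀ {n} {σ τ : NC n} {l} → HasseWalk σ τ l →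
               ∃[ u ] ∃[ d ] (u ℕ.+ d ≡ l × Extends σ τ u × Extends τ σ d)
walk-extends {σ = σ} {τ} (stop e) = 0 , 0 , refl ,
  ((λ ()) , (λ ()) , λ P r _ {x} {y} xy → r (Equivalence.from (e x y) xy)) ,
  ((λ ()) , (λ ()) , λ P r _ {x} {y} xy → r (Equivalence.to (e x y) xy))
walk-extends {n} {σ} {τ} (step {σ = υ} (inj₁ up) w) with generated {σ = σ} {υ} up | walk-extends w
... | a , b , gen | u , d , eq , (i , j , ext) , (i′ , j′ , ext′) =
  suc u , d , cong suc eq ,
  ( (λ { zero → a ; (suc e) → i e }) , (λ { zero → b ; (suc e) → j e })
  , λ P r pairs → ext P (gen P r (proj₁ (pairs zero)) (proj₂ (pairs zero))) (pairs ∘ suc) ) ,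
  -- Read backwards, an upward step only refines, so this direction takes no further pair.
  ( i′ , j′ , λ P r pairs xy → ext′ P r pairs (⊑⇒refines {σ = σ} {υ} (proj₁ (proj₁ up)) xy))
walk-extends {n} {σ} {τ} (step {σ = υ} (inj₂ down) w) with generated {σ = υ} {σ} down | walk-extends w
... | a , b , gen | u , d , eq , (i , j , ext) , (i′ , j′ , ext′) =
  u , suc d , trans (ℕₚ.+-suc u d) (cong suc eq) ,
  ( i , j , λ P r pairs → ext P (λ xy → r (⊑⇒refines {σ = υ} {σ} (proj₁ (proj₁ down)) xy)) pairs ) ,
  ( (λ { zero → a ; (suc e) → i′ e }) , (λ { zero → b ; (suc e) → j′ e })
  , λ P r pairs → gen P (ext′ P r (pairs ∘ suc)) (proj₁ (pairs zero)) (proj₂ (pairs zero)) )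

-- Take the blocks of `σ` as vertices and the pairs as edges. The graph is connected, because a
-- predicate compatible with `σ` and the pairs is also compatible with `τ`; so it has at most `u` +
-- 1 vertices.
extends-bound : ∀ {n} {σ τ : NC n} {u} → Extends σ τ u →
  (∀ P → Respects (block (partition σ)) P → Respects (block (partition τ)) P → ∀ x y → P x → P y) →
  size σ ℕ.≤ suc u
extends-bound {n} {σ} {τ} {u} (i , j , ext) conn =
  ℕₚ.≤-trans bound (ℕₚ.+-monoˡ-≤ u (Constant⇒≤1 λ c d →
    let (x , p) = edge c ; (y , q) = edge d in trans (sym p) (trans (sym (reach x y)) q)))
  where
  b : Fin n → Fin (size σ)
  b = block (partition σ)
  open Components (components (b ∘ i) (b ∘ j))
  edge : ∀ c → ∃[ x ] comp (b x) ≡ c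
  edge c with onto c
  ... | V , refl with nonempty (partition σ) V
  ...   | x , refl = x , refl
  reach : ∀ x y → comp (b y) ≡ comp (b x)
  reach x y = conn P onσ (ext P onσ λ e → trans (sym (joins e)) , trans (joins e)) x y refl
    where
    P : Fin n → Set
    P e = comp (b e) ≡ comp (b x)
    onσ : Respects b P
    onσ p q = trans (cong comp (sym p)) q

module _ {m : ℕ} (π ρ : NC (suc m))
         (conn : EdgeConnected (block (partition π)) (block (partition ρ)))
         (count : size π ℕ.+ size ρ ≡ suc (suc m)) where

  connected⇒far : ∀ l → HasseWalk π ρ l → m ℕ.≤ l
  connected⇒far l w with walk-extends w
  ... | u , d , refl , ext , ext′ = ℕₚ.≤-pred (ℕₚ.≤-pred (begin
    suc (suc m)           ≡⟨ sym count ⟩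
    size π ℕ.+ size ρ     ≤⟨ ℕₚ.+-mono-≤ (extends-bound {σ = π} {ρ} ext conn)
                               (extends-bound {σ = ρ} {π} ext′ λ P r s → conn P s r) ⟩
    suc u ℕ.+ suc d       ≡⟨ cong suc (ℕₚ.+-suc u d) ⟩
    suc (suc (u ℕ.+ d))   ∎))
    where open ℕₚ.≤-Reasoning

  connected⇒distance : IsInterval (partition π) → HasseDistance π ρ m
  connected⇒distance interval = short , connected⇒far
    where
    open Bipartite (block (partition π)) (block (partition ρ))
    short : HasseWalk π ρ m
    short =
      let (l , w , e) = walk-through-join π ρ interval
          one = ℕₚ.≤-antisym
            (connected⇒#comps≤1 (nonempty (partition π)) (nonempty (partition ρ)) conn)
            (ℕₚ.≤-trans (ℕ.s≤s ℕ.z≤n) (toℕ<n (class zero)))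
      in subst (HasseWalk π ρ)
           (ℕₚ.+-cancelʳ-≡ 2 l m (trans (cong (λ k → l ℕ.+ (k ℕ.+ k)) (sym one))
             (trans (sym e) (trans count (ℕₚ.+-comm 2 m))))) w

-- Trees by walks and trees by counting

without : ∀ {V n} (s t : Fin n → Fin V) (e : Fin n) →
  ∃[ k ] Σ[ h ∈ (Fin V → Fin k) ] StrictlySurjective _≡_ h ×
    (∀ e′ → e′ ≢ e → h (s e′) ≡ h (t e′)) × V ℕ.< k ℕ.+ n
without {V} {suc m} s t e = #comps , comp , onto ,
  (λ e′ ne → subst (λ x → comp (s x) ≡ comp (t x)) (punchIn-punchOut (ne ∘ sym)) (joins _)) ,
  -- Only `m` edges are left, one fewer than the original number, hence the strict inequality.
  subst (V ℕ.<_) (sym (ℕₚ.+-suc #comps m)) (ℕ.s≤s bound)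
  where open Components (components (s ∘ punchIn e) (t ∘ punchIn e))

module _ (G : FatGraph) where
  open FatGraph G

  walk-append : ∀ {u v w} → Walk G u v → Walk G v w → Walk G u w
  walk-append stop         v = v
  walk-append (step e j w) v = step e j (walk-append w v)

  module _ (blacks : StrictlySurjective _≡_ blackEnd) (whites : StrictlySurjective _≡_ whiteEnd)
           (conn : EdgeConnected blackEnd whiteEnd) (count : #black ℕ.+ #white ≡ suc #edges) where

    private
      down : ∀ {e V W} → blackEnd e ≡ V → whiteEnd e ≡ W → Walk G (inj₁ V) (inj₂ W)
      down {e} refl refl = step e (inj₁ (refl , refl)) stop

      up : ∀ {e V W} → blackEnd e ≡ V → whiteEnd e ≡ W → Walk G (inj₂ W) (inj₁ V)
      up {e} refl refl = step e (inj₂ (refl , refl)) stop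

      between : ∀ x y → Walk G (inj₁ (blackEnd x)) (inj₁ (blackEnd y))
      between x y = conn (λ e → Walk G (inj₁ (blackEnd x)) (inj₁ (blackEnd e)))
        (λ p w → subst (λ V → Walk G (inj₁ (blackEnd x)) (inj₁ V)) p w)
        (λ p w → walk-append w (walk-append (down refl p) (up refl refl)))
        x y stop

      incident : Vertex G → Fin #edges
      incident (inj₁ V) = proj₁ (blacks V)
      incident (inj₂ W) = proj₁ (whites W)

      leave : ∀ u → Walk G u (inj₁ (blackEnd (incident u)))
      leave (inj₁ V) with blacks V
      ... | e , refl = stop
      leave (inj₂ W) = up refl (proj₂ (whites W))

      arrive : ∀ v → Walk G (inj₁ (blackEnd (incident v))) v
      arrive (inj₁ V) with blacks V
      ... | e , refl = stop
      arrive (inj₂ W) = down refl (proj₂ (whites W))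

    private
      open module BP = Bipartite blackEnd whiteEnd using (s; t; connected⇒≤1)

      vertex : Vertex G → Fin (#black ℕ.+ #white)
      vertex (inj₁ V) = V ↑ˡ #white
      vertex (inj₂ W) = #black ↑ʳ W

    -- The rest of a cycle joins the ends of its first edge `e`. Deleting `e` therefore leaves one
    -- component, with too few edges for the number of vertices.
    connected⇒acyclic : ∀ {v} (w : Walk G v v) → ¬ IsCycle G w
    connected⇒acyclic stop (ne , _) = ne refl
    connected⇒acyclic (step e j w) (_ , fresh ∷ _ , _) with without s t e
    ... | k , h , onto , joins , fewer = ℕₚ.<-irrefl count
      (ℕₚ.≤-trans fewer (ℕₚ.+-monoˡ-≤ #edges (connected⇒≤1 blacks whites conn h onto joins-all)))
      where
      along : ∀ {u v} (w : Walk G u v) → All (e ≢_) (edges G w) → h (vertex u) ≡ h (vertex v)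
      along stop _ = refl
      along (step e′ (inj₁ (refl , refl)) w) (ne ∷ nes) = trans (joins e′ (ne ∘ sym)) (along w nes)
      along (step e′ (inj₂ (refl , refl)) w) (ne ∷ nes) = trans (sym (joins e′ (ne ∘ sym))) (along w nes)
      ends : h (s e) ≡ h (t e)
      ends = around j (along w fresh)
        where
        around : ∀ {u v} → Joins G e u v → h (vertex v) ≡ h (vertex u) → h (s e) ≡ h (t e)
        around (inj₁ (refl , refl)) p = sym p
        around (inj₂ (refl , refl)) p = p
      joins-all : ∀ e′ → h (s e′) ≡ h (t e′)
      joins-all e′ with e′ ≟ e
      ... | yes refl = ends
      ... | no ne    = joins e′ ne

    connected⇒tree : IsTree G
    connected⇒tree = record
      { connected = λ u v → walk-append (leave u) (walk-append (between (incident u) (incident v)) (arrive v))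
      ; acyclic = connected⇒acyclic }

  module _ (tree : IsTree G) where
    open IsTree tree

    tree⇒connected : EdgeConnected blackEnd whiteEnd
    tree⇒connected P onB onW x y px = along (connected (inj₁ (blackEnd x)) (inj₁ (blackEnd y)))
      (λ e p → onB (sym p) px) y refl
      where
      At : Vertex G → Set
      At (inj₁ V) = ∀ e → blackEnd e ≡ V → P e
      At (inj₂ W) = ∀ e → whiteEnd e ≡ W → P e
      along : ∀ {u v} → Walk G u v → At u → At v
      along stop p = p
      along (step e (inj₁ (refl , refl)) w) p = along w λ e′ q → onW (sym q) (p e refl)
      along (step e (inj₂ (refl , refl)) w) p = along w λ e′ q → onB (sym q) (p e refl)

    -- A walk from a white vertex to a black one begins with an edge at the former. Black vertices
    -- have their special edges instead.
    tree⇒whites : Fin #black → StrictlySurjective _≡_ whiteEnd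
    tree⇒whites r W = first (connected (inj₂ W) (inj₁ r))
      where
      first : ∀ {V} → Walk G (inj₂ W) (inj₁ V) → ∃[ e ] whiteEnd e ≡ W
      first (step e (inj₂ (refl , _)) _) = e , refl

    private
      open module BP = Bipartite blackEnd whiteEnd using (s; t; connected⇒#comps≤1; exact; #comps; comp)

      -- Simple walks ready to be closed by `e`. As `vertices` omits the final vertex, `avoids-end`
      -- says that the base point occurs once on the resulting cycle.
      record Path (e : Fin #edges) (v r : Vertex G) : Set where
        constructor path
        field
          walk       : Walk G v r
          edges!     : Unique (edges G walk)
          vertices!  : Unique (vertices G walk)
          avoids-end : All (_≢ r) (vertices G walk)
          avoids     : All (_≢ e) (edges G walk)

      suffix : ∀ {e v v′ r} (p : Path e v r) → v′ ∈ vertices G (Path.walk p) → Path e v′ r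
      suffix p@(path (step _ _ _) _ _ _ _) (here refl) = p
      suffix (path (step _ _ w) (_ ∷ a) (_ ∷ b) (_ ∷ c) (_ ∷ d)) (there i) = suffix (path w a b c d) i

      start : ∀ {x r} (w : Walk G x r) → x ≡ r ⊎ x ∈ vertices G w
      start stop         = inj₁ refl
      start (step _ _ _) = inj₂ (here refl)

      visited : ∀ {e u v x r} (w : Walk G x r) → Joins G e u v → e ∈ edges G w →
                u ≡ r ⊎ u ∈ vertices G w
      visited (step e (inj₁ (refl , refl)) w) (inj₁ (refl , refl)) (here refl) = inj₂ (here refl)
      visited (step e (inj₂ (refl , refl)) w) (inj₂ (refl , refl)) (here refl) = inj₂ (here refl)
      visited (step e (inj₁ (refl , refl)) w) (inj₂ (refl , refl)) (here refl) = Sum.map₂ there (start w)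
      visited (step e (inj₂ (refl , refl)) w) (inj₁ (refl , refl)) (here refl) = Sum.map₂ there (start w)
      visited (step _ _ w) j (there i) = Sum.map₂ there (visited w j i)

      _≟ᵛ_ : (u v : Vertex G) → Dec (u ≡ v)
      _≟ᵛ_ = ≡-dec _≟_ _≟_

      -- Loop erasure: if `u` is already on the path, the path from there on is taken. Otherwise
      -- `e′` is new too, since its presence would make `u` a visited vertex.
      extend : ∀ {e e′ u v r} → e′ ≢ e → Joins G e′ u v → Path e v r → Path e u r
      extend {e} {e′} {u} {v} {r} ne j p@(path w a b c d) with u ≟ᵛ r | Any.any? (u ≟ᵛ_) (vertices G w)
      ... | yes refl | _     = path stop [] [] [] []
      ... | no _     | yes i = suffix p i
      ... | no u≢r   | no u∉ = path (step e′ j w)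
        (¬Any⇒All¬ _ ([ u≢r , u∉ ]′ ∘ visited w j) ∷ a) (¬Any⇒All¬ _ u∉ ∷ b) (u≢r ∷ c) (ne ∷ d)

      -- Having a simple path to the black end of `e` that avoids `e` is invariant along the other
      -- edges. Redundancy would give the white end such a path, which `e` closes to a cycle.
      irredundant : ∀ e → ¬ Redundant s t e
      irredundant e redundant = close (toT (redundant (P ∘ splitAt #black) closed (fromS (path stop [] [] [] []))))
        where
        r : Vertex G
        r = inj₁ (blackEnd e)
        P : Vertex G → Set
        P v = Path e v r
        toS : ∀ {x} → P (splitAt #black (s x)) → P (inj₁ (blackEnd x))
        toS {x} = subst P (splitAt-↑ˡ #black (blackEnd x) #white)
        toT : ∀ {x} → P (splitAt #black (t x)) → P (inj₂ (whiteEnd x))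
        toT {x} = subst P (splitAt-↑ʳ #black #white (whiteEnd x))
        fromS : ∀ {x} → P (inj₁ (blackEnd x)) → P (splitAt #black (s x))
        fromS {x} = subst P (sym (splitAt-↑ˡ #black (blackEnd x) #white))
        fromT : ∀ {x} → P (inj₂ (whiteEnd x)) → P (splitAt #black (t x))
        fromT {x} = subst P (sym (splitAt-↑ʳ #black #white (whiteEnd x)))
        closed : Closed s t (_≢ e) (P ∘ splitAt #black)
        closed e′ ne = (λ p → fromT {e′} (extend ne (inj₂ (refl , refl)) (toS {e′} p)))
                     , (λ p → fromS {e′} (extend ne (inj₁ (refl , refl)) (toT {e′} p)))
        close : Path e (inj₂ (whiteEnd e)) r → ⊥
        close (path w a b c d) = acyclic (step e (inj₁ (refl , refl)) w)
          ( (λ ()) , (All.map (λ ne q → ne (sym q)) d ∷ a) , (All.map (λ ne q → ne (sym q)) c ∷ b) )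

    tree⇒count : Fin #black → StrictlySurjective _≡_ blackEnd → #black ℕ.+ #white ≡ suc #edges
    tree⇒count r blacks with exact
    ... | inj₂ (e , redundant) = ⊥-elim (irredundant e redundant)
    ... | inj₁ eq = trans eq (cong (ℕ._+ #edges) (ℕₚ.≤-antisym
      (connected⇒#comps≤1 blacks (tree⇒whites r) tree⇒connected)
      (ℕₚ.≤-trans (ℕ.s≤s ℕ.z≤n) (toℕ<n (comp (r ↑ˡ #white))))))

-- Cyclic orders and keys

module CyclicOrder {E : Set} {P : E → Set} {C : E → E → E → Set} (order : IsCyclicOrder P C) where
  open IsCyclicOrder order

  distinct : ∀ {a b c} → C a b c → a ≢ b × b ≢ c × a ≢ c
  distinct s = first s , first (cyclic s) , first (cyclic (cyclic s)) ∘ sym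
    where
    first : ∀ {a b c} → C a b c → a ≢ b
    first s refl = asym (cyclic s) (cyclic s)

  drop-first : ∀ {a b c d} → C a b c → C a c d → C b c d
  drop-first s t = cyclic (cyclic (transit (cyclic t) (cyclic (cyclic s))))

  -- The orders are bare relations. On distinct elements of `P` totality selects an orientation and
  -- asymmetry refutes the other.
  dec : Decidable P → (∀ (a b : E) → Dec (a ≡ b)) → ∀ a b c → Dec (C a b c)
  dec P? eq a b c with P? a ×-dec P? b ×-dec P? c ×-dec ¬? (eq a b) ×-dec ¬? (eq b c) ×-dec ¬? (eq a c)
  ... | no ne = no λ s → let (p , q , r) = support s ; (u , v , w) = distinct s in
                         ne (p , q , r , u , v , w)
  ... | yes (p , q , r , u , v , w) with total p q r u v w
  ...   | inj₁ s = yes s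
  ...   | inj₂ s = no λ s′ → asym s′ s

  reflects : ∀ {F : Set} {Q : F → Set} {D : F → F → F → Set} → IsCyclicOrder Q D →
             (f : E → F) → (∀ {a b c} → C a b c → D (f a) (f b) (f c)) →
             ∀ {a b c} → P a → P b → P c → a ≢ b → b ≢ c → a ≢ c →
             D (f a) (f b) (f c) → C a b c
  reflects order′ f pres p q r u v w s with total p q r u v w
  ... | inj₁ t = t
  ... | inj₂ t = ⊥-elim (IsCyclicOrder.asym order′ s (pres t))

Cyc : ℕ → ℕ → ℕ → Set
Cyc a b c = (a < b × b < c) ⊎ (b < c × c < a) ⊎ (c < a × a < b)

Cyc-isCyclicOrder : IsCyclicOrder (λ _ → ⊤) Cyc
Cyc-isCyclicOrder = record
  { support = λ _ → tt , tt , tt ; cyclic = cyc ; asym = asy ; transit = tra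
  ; total = λ _ _ _ → tot }
  where
  cyc : ∀ {a b c} → Cyc a b c → Cyc b c a
  cyc (inj₁ s)        = inj₂ (inj₂ s)
  cyc (inj₂ (inj₁ s)) = inj₁ s
  cyc (inj₂ (inj₂ s)) = inj₂ (inj₁ s)

  clash : ∀ {A : Set} {a b} → a < b → b < a → A
  clash u v = ⊥-elim (ℕₚ.<-asym u v)

  asy : ∀ {a b c} → Cyc a b c → ¬ Cyc c b a
  asy (inj₁ (u , v))        (inj₁ (w , x))        = clash u x
  asy (inj₁ (u , v))        (inj₂ (inj₁ (w , x))) = clash u w
  asy (inj₁ (u , v))        (inj₂ (inj₂ (w , x))) = clash v x
  asy (inj₂ (inj₁ (u , v))) (inj₁ (w , x))        = clash u w
  asy (inj₂ (inj₁ (u , v))) (inj₂ (inj₁ (w , x))) = clash v x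
  asy (inj₂ (inj₁ (u , v))) (inj₂ (inj₂ (w , x))) = clash u x
  asy (inj₂ (inj₂ (u , v))) (inj₁ (w , x))        = clash v x
  asy (inj₂ (inj₂ (u , v))) (inj₂ (inj₁ (w , x))) = clash v w
  asy (inj₂ (inj₂ (u , v))) (inj₂ (inj₂ (w , x))) = clash u w

  tra : ∀ {a b c d} → Cyc a b c → Cyc a c d → Cyc a b d
  tra (inj₁ (u , v))        (inj₁ (w , x))        = inj₁ (u , ℕₚ.<-trans v x)
  tra (inj₁ (u , v))        (inj₂ (inj₁ (w , x))) = clash (ℕₚ.<-trans u v) (ℕₚ.<-trans w x)
  tra (inj₁ (u , v))        (inj₂ (inj₂ (w , x))) = inj₂ (inj₂ (w , u))
  tra (inj₂ (inj₁ (u , v))) (inj₁ (w , x))        = clash v w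
  tra (inj₂ (inj₁ (u , v))) (inj₂ (inj₁ (w , x))) = inj₂ (inj₁ (ℕₚ.<-trans u w , x))
  tra (inj₂ (inj₁ (u , v))) (inj₂ (inj₂ (w , x))) = clash v x
  tra (inj₂ (inj₂ (u , v))) (inj₁ (w , x))        = clash u w
  tra (inj₂ (inj₂ (u , v))) (inj₂ (inj₁ (w , x))) = inj₂ (inj₂ (x , v))
  tra (inj₂ (inj₂ (u , v))) (inj₂ (inj₂ (w , x))) = clash u x

  tot : ∀ {a b c} → a ≢ b → b ≢ c → a ≢ c → Cyc a b c ⊎ Cyc c b a
  tot {a} {b} {c} a≢b b≢c a≢c with ℕₚ.<-cmp a b | ℕₚ.<-cmp b c | ℕₚ.<-cmp a c
  ... | tri≈ _ e _ | _          | _          = ⊥-elim (a≢b e)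
  ... | tri< _ _ _ | tri≈ _ e _ | _          = ⊥-elim (b≢c e)
  ... | tri> _ _ _ | tri≈ _ e _ | _          = ⊥-elim (b≢c e)
  ... | tri< u _ _ | tri< v _ _ | _          = inj₁ (inj₁ (u , v))
  ... | tri> _ _ u | tri> _ _ v | _          = inj₂ (inj₁ (v , u))
  ... | tri< _ _ _ | tri> _ _ _ | tri≈ _ e _ = ⊥-elim (a≢c e)
  ... | tri> _ _ _ | tri< _ _ _ | tri≈ _ e _ = ⊥-elim (a≢c e)
  ... | tri< u _ _ | tri> _ _ v | tri< w _ _ = inj₂ (inj₂ (inj₂ (w , v)))
  ... | tri< u _ _ | tri> _ _ v | tri> _ _ w = inj₁ (inj₂ (inj₂ (w , u)))
  ... | tri> _ _ u | tri< v _ _ | tri< w _ _ = inj₂ (inj₂ (inj₁ (u , w)))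
  ... | tri> _ _ u | tri< v _ _ | tri> _ _ w = inj₁ (inj₂ (inj₁ (v , w)))

Cyc-map : ∀ {a b c a′ b′ c′} → (a < b → a′ < b′) → (b < c → b′ < c′) → (c < a → c′ < a′) →
          Cyc a b c → Cyc a′ b′ c′
Cyc-map f g h (inj₁ (u , v))        = inj₁ (f u , g v)
Cyc-map f g h (inj₂ (inj₁ (u , v))) = inj₂ (inj₁ (g u , h v))
Cyc-map f g h (inj₂ (inj₂ (u , v))) = inj₂ (inj₂ (h u , f v))

module _ {_≼_ : Rel ℕ 0ℓ} (reflex : Reflexive _≼_) (trans′ : Transitive _≼_) (tot : Total _≼_) where

  extremum : ∀ {n} {P : Pred (Fin n) 0ℓ} → Decidable P → (key : Fin n → ℕ) → ∃ P →
             ∃[ i ] (P i × (∀ j → P j → key i ≼ key j))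
  extremum {suc n} P? key (i , Pi) with any? (P? ∘ suc)
  extremum {suc n} P? key (zero , P0) | no none =
    zero , P0 , λ { zero _ → reflex ; (suc j) Pj → ⊥-elim (none (j , Pj)) }
  extremum {suc n} P? key (suc i , Pi) | no none = ⊥-elim (none (i , Pi))
  extremum {suc n} P? key _ | yes some with extremum (P? ∘ suc) (key ∘ suc) some
  ... | k , Pk , min with P? zero
  ...   | no ¬P0 = suc k , Pk , λ { zero P0 → ⊥-elim (¬P0 P0) ; (suc j) Pj → min j Pj }
  ...   | yes P0 with tot (key zero) (key (suc k))
  ...     | inj₁ 0≼k = zero , P0 , λ { zero _ → reflex ; (suc j) Pj → trans′ 0≼k (min j Pj) }
  ...     | inj₂ k≼0 = suc k , Pk , λ { zero _ → k≼0 ; (suc j) Pj → min j Pj }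

least : ∀ {n} {P : Pred (Fin n) 0ℓ} → Decidable P → (key : Fin n → ℕ) → ∃ P →
        ∃[ i ] (P i × (∀ j → P j → key i ≤ key j))
least = extremum ℕₚ.≤-refl ℕₚ.≤-trans ℕₚ.≤-total

greatest : ∀ {n} {P : Pred (Fin n) 0ℓ} → Decidable P → (key : Fin n → ℕ) → ∃ P →
           ∃[ i ] (P i × (∀ j → P j → key j ≤ key i))
greatest = extremum ℕₚ.≤-refl (flip ℕₚ.≤-trans) (λ m n → ℕₚ.≤-total n m)

count : ∀ {n} {P : Pred (Fin n) 0ℓ} → Decidable P → ℕ
count {zero}  P? = 0
count {suc n} P? with P? zero
... | yes _ = suc (count (P? ∘ suc))
... | no  _ = count (P? ∘ suc)

count-≤ : ∀ {n} {P Q : Pred (Fin n) 0ℓ} (P? : Decidable P) (Q? : Decidable Q) →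
          (∀ i → P i → Q i) → count P? ≤ count Q?
count-≤ {zero}  P? Q? sub = ℕ.z≤n
count-≤ {suc n} P? Q? sub with P? zero | Q? zero
... | yes p | yes q = ℕ.s≤s (count-≤ (P? ∘ suc) (Q? ∘ suc) (sub ∘ suc))
... | yes p | no ¬q = ⊥-elim (¬q (sub zero p))
... | no ¬p | yes q = ℕₚ.m≤n⇒m≤1+n (count-≤ (P? ∘ suc) (Q? ∘ suc) (sub ∘ suc))
... | no ¬p | no ¬q = count-≤ (P? ∘ suc) (Q? ∘ suc) (sub ∘ suc)

count-< : ∀ {n} {P Q : Pred (Fin n) 0ℓ} (P? : Decidable P) (Q? : Decidable Q) →
          (∀ i → P i → Q i) → ∀ i → ¬ P i → Q i → count P? < count Q?
count-< {suc n} P? Q? sub i ¬p q with P? zero | Q? zero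
count-< P? Q? sub zero ¬p q | yes p | _     = ⊥-elim (¬p p)
count-< P? Q? sub zero ¬p q | no _  | no ¬q = ⊥-elim (¬q q)
count-< P? Q? sub zero ¬p q | no _  | yes _ = ℕ.s≤s (count-≤ (P? ∘ suc) (Q? ∘ suc) (sub ∘ suc))
count-< P? Q? sub (suc i) ¬p q | yes _ | yes _ = ℕ.s≤s (count-< (P? ∘ suc) (Q? ∘ suc) (sub ∘ suc) i ¬p q)
count-< P? Q? sub (suc i) ¬p q | yes p | no ¬q = ⊥-elim (¬q (sub zero p))
count-< P? Q? sub (suc i) ¬p q | no _  | yes _ = ℕₚ.m≤n⇒m≤1+n (count-< (P? ∘ suc) (Q? ∘ suc) (sub ∘ suc) i ¬p q)
count-< P? Q? sub (suc i) ¬p q | no _  | no _  = count-< (P? ∘ suc) (Q? ∘ suc) (sub ∘ suc) i ¬p q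

-- Cutting a cyclic order at a base point makes it linear; the key of an edge
-- counts the edges before it.

module Cut {n : ℕ} {P : Fin n → Set} {C : Fin n → Fin n → Fin n → Set}
           (order : IsCyclicOrder P C) (P? : Decidable P) (z : Fin n) (Pz : P z) where
  open IsCyclicOrder order
  open CyclicOrder order

  Before : Fin n → Fin n → Set
  Before y x = (y ≡ z × x ≢ z) ⊎ C z y x

  private
    before? : ∀ x → Decidable (λ y → Before y x)
    before? x y = (y ≟ z ×-dec ¬? (x ≟ z)) ⊎-dec dec P? _≟_ z y x

    before-trans : ∀ {x y w} → Before x y → Before y w → Before x w
    before-trans (inj₁ (x≡z , y≢z)) (inj₁ (y≡z , _)) = ⊥-elim (y≢z y≡z)
    before-trans (inj₁ (x≡z , _))   (inj₂ s)         = inj₁ (x≡z , λ { refl → proj₂ (proj₂ (distinct s)) refl })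
    before-trans (inj₂ s)           (inj₁ (refl , _)) = ⊥-elim (proj₂ (proj₂ (distinct s)) refl)
    before-trans (inj₂ s)           (inj₂ t)         = inj₂ (transit s t)

    before-irrefl : ∀ {x} → ¬ Before x x
    before-irrefl (inj₁ (e , ne)) = ne e
    before-irrefl (inj₂ s)        = proj₁ (proj₂ (distinct s)) refl

    before-total : ∀ {x y} → P x → P y → x ≢ y → Before x y ⊎ Before y x
    before-total {x} {y} px py ne with x ≟ z | y ≟ z
    ... | yes p | yes q = ⊥-elim (ne (trans p (sym q)))
    ... | yes p | no q  = inj₁ (inj₁ (p , q))
    ... | no p  | yes q = inj₂ (inj₁ (q , p))
    ... | no p  | no q with total Pz px py (p ∘ sym) ne (q ∘ sym)
    ...   | inj₁ s = inj₁ (inj₂ s)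
    ...   | inj₂ s = inj₂ (inj₂ (cyclic (cyclic s)))

    before-cyclic : ∀ {x y w} → Before x y → Before y w → C x y w
    before-cyclic (inj₁ (refl , y≢z)) (inj₁ (y≡z , _)) = ⊥-elim (y≢z y≡z)
    before-cyclic (inj₁ (refl , _)) (inj₂ s) = s
    before-cyclic (inj₂ s) (inj₁ (refl , _)) = ⊥-elim (proj₂ (proj₂ (distinct s)) refl)
    before-cyclic (inj₂ s) (inj₂ t) = drop-first s t

  key : Fin n → ℕ
  key x = count (before? x)

  private
    key-mono : ∀ {x y} → Before x y → key x < key y
    key-mono {x} {y} b = count-< (before? x) (before? y) (λ _ c → before-trans c b) x before-irrefl b

    key-reflects : ∀ {x y} → P x → P y → key x < key y → Before x y
    key-reflects {x} {y} px py lt with x ≟ y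
    ... | yes refl = ⊥-elim (ℕₚ.<-irrefl refl lt)
    ... | no ne with before-total px py ne
    ...   | inj₁ b = b
    ...   | inj₂ b = ⊥-elim (ℕₚ.<-asym lt (key-mono b))

  key-injective : ∀ {x y} → P x → P y → key x ≡ key y → x ≡ y
  key-injective {x} {y} px py e with x ≟ y
  ... | yes p = p
  ... | no ne with before-total px py ne
  ...   | inj₁ b = ⊥-elim (ℕₚ.<-irrefl e (key-mono b))
  ...   | inj₂ b = ⊥-elim (ℕₚ.<-irrefl (sym e) (key-mono b))

  key-least : ∀ x → P x → key z ≤ key x
  key-least x px = go (x ≟ z)
    where
    go : Dec (x ≡ z) → key z ≤ key x
    go (yes e) = ℕₚ.≤-reflexive (cong key (sym e))
    go (no ne) = ℕₚ.<⇒≤ (key-mono (inj₁ (refl , ne)))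

  -- Distinct keys have one of two orientations. The wrong one, read from its least key on, is a
  -- chain for `Before` and would reverse `C a b c`.
  key-cyc : ∀ {a b c} → C a b c → Cyc (key a) (key b) (key c)
  key-cyc {a} {b} {c} s =
    let (pa , pb , pc) = support s
        (u , v , w)    = distinct s
        sorted : ∀ {x y w} → P x → P y → P w → key x < key y → key y < key w → C x y w
        sorted p q r lt lt′ = before-cyclic (key-reflects p q lt) (key-reflects q r lt′)
        impossible : ¬ Cyc (key c) (key b) (key a)
        impossible = λ
          { (inj₁ (l , m))        → asym s (sorted pc pb pa l m)
          ; (inj₂ (inj₁ (l , m))) → asym s (cyclic (cyclic (sorted pb pa pc l m)))
          ; (inj₂ (inj₂ (l , m))) → asym s (cyclic (sorted pa pc pb l m)) }
    in [ id , ⊥-elim ∘ impossible ]′ (IsCyclicOrder.total Cyc-isCyclicOrder _ _ _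
         (u ∘ key-injective pa pb) (v ∘ key-injective pb pc) (w ∘ key-injective pa pc))

-- Labelling the edges of a marked fat-tree

-- The cyclic orders and special edges are encoded by numbers: rk increases
-- counterclockwise around a black vertex, starting from the special edge, and
-- wk increases clockwise around a white vertex, from an arbitrary edge on.

record KeyedTree (n : ℕ) : Set₁ where
  field
    {B W}     : ℕ
    black     : Fin n → Fin B
    white     : Fin n → Fin W
    rk wk     : Fin n → ℕ
    root      : Fin B
    blacks    : StrictlySurjective _≡_ black
    whites    : StrictlySurjective _≡_ white
    rk-inj    : ∀ {x y} → black x ≡ black y → rk x ≡ rk y → x ≡ y
    wk-inj    : ∀ {x y} → white x ≡ white y → wk x ≡ wk y → x ≡ y
    connected : EdgeConnected black white
    count-≡   : B ℕ.+ W ≡ suc n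

-- Only the order of the numbers matters. `mono` and `cyc` recover the orders around the vertices,
-- `convex` makes the black blocks intervals, and `root-first` puts the least label at the root.
record Labelling {n} (T : KeyedTree n) : Set where
  open KeyedTree T
  field
    ℓ           : Fin n → ℕ
    injective   : ∀ {x y} → ℓ x ≡ ℓ y → x ≡ y
    mono        : ∀ {x y} → black x ≡ black y → rk x < rk y → ℓ x < ℓ y
    cyc         : ∀ {a b c} → white a ≡ white b → white b ≡ white c →
                  Cyc (wk a) (wk b) (wk c) → Cyc (ℓ a) (ℓ b) (ℓ c)
    convex      : ∀ {x y z} → black x ≡ black y → ℓ x < ℓ z → ℓ z < ℓ y → black z ≡ black x
    noncrossing : ∀ {a b c d} → white a ≡ white c → white b ≡ white d → white a ≢ white b →
                  ℓ a < ℓ b → ℓ b < ℓ c → ℓ c < ℓ d → ⊥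
    root-first  : ∀ {x y} → black x ≡ root → black y ≢ root → ℓ x < ℓ y

data View {n} (g : Fin (suc n)) : Fin (suc n) → Set where
  new : View g g
  old : ∀ x → View g (punchIn g x)

view : ∀ {n} (g x : Fin (suc n)) → View g x
view g x with g ≟ x
... | yes refl = new
... | no ne    = subst (View g) (punchIn-punchOut ne) (old (punchOut ne))

-- The new label g is placed next to its host h, on the side given by the
-- comparison of α and β.

module Insert {n} (g : Fin (suc n)) (h : Fin n) (ℓ′ : Fin n → ℕ)
              (ℓ′-inj : ∀ {x y} → ℓ′ x ≡ ℓ′ y → x ≡ y)
              {α β : ℕ} (α≤1 : α ≤ 1) (β≤1 : β ≤ 1) (α≢β : α ≢ β) where

  p : Fin (suc n) → Fin n
  p = insertAt id g h

  p-new : p g ≡ h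
  p-new = insertAt-lookup id g h

  p-old : ∀ x → p (punchIn g x) ≡ x
  p-old = insertAt-punchIn id g h

  side : Fin (suc n) → ℕ
  side = insertAt (λ _ → β) g α

  side-new : side g ≡ α
  side-new = insertAt-lookup (λ _ → β) g α

  side-old : ∀ x → side (punchIn g x) ≡ β
  side-old = insertAt-punchIn (λ _ → β) g α

  side≤1 : ∀ x → side x ≤ 1
  side≤1 x with view g x
  ... | new   = subst (_≤ 1) (sym side-new) α≤1
  ... | old x = subst (_≤ 1) (sym (side-old x)) β≤1

  -- Doubling leaves a free place beside every old label; with `α` and `β` being 0 and 1 in some
  -- order, the new label falls right before or right after that of `h`.
  ℓ : Fin (suc n) → ℕ
  ℓ x = (ℓ′ (p x) ℕ.+ ℓ′ (p x)) ℕ.+ side x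

  ℓ-mono : ∀ {x y} → ℓ′ (p x) < ℓ′ (p y) → ℓ x < ℓ y
  ℓ-mono {x} {y} lt = begin-strict
    (a ℕ.+ a) ℕ.+ side x ≤⟨ ℕₚ.+-monoʳ-≤ (a ℕ.+ a) (side≤1 x) ⟩
    (a ℕ.+ a) ℕ.+ 1      ≡⟨ trans (ℕₚ.+-assoc a a 1) (cong (a ℕ.+_) (ℕₚ.+-comm a 1)) ⟩
    a ℕ.+ suc a          <⟨ ℕₚ.+-mono-<-≤ lt lt ⟩
    b ℕ.+ b              ≤⟨ ℕₚ.m≤m+n (b ℕ.+ b) (side y) ⟩
    (b ℕ.+ b) ℕ.+ side y ∎
    where
    open ℕₚ.≤-Reasoning
    a b : ℕ
    a = ℓ′ (p x)
    b = ℓ′ (p y)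

  ℓ-side : ∀ {x y} → p x ≡ p y → side x < side y → ℓ x < ℓ y
  ℓ-side {x} {y} e lt = subst (λ z → (ℓ′ (p x) ℕ.+ ℓ′ (p x)) ℕ.+ side x < (ℓ′ z ℕ.+ ℓ′ z) ℕ.+ side y) e
    (ℕₚ.+-monoʳ-< (ℓ′ (p x) ℕ.+ ℓ′ (p x)) lt)

  ℓ-reflects : ∀ {x y} → ℓ x < ℓ y → p x ≡ p y ⊎ ℓ′ (p x) < ℓ′ (p y)
  ℓ-reflects {x} {y} lt with ℕₚ.<-cmp (ℓ′ (p x)) (ℓ′ (p y))
  ... | tri< l _ _ = inj₂ l
  ... | tri≈ _ e _ = inj₁ (ℓ′-inj e)
  ... | tri> _ _ g = ⊥-elim (ℕₚ.<-asym lt (ℓ-mono g))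

  ℓ-old : ∀ {x y} → ℓ (punchIn g x) < ℓ (punchIn g y) → ℓ′ x < ℓ′ y
  ℓ-old {x} {y} lt with ℓ-reflects {punchIn g x} {punchIn g y} lt
  ... | inj₂ l = subst₂ (λ a b → ℓ′ a < ℓ′ b) (p-old x) (p-old y) l
  ... | inj₁ e with trans (sym (p-old x)) (trans e (p-old y))
  ...   | refl = ⊥-elim (ℕₚ.<-irrefl refl lt)

  ℓ-old-mono : ∀ {x y} → ℓ′ x < ℓ′ y → ℓ (punchIn g x) < ℓ (punchIn g y)
  ℓ-old-mono {x} {y} l = ℓ-mono (subst₂ (λ a b → ℓ′ a < ℓ′ b) (sym (p-old x)) (sym (p-old y)) l)

  ℓ-inj : ∀ {x y} → ℓ x ≡ ℓ y → x ≡ y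
  ℓ-inj {x} {y} e = go (view g x) (view g y) e (ℓ′-inj same-host)
    where
    same-host : ℓ′ (p x) ≡ ℓ′ (p y)
    same-host with ℕₚ.<-cmp (ℓ′ (p x)) (ℓ′ (p y))
    ... | tri< l _ _ = ⊥-elim (ℕₚ.<-irrefl e (ℓ-mono l))
    ... | tri≈ _ q _ = q
    ... | tri> _ _ l = ⊥-elim (ℕₚ.<-irrefl (sym e) (ℓ-mono l))
    sides : ∀ {x y} → ℓ x ≡ ℓ y → p x ≡ p y → side x ≡ side y
    sides {x} {y} e q = ℕₚ.+-cancelˡ-≡ (ℓ′ (p x) ℕ.+ ℓ′ (p x)) (side x) (side y)
      (trans e (cong (λ z → (ℓ′ z ℕ.+ ℓ′ z) ℕ.+ side y) (sym q)))
    go : ∀ {x y} → View g x → View g y → ℓ x ≡ ℓ y → p x ≡ p y → x ≡ y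
    go new     new     _ _ = refl
    go (old x) (old y) _ q = cong (punchIn g) (trans (sym (p-old x)) (trans q (p-old y)))
    go new     (old y) e q = ⊥-elim (α≢β (trans (sym side-new) (trans (sides {g} {punchIn g y} e q) (side-old y))))
    go (old x) new     e q = ⊥-elim (α≢β (sym (trans (sym (side-old x)) (trans (sides {punchIn g x} {g} e q) side-new))))

-- Removing a white leaf

record Deletion {k : ℕ} (V : Fin k) : Set where
  field
    rest      : ℕ
    rest-≡    : suc rest ≡ k
    shrink    : ∀ {X} → V ≢ X → Fin rest
    cong-shrink : ∀ {X Y} {p : V ≢ X} {q : V ≢ Y} → X ≡ Y → shrink p ≡ shrink q
    injective : ∀ {X Y} {p : V ≢ X} {q : V ≢ Y} → shrink p ≡ shrink q → X ≡ Y
    hits      : ∀ Z → ∃[ X ] Σ[ p ∈ V ≢ X ] shrink p ≡ Z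

deletion : ∀ {k} (V : Fin k) → Deletion V
deletion {suc k} V = record
  { rest = k ; rest-≡ = refl ; shrink = punchOut
  ; cong-shrink = punchOut-cong V ; injective = punchOut-injective {i = V} _ _
  ; hits = λ Z → punchIn V Z , punchInᵢ≢i V Z ∘ sym , punchOut-punchIn V }

module _ {n : ℕ} (T : KeyedTree (suc n)) where
  open KeyedTree T

  IsLeaf : Fin (suc n) → Set
  IsLeaf g = ∀ x → white g ≡ white x → g ≡ x

  -- `h` is next to `g` in the ranks at their common black vertex; the constructor tells on which
  -- side of `h` the label of `g` belongs.
  data Neighbour (g : Fin (suc n)) (h : Fin n) : Set where
    after  : rk (punchIn g h) < rk g →
             (∀ y → black y ≡ black g → rk y < rk g → rk y ≤ rk (punchIn g h)) → Neighbour g h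
    before : rk g < rk (punchIn g h) →
             (∀ y → black y ≡ black g → rk g < rk y → rk (punchIn g h) ≤ rk y) → Neighbour g h

  neighbour : ∀ g x → g ≢ x → black x ≡ black g →
              ∃[ h ] (black (punchIn g h) ≡ black g × Neighbour g h)
  neighbour g x g≢x xg with any? (λ y → (black y ≟ black g) ×-dec (rk y ℕₚ.<? rk g))
  ... | yes some with greatest (λ y → (black y ≟ black g) ×-dec (rk y ℕₚ.<? rk g)) rk some
  ...   | h , (hg , lt) , max with view g h
  ...     | new   = ⊥-elim (ℕₚ.<-irrefl refl lt)
  ...     | old h = h , hg , after lt λ y yg l → max y (yg , l)
  neighbour g x g≢x xg | no none
    with least (λ y → (black y ≟ black g) ×-dec (rk g ℕₚ.<? rk y)) rk (x , xg , higher)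
    where
    higher : rk g < rk x
    higher with ℕₚ.<-cmp (rk g) (rk x)
    ... | tri< l _ _ = l
    ... | tri≈ _ e _ = ⊥-elim (g≢x (rk-inj (sym xg) e))
    ... | tri> _ _ l = ⊥-elim (none (x , xg , l))
  ... | h , (hg , lt) , min with view g h
  ...   | new   = ⊥-elim (ℕₚ.<-irrefl refl lt)
  ...   | old h = h , hg , before lt λ y yg l → min y (yg , l)

  module RemoveLeaf {g : Fin (suc n)} (leaf : IsLeaf g) {h : Fin n}
                    (hg : black (punchIn g h) ≡ black g) where

    private
      ι : Fin n → Fin (suc n)
      ι = punchIn g

      open Deletion (deletion (white g)) renaming (injective to shrink-injective)

      survives : ∀ x → white g ≢ white (ι x)
      survives x e = punchInᵢ≢i g x (sym (leaf (ι x) e))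

      leaf-p : Fin (suc n) → Fin n
      leaf-p = insertAt id g h

      black-p : ∀ x → black (ι (leaf-p x)) ≡ black x
      black-p x with view g x
      ... | new   = trans (cong (black ∘ ι) (insertAt-lookup id g h)) hg
      ... | old x = cong (black ∘ ι) (insertAt-punchIn id g h x)

    removed : KeyedTree n
    removed = record
      { black = black ∘ ι ; white = λ x → shrink (survives x) ; rk = rk ∘ ι ; wk = wk ∘ ι ; root = root
      ; blacks = λ V → let (x , e) = blacks V in leaf-p x , trans (black-p x) e
      ; whites = whites′
      ; rk-inj = λ p q → punchIn-injective g _ _ (rk-inj p q)
      ; wk-inj = λ p q → punchIn-injective g _ _ (wk-inj (shrink-injective p) q)
      -- A predicate on the remaining edges is extended to `g` by its value at `h`, which has the
      -- same black vertex.
      ; connected = λ P onB onW x y px → subst P (insertAt-punchIn id g h y)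
          (connected (P ∘ leaf-p)
            (λ {x} {y} e → onB (trans (black-p x) (trans e (sym (black-p y)))))
            (λ {x} {y} → onWhite P onW (view g x) (view g y))
            (ι x) (ι y) (subst P (sym (insertAt-punchIn id g h x)) px))
      ; count-≡ = ℕₚ.suc-injective (trans (sym (ℕₚ.+-suc B rest)) (trans (cong (B ℕ.+_) rest-≡) count-≡))
      }
      where
      whites′ : StrictlySurjective _≡_ (λ x → shrink (survives x))
      whites′ Z with hits Z
      ... | X , ne , e with whites X
      ...   | x , refl with view g x
      ...     | new   = ⊥-elim (ne refl)
      ...     | old x = x , trans (cong-shrink refl) e
      onWhite : ∀ P → Respects (λ x → shrink (survives x)) P → ∀ {x y} → View g x → View g y →
                white x ≡ white y → P (leaf-p x) → P (leaf-p y)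
      onWhite P onW new     new     e p = p
      onWhite P onW new     (old y) e p = ⊥-elim (survives y e)
      onWhite P onW (old x) new     e p = ⊥-elim (survives x (sym e))
      onWhite P onW (old x) (old y) e p = subst P (sym (insertAt-punchIn id g h y))
        (onW (cong-shrink e) (subst P (insertAt-punchIn id g h x) p))

    module _ (L : Labelling removed) where
      private module L = Labelling L

      -- Placed beside `h`, the label of `g` stays in the black interval of `h`. As `g` is alone at
      -- its white vertex, no cyclic triple and no crossing contains it.
      extend-by : ∀ {α β} → α ≤ 1 → β ≤ 1 → α ≢ β →
        (∀ x → black x ≡ black g → rk x < rk g → (x ≡ ι h × β < α) ⊎ rk x < rk (ι h)) →
        (∀ x → black x ≡ black g → rk g < rk x → (x ≡ ι h × α < β) ⊎ rk (ι h) < rk x) →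
        Labelling T
      extend-by {α} {β} α≤1 β≤1 α≢β below above = record
        { ℓ = ℓ ; injective = ℓ-inj
        ; mono = λ {x} {y} → mono′ (view g x) (view g y)
        ; cyc = λ {a} {b} {c} → cyc′ (view g a) (view g b) (view g c)
        ; convex = convex′
        ; noncrossing = λ {a} {b} {c} {d} → noncrossing′ (view g a) (view g b) (view g c) (view g d)
        ; root-first = λ {x} {y} p q → ℓ-mono (L.root-first (trans (black-p x) p) (q ∘ trans (sym (black-p y))))
        }
        where
        open Insert g h L.ℓ L.injective α≤1 β≤1 α≢β
        mono′ : ∀ {x y} → View g x → View g y → black x ≡ black y → rk x < rk y → ℓ x < ℓ y
        mono′ new     new     e lt = ⊥-elim (ℕₚ.<-irrefl refl lt)
        mono′ (old x) (old y) e lt = ℓ-old-mono (L.mono e lt)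
        mono′ (old x) new     e lt with below (ι x) e lt
        ... | inj₁ (q , b<a) = ℓ-side (trans (cong p q) (trans (p-old h) (sym p-new)))
                                      (subst₂ _<_ (sym (side-old x)) (sym side-new) b<a)
        ... | inj₂ l = ℓ-mono (subst₂ (λ a b → L.ℓ a < L.ℓ b) (sym (p-old x)) (sym p-new) (L.mono (trans e (sym hg)) l))
        mono′ new     (old y) e lt with above (ι y) (sym e) lt
        ... | inj₁ (q , a<b) = ℓ-side (sym (trans (cong p q) (trans (p-old h) (sym p-new))))
                                      (subst₂ _<_ (sym side-new) (sym (side-old y)) a<b)
        ... | inj₂ l = ℓ-mono (subst₂ (λ a b → L.ℓ a < L.ℓ b) (sym p-new) (sym (p-old y)) (L.mono (trans hg e) l))

        cyc′ : ∀ {a b c} → View g a → View g b → View g c → white a ≡ white b → white b ≡ white c →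
               Cyc (wk a) (wk b) (wk c) → Cyc (ℓ a) (ℓ b) (ℓ c)
        cyc′ (old a) (old b) (old c) e f s =
          Cyc-map ℓ-old-mono ℓ-old-mono ℓ-old-mono (L.cyc (cong-shrink e) (cong-shrink f) s)
        cyc′ {b = b} {c} new _ _ e f s =
          ⊥-elim (proj₁ (CyclicOrder.distinct Cyc-isCyclicOrder s) (cong wk (leaf b e)))
        cyc′ {a} {c = c} _ new _ e f s =
          ⊥-elim (proj₁ (CyclicOrder.distinct Cyc-isCyclicOrder s) (cong wk (sym (leaf a (sym e)))))
        cyc′ {a} {b} _ _ new e f s =
          ⊥-elim (proj₁ (proj₂ (CyclicOrder.distinct Cyc-isCyclicOrder s)) (cong wk (sym (leaf b (sym f)))))

        convex′ : ∀ {x y z} → black x ≡ black y → ℓ x < ℓ z → ℓ z < ℓ y → black z ≡ black x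
        convex′ {x} {y} {z} e l m with ℓ-reflects {x} {z} l | ℓ-reflects {z} {y} m
        ... | inj₁ q | _      = trans (sym (black-p z)) (trans (cong (black ∘ ι) (sym q)) (black-p x))
        ... | _      | inj₁ q = trans (sym (black-p z)) (trans (cong (black ∘ ι) q) (trans (black-p y) (sym e)))
        ... | inj₂ u | inj₂ v = trans (sym (black-p z))
          (trans (L.convex (trans (black-p x) (trans e (sym (black-p y)))) u v) (black-p x))

        noncrossing′ : ∀ {a b c d} → View g a → View g b → View g c → View g d →
          white a ≡ white c → white b ≡ white d → white a ≢ white b →
          ℓ a < ℓ b → ℓ b < ℓ c → ℓ c < ℓ d → ⊥
        noncrossing′ (old a) (old b) (old c) (old d) e f ne l m o =
          L.noncrossing (cong-shrink e) (cong-shrink f) (ne ∘ shrink-injective) (ℓ-old l) (ℓ-old m) (ℓ-old o)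
        noncrossing′ {c = c} new _ _ _ e f ne l m o = ℕₚ.<-irrefl (cong ℓ (leaf c e)) (ℕₚ.<-trans l m)
        noncrossing′ {d = d} _ new _ _ e f ne l m o = ℕₚ.<-irrefl (cong ℓ (leaf d f)) (ℕₚ.<-trans m o)
        noncrossing′ {a} _ _ new _ e f ne l m o = ℕₚ.<-irrefl (cong ℓ (sym (leaf a (sym e)))) (ℕₚ.<-trans l m)
        noncrossing′ {b = b} _ _ _ new e f ne l m o = ℕₚ.<-irrefl (cong ℓ (sym (leaf b (sym f)))) (ℕₚ.<-trans m o)

      extended : Neighbour g h → Labelling T
      extended (after lt max) = extend-by {1} {0} ℕₚ.≤-refl ℕ.z≤n (λ ()) below (λ x e l → inj₂ (ℕₚ.<-trans lt l))
        where
        below : ∀ x → black x ≡ black g → rk x < rk g → (x ≡ ι h × 0 < 1) ⊎ rk x < rk (ι h)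
        below x e l with ℕₚ.m≤n⇒m<n∨m≡n (max x e l)
        ... | inj₁ u = inj₂ u
        ... | inj₂ u = inj₁ (rk-inj (trans e (sym hg)) u , ℕₚ.≤-refl)
      extended (before lt min) = extend-by {0} {1} ℕ.z≤n ℕₚ.≤-refl (λ ()) (λ x e l → inj₂ (ℕₚ.<-trans l lt)) above
        where
        above : ∀ x → black x ≡ black g → rk g < rk x → (x ≡ ι h × 0 < 1) ⊎ rk (ι h) < rk x
        above x e l with ℕₚ.m≤n⇒m<n∨m≡n (min x e l)
        ... | inj₁ u = inj₂ u
        ... | inj₂ u = inj₁ (sym (rk-inj (trans hg (sym e)) u) , ℕₚ.≤-refl)

-- Merging two consecutive edges

private
  module CycOrd = IsCyclicOrder Cyc-isCyclicOrder
  module CycOrd′ = CyclicOrder Cyc-isCyclicOrder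

Adjacent : ∀ {n} (T : KeyedTree n) → Fin n → Fin n → Set
Adjacent T e f = white e ≡ white f × e ≢ f ×
  (∀ y → white y ≡ white f → y ≢ e → y ≢ f → Cyc (wk e) (wk f) (wk y))
  where open KeyedTree T

-- Two consecutive edges e, f at a white vertex such that e is the last edge
-- at its black vertex and f the special one at its own are merged into one
-- edge: the black interval of e is followed by that of f.

module Fold {n : ℕ} (T : KeyedTree (suc n)) where
  open KeyedTree T

  module _ {f : Fin (suc n)} {e : Fin n} (adjacent : Adjacent T (punchIn f e) f)
           (last : ∀ y → black y ≡ black (punchIn f e) → rk y ≤ rk (punchIn f e))
           (first : ∀ y → black y ≡ black f → rk f ≤ rk y)
           (f-not-root : black f ≢ root) where

    private
      ι : Fin n → Fin (suc n)
      ι = punchIn f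

      fold : Fin (suc n) → Fin n
      fold = insertAt id f e

      fold-new : fold f ≡ e
      fold-new = insertAt-lookup id f e

      fold-old : ∀ x → fold (ι x) ≡ x
      fold-old = insertAt-punchIn id f e

      white-fold : ∀ x → white (ι (fold x)) ≡ white x
      white-fold x with view f x
      ... | new   = trans (cong (white ∘ ι) fold-new) (proj₁ adjacent)
      ... | old x = cong (white ∘ ι) (fold-old x)

      lift : ∀ (P : Fin n → Set) → (∀ {x y} → white (ι x) ≡ white (ι y) → P x → P y) →
             ∀ {x y} → white x ≡ white y → P (fold x) → P (fold y)
      lift P onW {x} {y} p = onW (trans (white-fold x) (trans p (sym (white-fold y))))

      -- Otherwise e and f would be parallel, and T would remain connected
      -- without f, having too few edges.

      ends-differ : black (ι e) ≢ black f
      ends-differ parallel = ℕₚ.<-irrefl count-≡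
        (ℕ.s≤s (Bipartite.connected⇒bound (black ∘ ι) (white ∘ ι)
          (λ V → let (x , p) = blacks V in fold x , trans (black-fold x) p)
          (λ V → let (x , p) = whites V in fold x , trans (white-fold x) p)
          (λ P onB onW x y px → subst P (fold-old y) (connected (P ∘ fold)
            (λ {x} {y} p → onB (trans (black-fold x) (trans p (sym (black-fold y)))))
            (lift P onW) (ι x) (ι y) (subst P (sym (fold-old x)) px)))))
        where
        black-fold : ∀ x → black (ι (fold x)) ≡ black x
        black-fold x with view f x
        ... | new   = trans (cong (black ∘ ι) fold-new) parallel
        ... | old x = cong (black ∘ ι) (fold-old x)

      open Merging (merging ends-differ) renaming (size to size′; size-≡ to size′-≡)

      black-fold : ∀ x → collapse (black (ι (fold x))) ≡ collapse (black x)
      black-fold x with view f x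
      ... | new   = trans (cong (collapse ∘ black ∘ ι) fold-new) merges
      ... | old x = cong (collapse ∘ black ∘ ι) (fold-old x)

      -- Ranks at the black vertex of `f` are moved past the greatest rank at that of `e`, so the
      -- merged vertex lists the edges of the latter first.
      shift : Fin n → ℕ
      shift x with black (ι x) ≟ black f
      ... | yes _ = suc (rk (ι e))
      ... | no _  = 0

      rk′ : Fin n → ℕ
      rk′ x = shift x ℕ.+ rk (ι x)

      rk′-same : ∀ {x y} → black (ι x) ≡ black (ι y) → shift x ≡ shift y
      rk′-same {x} {y} p with black (ι x) ≟ black f | black (ι y) ≟ black f
      ... | yes _ | yes _ = refl
      ... | no _  | no _  = refl
      ... | yes q | no r  = ⊥-elim (r (trans (sym p) q))
      ... | no r  | yes q = ⊥-elim (r (trans p q))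

      shift-e : ∀ {x} → black (ι x) ≢ black f → shift x ≡ 0
      shift-e {x} ne with black (ι x) ≟ black f
      ... | yes p = ⊥-elim (ne p)
      ... | no _  = refl

      shift-f : ∀ {x} → black (ι x) ≡ black f → shift x ≡ suc (rk (ι e))
      shift-f {x} p with black (ι x) ≟ black f
      ... | yes _ = refl
      ... | no ne = ⊥-elim (ne p)

      rk′-cross : ∀ {x y} → black (ι x) ≡ black (ι e) → black (ι y) ≡ black f → rk′ x < rk′ y
      rk′-cross {x} {y} p q = begin-strict
        shift x ℕ.+ rk (ι x)          ≡⟨ cong (ℕ._+ rk (ι x)) (shift-e (ends-differ ∘ trans (sym p))) ⟩
        rk (ι x)                      ≤⟨ last (ι x) p ⟩
        rk (ι e)                      <⟨ ℕₚ.m≤m+n (suc (rk (ι e))) (rk (ι y)) ⟩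
        suc (rk (ι e)) ℕ.+ rk (ι y)   ≡⟨ cong (ℕ._+ rk (ι y)) (sym (shift-f q)) ⟩
        shift y ℕ.+ rk (ι y)          ∎
        where open ℕₚ.≤-Reasoning

      rk′-mono : ∀ {x y} → black (ι x) ≡ black (ι y) → rk (ι x) < rk (ι y) → rk′ x < rk′ y
      rk′-mono {x} {y} p l = subst (λ k → k ℕ.+ rk (ι x) < rk′ y) (sym (rk′-same p)) (ℕₚ.+-monoʳ-< (shift y) l)

    folded : KeyedTree n
    folded = record
      { black = collapse ∘ black ∘ ι ; white = white ∘ ι ; rk = rk′ ; wk = wk ∘ ι ; root = collapse root
      ; blacks = blacks′
      ; whites = λ V → let (x , p) = whites V in fold x , trans (white-fold x) p
      ; rk-inj = rk′-inj
      ; wk-inj = λ p q → punchIn-injective f _ _ (wk-inj p q)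
      ; connected = λ P onB onW x y px → subst P (fold-old y) (connected (P ∘ fold)
          (λ {x} {y} p → onB (trans (black-fold x) (trans (cong collapse p) (sym (black-fold y)))))
          (lift P onW) (ι x) (ι y) (subst P (sym (fold-old x)) px))
      ; count-≡ = ℕₚ.suc-injective (trans (cong (ℕ._+ W) size′-≡) count-≡)
      }
      where
      blacks′ : StrictlySurjective _≡_ (collapse ∘ black ∘ ι)
      blacks′ Z with hits Z
      ... | X , refl with blacks X
      ...   | x , refl = fold x , black-fold x
      rk′-inj : ∀ {x y} → collapse (black (ι x)) ≡ collapse (black (ι y)) → rk′ x ≡ rk′ y → x ≡ y
      rk′-inj {x} {y} p q with separates p
      ... | inj₁ r = punchIn-injective f _ _ (rk-inj r (ℕₚ.+-cancelˡ-≡ (shift x) _ _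
              (trans q (cong (ℕ._+ rk (ι y)) (sym (rk′-same r))))))
      ... | inj₂ (inj₁ (r , s)) = ⊥-elim (ℕₚ.<-irrefl q (rk′-cross r s))
      ... | inj₂ (inj₂ (r , s)) = ⊥-elim (ℕₚ.<-irrefl (sym q) (rk′-cross s r))

    module _ (L : Labelling folded) where
      private module L = Labelling L

      unfolded : Labelling T
      unfolded = record
        { ℓ = ℓ ; injective = ℓ-inj
        ; mono = λ {x} {y} → mono′ (view f x) (view f y)
        ; cyc = cyc′
        ; convex = convex′
        ; noncrossing = noncrossing′
        ; root-first = root-first′
        }
        where
        -- Side 1 for `f` and 0 for all others: the label of `f` directly follows that of `e`.
        open Insert f e L.ℓ L.injective {1} {0} ℕₚ.≤-refl ℕ.z≤n (λ ())

        from-fold : ∀ {x y} → L.ℓ x < L.ℓ y → ∀ {x′ y′} → p x′ ≡ x → p y′ ≡ y → ℓ x′ < ℓ y′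
        from-fold l refl refl = ℓ-mono l

        cross : ∀ {x y} → black x ≡ black (ι e) → black y ≡ black f → ℓ x < ℓ y
        cross {x} {y} = go (view f x) (view f y)
          where
          go : ∀ {x y} → View f x → View f y → black x ≡ black (ι e) → black y ≡ black f → ℓ x < ℓ y
          go new     _       p q = ⊥-elim (ends-differ (sym p))
          go (old x) (old y) p q = ℓ-old-mono (L.mono (trans (cong collapse p) (trans merges (cong collapse (sym q)))) (rk′-cross p q))
          go (old x) new     p q with ℕₚ.m≤n⇒m<n∨m≡n (last (ι x) p)
          ... | inj₁ l = from-fold (L.mono (cong collapse p) (rk′-mono p l)) (p-old x) p-new
          ... | inj₂ r = ℓ-side (trans (p-old x) (trans (punchIn-injective f _ _ (rk-inj p r)) (sym p-new)))
                                (subst₂ _<_ (sym (side-old x)) (sym side-new) ℕₚ.≤-refl)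

        mono′ : ∀ {x y} → View f x → View f y → black x ≡ black y → rk x < rk y → ℓ x < ℓ y
        mono′ new     new     q l = ⊥-elim (ℕₚ.<-irrefl refl l)
        mono′ (old x) (old y) q l = ℓ-old-mono (L.mono (cong collapse q) (rk′-mono q l))
        mono′ (old x) new     q l = ⊥-elim (ℕₚ.<⇒≱ l (first (ι x) q))
        mono′ new     (old y) q l =
          from-fold (L.mono (trans merges (cong collapse q)) (rk′-cross refl (sym q))) p-new (p-old y)

        next-to-e : ℓ (ι e) < ℓ f
        next-to-e = ℓ-side (trans (p-old e) (sym p-new)) (subst₂ _<_ (sym (side-old e)) (sym side-new) ℕₚ.≤-refl)

        -- If `e` is not in the triple, it may replace `f`, being next to it both around the white
        -- vertex and among the labels. If it is, it comes third, as `f` directly follows `e`, and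
        -- then any position of `b` gives the right orientation.
        rotate : ∀ {b c} → View f b → View f c → white f ≡ white b → white b ≡ white c →
                 Cyc (wk f) (wk b) (wk c) → Cyc (ℓ f) (ℓ b) (ℓ c)
        rotate new _   _ _ s = ⊥-elim (proj₁ (CycOrd′.distinct s) refl)
        rotate _   new _ _ s = ⊥-elim (proj₂ (proj₂ (CycOrd′.distinct s)) refl)
        rotate (old b) (old c) q r s with b ≟ e | c ≟ e
        ... | yes refl | yes refl = ⊥-elim (proj₁ (proj₂ (CycOrd′.distinct s)) refl)
        ... | yes refl | no c≢e =
          ⊥-elim (CycOrd.asym s (CycOrd.cyclic (CycOrd.cyclic
            (proj₂ (proj₂ adjacent) (ι c) (sym (trans q r)) (c≢e ∘ punchIn-injective f _ _) (punchInᵢ≢i f c)))))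
        ... | no b≢e | yes refl = beside (ℕₚ.<-cmp (L.ℓ b) (L.ℓ e))
          where
          beside : Tri (L.ℓ b < L.ℓ e) (L.ℓ b ≡ L.ℓ e) (L.ℓ e < L.ℓ b) → Cyc (ℓ f) (ℓ (ι b)) (ℓ (ι e))
          beside (tri< l _ _) = inj₂ (inj₁ (ℓ-old-mono l , next-to-e))
          beside (tri≈ _ t _) = ⊥-elim (b≢e (L.injective t))
          beside (tri> _ _ l) = inj₂ (inj₂ (next-to-e , from-fold l p-new (p-old b)))
        ... | no b≢e | no c≢e =
          Cyc-map (λ l → from-fold l p-new (p-old b)) (λ l → ℓ-old-mono l) (λ l → from-fold l (p-old c) p-new)
            (L.cyc (trans (proj₁ adjacent) q) r
              (CycOrd.cyclic (CycOrd.cyclic (CycOrd′.drop-first s (CycOrd.cyclic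
                (proj₂ (proj₂ adjacent) (ι c) (sym (trans q r)) (c≢e ∘ punchIn-injective f _ _) (punchInᵢ≢i f c)))))))

        cyc′ : ∀ {a b c} → white a ≡ white b → white b ≡ white c →
               Cyc (wk a) (wk b) (wk c) → Cyc (ℓ a) (ℓ b) (ℓ c)
        cyc′ {a} {b} {c} q r s = go (view f a) (view f b) (view f c) q r s
          where
          go : ∀ {a b c} → View f a → View f b → View f c → white a ≡ white b → white b ≡ white c →
               Cyc (wk a) (wk b) (wk c) → Cyc (ℓ a) (ℓ b) (ℓ c)
          go (old a) (old b) (old c) q r s = Cyc-map ℓ-old-mono ℓ-old-mono ℓ-old-mono (L.cyc q r s)
          go new vb vc q r s = rotate vb vc q r s
          go va new vc q r s = CycOrd.cyclic (CycOrd.cyclic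
            (rotate vc va r (sym (trans q r)) (CycOrd.cyclic s)))
          go va vb new q r s = CycOrd.cyclic
            (rotate va vb (sym (trans q r)) q (CycOrd.cyclic (CycOrd.cyclic s)))

        convex′ : ∀ {x y z} → black x ≡ black y → ℓ x < ℓ z → ℓ z < ℓ y → black z ≡ black x
        convex′ {x} {y} {z} q l m with separates {black z} {black x} collapsed
          where
          c : Fin (suc n) → Fin size′
          c x = collapse (black (ι (p x)))
          merged : c z ≡ c x
          merged with ℓ-reflects {x} {z} l | ℓ-reflects {z} {y} m
          ... | inj₁ r | _      = cong (collapse ∘ black ∘ ι) (sym r)
          ... | _      | inj₁ r = trans (cong (collapse ∘ black ∘ ι) r) (trans (black-fold y) (trans (cong collapse (sym q)) (sym (black-fold x))))
          ... | inj₂ u | inj₂ v = L.convex (trans (black-fold x) (trans (cong collapse q) (sym (black-fold y)))) u v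
          collapsed : collapse (black z) ≡ collapse (black x)
          collapsed = trans (sym (black-fold z)) (trans merged (black-fold x))
        ... | inj₁ r = r
        -- If `z` were in the other half than `x` and `y`, `cross` would put it beyond both and not
        -- between them.
        ... | inj₂ (inj₁ (r , s)) = ⊥-elim (ℕₚ.<-asym l (cross r s))
        ... | inj₂ (inj₂ (r , s)) = ⊥-elim (ℕₚ.<-asym m (cross (trans (sym q) s) r))

        noncrossing′ : ∀ {a b c d} → white a ≡ white c → white b ≡ white d → white a ≢ white b →
          ℓ a < ℓ b → ℓ b < ℓ c → ℓ c < ℓ d → ⊥
        noncrossing′ {a} {b} {c} {d} q r ne l m o =
          L.noncrossing (trans (white-fold a) (trans q (sym (white-fold c))))
            (trans (white-fold b) (trans r (sym (white-fold d))))
            (λ s → ne (trans (sym (white-fold a)) (trans s (white-fold b))))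
            (strict l ne) (strict m (λ s → ne (trans q (sym s)))) (strict o (λ s → ne (trans q (trans s (sym r)))))
          where
          strict : ∀ {x y} → ℓ x < ℓ y → white x ≢ white y → L.ℓ (p x) < L.ℓ (p y)
          strict {x} {y} l ne with ℓ-reflects {x} {y} l
          ... | inj₁ s = ⊥-elim (ne (trans (sym (white-fold x)) (trans (cong (white ∘ ι) s) (white-fold y))))
          ... | inj₂ u = u

        root-first′ : ∀ {x y} → black x ≡ root → black y ≢ root → ℓ x < ℓ y
        root-first′ {x} {y} q ne with collapse (black y) ≟ collapse root
        ... | no ne′ = ℓ-mono (L.root-first (trans (black-fold x) (cong collapse q)) (ne′ ∘ trans (sym (black-fold y))))
        ... | yes s with separates s
        ...   | inj₁ r              = ⊥-elim (ne r)
        -- Since `f` is not at the root, a root that takes part in the merging is the vertex of `e`,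
        -- whose labels come first.
        ...   | inj₂ (inj₁ (_ , r)) = ⊥-elim (f-not-root (sym r))
        ...   | inj₂ (inj₂ (r , u)) = cross (trans q u) r

-- Existence of a mergeable pair, and the induction

module _ {n : ℕ} (T : KeyedTree n) where
  open KeyedTree T

  -- The edge with the greatest key below that of `f`, or, if `f` has the least key, the one with
  -- the greatest key of all, where the cycle wraps around.
  predecessor : ∀ f x → white x ≡ white f → x ≢ f → ∃[ e ] Adjacent T e f
  predecessor f x xf x≢f with any? (λ y → (white y ≟ white f) ×-dec (wk y ℕₚ.<? wk f))
  ... | yes some with greatest (λ y → (white y ≟ white f) ×-dec (wk y ℕₚ.<? wk f)) wk some
  ...   | e , (ef , lt) , max = e , ef , (λ { refl → ℕₚ.<-irrefl refl lt }) , next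
    where
    next : ∀ y → white y ≡ white f → y ≢ e → y ≢ f → Cyc (wk e) (wk f) (wk y)
    next y yf y≢e y≢f with ℕₚ.<-cmp (wk y) (wk f)
    ... | tri< l _ _ = inj₂ (inj₂ (ℕₚ.≤∧≢⇒< (max y (yf , l)) (y≢e ∘ wk-inj (trans yf (sym ef))) , lt))
    ... | tri≈ _ s _ = ⊥-elim (y≢f (wk-inj yf s))
    ... | tri> _ _ l = inj₁ (lt , l)
  predecessor f x xf x≢f | no none
    with greatest (λ y → (white y ≟ white f) ×-dec ¬? (y ≟ f)) wk (x , xf , x≢f)
  ... | e , (ef , e≢f) , max = e , ef , e≢f , next
    where
    next : ∀ y → white y ≡ white f → y ≢ e → y ≢ f → Cyc (wk e) (wk f) (wk y)
    next y yf y≢e y≢f with ℕₚ.<-cmp (wk y) (wk f)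
    ... | tri< l _ _ = ⊥-elim (none (y , yf , l))
    ... | tri≈ _ s _ = ⊥-elim (y≢f (wk-inj yf s))
    ... | tri> _ _ l = inj₂ (inj₁ (l , ℕₚ.≤∧≢⇒< (max y (yf , y≢f)) (y≢e ∘ wk-inj (trans yf (sym ef)))))

  adjacent-injective : ∀ {e f f′} → Adjacent T e f → Adjacent T e f′ → f ≡ f′
  adjacent-injective {e} {f} {f′} (ef , e≢f , next) (ef′ , e≢f′ , next′) =
    decidable-stable (f ≟ f′) λ f≢f′ → CycOrd.asym
      (CycOrd.cyclic (CycOrd.cyclic (next f′ (trans (sym ef′) ef) (e≢f′ ∘ sym) (f≢f′ ∘ sym))))
      (CycOrd.cyclic (CycOrd.cyclic (next′ f (trans (sym ef) ef′) (e≢f ∘ sym) f≢f′)))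

  first-at : ∀ V → ∃[ f ] (black f ≡ V × (∀ y → black y ≡ V → rk f ≤ rk y))
  first-at V = least (λ y → black y ≟ V) rk (blacks V)

  last-at : ∀ V → ∃[ e ] (black e ≡ V × (∀ y → black y ≡ V → rk y ≤ rk e))
  last-at V = greatest (λ y → black y ≟ V) rk (blacks V)

⊎-injective⇒≤ : ∀ {a b n} (f : Fin a ⊎ Fin b → Fin n) → Injective _≡_ _≡_ f → a ℕ.+ b ≤ n
⊎-injective⇒≤ {a} {b} f inj = injective⇒≤ {f = f ∘ splitAt a} λ {x} {y} e →
  trans (sym (join-splitAt a b x)) (trans (cong (Fin.join a b) (inj e)) (join-splitAt a b y))

-- Pigeonhole: without white leaves 2W ≤ n, hence 2B ≥ n + 2, and the B last
-- edges cannot be disjoint from the B - 1 predecessors of the nonroot special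
-- ones.

module _ {n : ℕ} (T : KeyedTree n) (thick : ∀ f → ∃[ x ] (KeyedTree.white T x ≡ KeyedTree.white T f × x ≢ f)) where
  open KeyedTree T

  private
    prev : ∀ f → ∃[ e ] Adjacent T e f
    prev f = let (x , p , q) = thick f in predecessor T f x p q

    sp la : Fin B → Fin n
    sp V = proj₁ (first-at T V)
    la V = proj₁ (last-at T V)

    Foldable : Fin B → Set
    Foldable V = V ≢ root × la (black (proj₁ (prev (sp V)))) ≡ proj₁ (prev (sp V))

    foldable-vertex : ∃ Foldable
    foldable-vertex with any? (λ V → ¬? (V ≟ root) ×-dec (la (black (proj₁ (prev (sp V)))) ≟ proj₁ (prev (sp V))))
    ... | yes found = found
    ... | no none   = ⊥-elim (ℕₚ.1+n≰n (begin
      suc (suc n ℕ.+ n)             ≡⟨ cong suc (ℕₚ.+-comm (suc n) n) ⟩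
      suc n ℕ.+ suc n               ≡⟨ sym (cong₂ ℕ._+_ count-≡ count-≡) ⟩
      (B ℕ.+ W) ℕ.+ (B ℕ.+ W)       ≡⟨ arith B W ⟩
      (B ℕ.+ B) ℕ.+ (W ℕ.+ W)       ≤⟨ ℕₚ.+-mono-≤ blacks≤ whites≤ ⟩
      suc n ℕ.+ n                   ∎))
      where
      open ℕₚ.≤-Reasoning
      arith : ∀ b w → (b ℕ.+ w) ℕ.+ (b ℕ.+ w) ≡ (b ℕ.+ b) ℕ.+ (w ℕ.+ w)
      arith = solve-∀
      -- The root contributes no predecessor and is sent to the extra point `zero`. Without a
      -- foldable vertex this is injective, so 2B ≤ n + 1.
      φ : Fin B ⊎ Fin B → Fin (suc n)
      φ (inj₁ V) with V ≟ root
      ... | yes _ = zero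
      ... | no _  = suc (proj₁ (prev (sp V)))
      φ (inj₂ V) = suc (la V)
      sp-inj : ∀ {V V′} → proj₁ (prev (sp V)) ≡ proj₁ (prev (sp V′)) → V ≡ V′
      sp-inj {V} {V′} e = trans (sym (proj₁ (proj₂ (first-at T V)))) (trans (cong black
        (adjacent-injective T (proj₂ (prev (sp V))) (subst (λ z → Adjacent T z (sp V′)) (sym e) (proj₂ (prev (sp V′))))))
        (proj₁ (proj₂ (first-at T V′))))
      la-inj : ∀ {V V′} → la V ≡ la V′ → V ≡ V′
      la-inj {V} {V′} e = trans (sym (proj₁ (proj₂ (last-at T V)))) (trans (cong black e) (proj₁ (proj₂ (last-at T V′))))
      clash : ∀ {V V′} → V ≢ root → proj₁ (prev (sp V)) ≡ la V′ → ⊥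
      clash {V} {V′} ne e = none (V , ne , trans (cong (la ∘ black) e)
        (trans (cong la (proj₁ (proj₂ (last-at T V′)))) (sym e)))
      φ-inj : Injective _≡_ _≡_ φ
      φ-inj {inj₁ V} {inj₁ V′} e with V ≟ root | V′ ≟ root
      ... | yes p | yes q = cong inj₁ (trans p (sym q))
      ... | no _  | no _  = cong inj₁ (sp-inj (suc-injective e))
      φ-inj {inj₁ V} {inj₂ V′} e with V ≟ root
      ... | no ne = ⊥-elim (clash ne (suc-injective e))
      φ-inj {inj₂ V} {inj₁ V′} e with V′ ≟ root
      ... | no ne = ⊥-elim (clash ne (sym (suc-injective e)))
      φ-inj {inj₂ V} {inj₂ V′} e = cong inj₂ (la-inj (suc-injective e))
      blacks≤ : B ℕ.+ B ≤ suc n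
      blacks≤ = ⊎-injective⇒≤ φ φ-inj
      at : Fin W → Fin n
      at V = proj₁ (whites V)
      at-white : ∀ V → white (at V) ≡ V
      at-white V = proj₂ (whites V)
      other-white : ∀ V → white (proj₁ (thick (at V))) ≡ V
      other-white V = trans (proj₁ (proj₂ (thick (at V)))) (at-white V)
      ψ : Fin W ⊎ Fin W → Fin n
      ψ (inj₁ V) = at V
      ψ (inj₂ V) = proj₁ (thick (at V))
      apart : ∀ {V V′} → at V ≢ proj₁ (thick (at V′))
      apart {V} {V′} e with trans (sym (at-white V)) (trans (cong white e) (other-white V′))
      ... | refl = proj₂ (proj₂ (thick (at V))) (sym e)
      ψ-inj : Injective _≡_ _≡_ ψ
      ψ-inj {inj₁ V} {inj₁ V′} e = cong inj₁ (trans (sym (at-white V)) (trans (cong white e) (at-white V′)))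
      ψ-inj {inj₁ V} {inj₂ V′} e = ⊥-elim (apart e)
      ψ-inj {inj₂ V} {inj₁ V′} e = ⊥-elim (apart (sym e))
      ψ-inj {inj₂ V} {inj₂ V′} e = cong inj₂ (trans (sym (other-white V)) (trans (cong white e) (other-white V′)))
      whites≤ : W ℕ.+ W ≤ n
      whites≤ = ⊎-injective⇒≤ ψ ψ-inj

  foldable : ∃[ e ] ∃[ f ] (Adjacent T e f × (∀ y → black y ≡ black e → rk y ≤ rk e) ×
             (∀ y → black y ≡ black f → rk f ≤ rk y) × black f ≢ root)
  foldable =
    let (V , V≢root , at-end) = foldable-vertex
        (f , fV , first)      = first-at T V
        (e , adjacent)        = prev f
        (_ , _ , greatest-rk) = last-at T (black e)
    in e , f , adjacent
     , (λ y p → subst (λ z → rk y ≤ rk z) at-end (greatest-rk y p))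
     , (λ y p → first y (trans p fV)) , λ p → V≢root (trans (sym fV) p)

module _ {n : ℕ} (T : KeyedTree (suc n)) (rec : ∀ (T′ : KeyedTree n) → Labelling T′) where
  open KeyedTree T

  label-thick : (∃[ e ] ∃[ f ] (Adjacent T e f × (∀ y → black y ≡ black e → rk y ≤ rk e) ×
                (∀ y → black y ≡ black f → rk f ≤ rk y) × black f ≢ root)) → Labelling T
  label-thick (e , f , rest) = go (view f e) rest
    where
    go : ∀ {e} → View f e → Adjacent T e f × (∀ y → black y ≡ black e → rk y ≤ rk e) ×
         (∀ y → black y ≡ black f → rk f ≤ rk y) × black f ≢ root → Labelling T
    go new     (adjacent , _) = ⊥-elim (proj₁ (proj₂ adjacent) refl)
    go (old e) (adjacent , last , first , f≢root) =
      Fold.unfolded T adjacent last first f≢root (rec (Fold.folded T adjacent last first f≢root))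

  label-leaf : ∀ g → IsLeaf T g → (∃[ x ] g ≢ x) → Labelling T
  label-leaf g leaf (x , g≢x) =
    let (y , p , q)   = sibling
        (h , hg , nb) = neighbour T g y p q
    in RemoveLeaf.extended T leaf hg (rec (RemoveLeaf.removed T leaf hg)) nb
    where
    -- Otherwise `g`, alone at its white vertex, would be alone at its black one too and form a
    -- component by itself, although there is another edge.
    sibling : ∃[ y ] (g ≢ y × black y ≡ black g)
    sibling with any? (λ y → ¬? (g ≟ y) ×-dec (black y ≟ black g))
    ... | yes (y , p , q) = y , p , q
    ... | no none = ⊥-elim (g≢x (connected (g ≡_)
      (λ { {x} {y} p refl → decidable-stable (g ≟ y) λ ne → none (y , ne , sym p) })
      (λ { {x} {y} p refl → leaf y p }) g x refl))

  label-step : ∃[ x ] ∃[ y ] x ≢ y → Labelling T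
  label-step (x , y , x≢y) = go (any? (λ g → all? (λ x → (white g ≟ white x) →-dec (g ≟ x))))
    where
    other : ∀ g → ∃[ z ] g ≢ z
    other g with g ≟ x
    ... | yes refl = y , x≢y
    ... | no ne    = x , ne
    go : Dec (∃[ g ] IsLeaf T g) → Labelling T
    go (yes (g , leaf)) = label-leaf g leaf (other g)
    go (no no-leaf) = label-thick (foldable T λ f → decidable-stable
      (any? (λ x → (white x ≟ white f) ×-dec ¬? (x ≟ f)))
      (λ none → no-leaf (f , λ x p → decidable-stable (f ≟ x) λ ne → none (x , sym p , ne ∘ sym))))

labelling : ∀ {m n} → n ≡ suc m → (T : KeyedTree n) → Labelling T
labelling {zero} refl T = record
  { ℓ = λ _ → 0 ; injective = λ {x} {y} _ → single x y
  ; mono = λ { {zero} {zero} _ l → ⊥-elim (ℕₚ.<-irrefl refl l) }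
  ; cyc = λ { {zero} {zero} _ _ s → ⊥-elim (proj₁ (CycOrd′.distinct s) refl) }
  ; convex = λ _ ()
  ; noncrossing = λ _ _ _ ()
  ; root-first = λ {x} {y} p q → ⊥-elim (q (trans (cong black (single y x)) p))
  }
  where
  open KeyedTree T
  single : (x y : Fin 1) → x ≡ y
  single zero zero = refl
labelling {suc m} refl T = label-step T (labelling refl) (zero , suc zero , λ ())

-- Isomorphisms and realisation

⇔-subst : ∀ {A B : Set} (C : A → B → B → B → Set) {v v′ a a′ b b′ c c′} →
          v ≡ v′ → a ≡ a′ → b ≡ b′ → c ≡ c′ → C v a b c ⇔ C v′ a′ b′ c′
⇔-subst C refl refl refl refl = mk⇔ id id

≅-refl : ∀ {T : 𝔗} → T ≅ T
≅-refl = record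
  { onBlack = ↔-id _ ; onWhite = ↔-id _ ; onEdges = ↔-id _
  ; blackEnd-≡ = λ _ → refl ; whiteEnd-≡ = λ _ → refl
  ; blackCyc-⇔ = λ _ _ _ _ → mk⇔ id id ; whiteCyc-⇔ = λ _ _ _ _ → mk⇔ id id
  ; root-≡ = refl ; special-≡ = λ _ → refl }

≅-sym : ∀ {T U : 𝔗} → T ≅ U → U ≅ T
≅-sym {T , _} {U , _} iso = record
  { onBlack = ↔-sym onBlack ; onWhite = ↔-sym onWhite ; onEdges = ↔-sym onEdges
  ; blackEnd-≡ = λ e → sym (Bl.inverseʳ (trans (cong U.blackEnd (sym (E.strictlyInverseˡ e))) (blackEnd-≡ (E.from e))))
  ; whiteEnd-≡ = λ e → sym (Wh.inverseʳ (trans (cong U.whiteEnd (sym (E.strictlyInverseˡ e))) (whiteEnd-≡ (E.from e))))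
  ; blackCyc-⇔ = λ v a b c →
      let h = blackCyc-⇔ (Bl.from v) (E.from a) (E.from b) (E.from c)
          k = ⇔-subst U.blackCyc (Bl.strictlyInverseˡ v) (E.strictlyInverseˡ a) (E.strictlyInverseˡ b) (E.strictlyInverseˡ c)
      in mk⇔ (from h ∘ from k) (to k ∘ to h)
  ; whiteCyc-⇔ = λ v a b c →
      let h = whiteCyc-⇔ (Wh.from v) (E.from a) (E.from b) (E.from c)
          k = ⇔-subst U.whiteCyc (Wh.strictlyInverseˡ v) (E.strictlyInverseˡ a) (E.strictlyInverseˡ b) (E.strictlyInverseˡ c)
      in mk⇔ (from h ∘ from k) (to k ∘ to h)
  ; root-≡ = sym (Bl.inverseʳ root-≡)
  ; special-≡ = λ v → sym (E.inverseʳ (trans (cong U.special (sym (Bl.strictlyInverseˡ v))) (special-≡ (Bl.from v))))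
  }
  where
  open Isomorphism iso
  module T = MarkedFatGraph T
  module U = MarkedFatGraph U
  module Bl = Inverse onBlack
  module Wh = Inverse onWhite
  module E = Inverse onEdges

≅-trans : ∀ {T U V : 𝔗} → T ≅ U → U ≅ V → T ≅ V
≅-trans iso iso′ = record
  { onBlack = J.onBlack ↔-∘ I.onBlack ; onWhite = J.onWhite ↔-∘ I.onWhite ; onEdges = J.onEdges ↔-∘ I.onEdges
  ; blackEnd-≡ = λ e → trans (J.blackEnd-≡ _) (cong J.β (I.blackEnd-≡ e))
  ; whiteEnd-≡ = λ e → trans (J.whiteEnd-≡ _) (cong J.ω (I.whiteEnd-≡ e))
  ; blackCyc-⇔ = λ v a b c → let h = I.blackCyc-⇔ v a b c ; k = J.blackCyc-⇔ (I.β v) (I.ε a) (I.ε b) (I.ε c) in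
                             mk⇔ (to k ∘ to h) (from h ∘ from k)
  ; whiteCyc-⇔ = λ v a b c → let h = I.whiteCyc-⇔ v a b c ; k = J.whiteCyc-⇔ (I.ω v) (I.ε a) (I.ε b) (I.ε c) in
                             mk⇔ (to k ∘ to h) (from h ∘ from k)
  ; root-≡ = trans J.root-≡ (cong J.β I.root-≡)
  ; special-≡ = λ v → trans (J.special-≡ _) (cong J.ε (I.special-≡ v))
  }
  where
  module I = Isomorphism iso
  module J = Isomorphism iso′

special-least : ∀ M V j → MarkedFatGraph.blackEnd (markedΓ M) j ≡ V → MarkedFatGraph.special (markedΓ M) V Fin.≤ j
special-least (m , M) V =
  proj₂ (proj₂ (smallest (λ i → block (partition (top M)) i ≟ V) (nonempty (partition (top M)) V)))

special-unique : ∀ M V i → MarkedFatGraph.blackEnd (markedΓ M) i ≡ V →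
  (∀ j → MarkedFatGraph.blackEnd (markedΓ M) j ≡ V → i Fin.≤ j) → MarkedFatGraph.special (markedΓ M) V ≡ i
special-unique M V i iV min = toℕ-injective (ℕₚ.≤-antisym (special-least M V i iV)
  (min _ (MarkedFatGraph.special-at (markedΓ M) V)))

module _ {n : ℕ} {π ρ : NC n} (e : π ≈ ρ) where
  private
    f : Fin n → Fin (size π)
    f = block (partition π)
    g : Fin n → Fin (size ρ)
    g = block (partition ρ)
    pt : ∀ V → ∃[ i ] f i ≡ V
    pt = nonempty (partition π)
    pt′ : ∀ V → ∃[ i ] g i ≡ V
    pt′ = nonempty (partition ρ)

  blocks-↔ : Fin (size π) ↔ Fin (size ρ)
  blocks-↔ = mk↔ₛ′ (λ V → g (proj₁ (pt V))) (λ V → f (proj₁ (pt′ V)))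
    (λ V → trans (to (e _ _) (proj₂ (pt (f (proj₁ (pt′ V)))))) (proj₂ (pt′ V)))
    (λ V → trans (from (e _ _) (proj₂ (pt′ (g (proj₁ (pt V)))))) (proj₂ (pt V)))

  blocks-↔-block : ∀ i → g i ≡ Inverse.to blocks-↔ (f i)
  blocks-↔-block i = to (e _ _) (sym (proj₂ (pt (f i))))

  blocks-↔-fibre : ∀ V i → f i ≡ V ⇔ g i ≡ Inverse.to blocks-↔ V
  blocks-↔-fibre V i = mk⇔ (λ p → trans (blocks-↔-block i) (cong (Inverse.to blocks-↔) p))
    (λ p → trans (from (e _ _) p) (proj₂ (pt V)))

Increasing-cong : ∀ {n} {P Q : Fin n → Set} → (∀ i → P i ⇔ Q i) →
                  ∀ {a b c} → Increasing P a b c → Increasing Q a b c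
Increasing-cong iff ((p , q , r) , s) = (to (iff _) p , to (iff _) q , to (iff _) r) , s

forget-cong : ∀ {M N} → M ≈ᴹ N → Isomorphism (markedΓ M) (markedΓ N)
forget-cong {m , M} {.m , N} (same e₁ e₂) = record
  { onBlack = blocks-↔ {π = top M} {top N} e₁ ; onWhite = blocks-↔ {π = bottom M} {bottom N} e₂ ; onEdges = ↔-id _
  ; blackEnd-≡ = blocks-↔-block {π = top M} {top N} e₁
  ; whiteEnd-≡ = blocks-↔-block {π = bottom M} {bottom N} e₂
  ; blackCyc-⇔ = λ V _ _ _ → let h = blocks-↔-fibre {π = top M} {top N} e₁ V in
      mk⇔ (Increasing-cong h) (Increasing-cong λ i → mk⇔ (from (h i)) (to (h i)))
  ; whiteCyc-⇔ = λ V _ _ _ → let h = blocks-↔-fibre {π = bottom M} {bottom N} e₂ V in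
      mk⇔ (Increasing-cong h) (Increasing-cong λ i → mk⇔ (from (h i)) (to (h i)))
  ; root-≡ = blocks-↔-block {π = top M} {top N} e₁ zero
  ; special-≡ = λ V → let h = blocks-↔-fibre {π = top M} {top N} e₁ V in
      special-unique (m , N) _ _ (to (h _) (MarkedFatGraph.special-at (markedΓ (m , M)) V))
        (λ j p → special-least (m , M) V j (from (h j) p))
  }

injective⇒hits : ∀ {n} {f : Fin n → Fin n} → Injective _≡_ _≡_ f → StrictlySurjective _≡_ f
injective⇒hits {suc n} {f} inj y with any? (λ x → f x ≟ y)
... | yes hit = hit
... | no miss = ⊥-elim (ℕₚ.1+n≰n (injective⇒≤ {f = λ x → punchOut (λ e → miss (x , sym e))}
  λ {x} {x′} e → inj (punchOut-injective {i = y} _ _ e)))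

record Ranking {n} (ℓ : Fin n → ℕ) : Set where
  field
    rank       : Fin n → Fin n
    unrank     : Fin n → Fin n
    rank-mono  : ∀ {x y} → ℓ x < ℓ y → rank x Fin.< rank y
    rank∘unrank : ∀ i → rank (unrank i) ≡ i
    unrank∘rank : ∀ x → unrank (rank x) ≡ x
    unrank-mono : ∀ {i j} → i Fin.< j → ℓ (unrank i) < ℓ (unrank j)

-- The rank of an edge is the number of smaller labels; it is onto because an injective self-map of
-- a finite set is.
ranking : ∀ {n} (ℓ : Fin n → ℕ) → (∀ {x y} → ℓ x ≡ ℓ y → x ≡ y) → Ranking ℓ
ranking {n} ℓ ℓ-inj = record
  { rank = rank ; unrank = unrank ; rank-mono = rank-mono
  ; rank∘unrank = λ i → proj₂ (injective⇒hits rank-inj i)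
  ; unrank∘rank = λ x → rank-inj (proj₂ (injective⇒hits rank-inj (rank x)))
  ; unrank-mono = λ {i} {j} lt → reflects (subst₂ Fin._<_ (sym (proj₂ (injective⇒hits rank-inj i)))
                                                     (sym (proj₂ (injective⇒hits rank-inj j))) lt) }
  where
  below? : ∀ x y → Dec (ℓ y < ℓ x)
  below? x y = ℓ y ℕₚ.<? ℓ x
  count-all : ∀ {n} {P : Fin n → Set} (P? : ∀ x → Dec (P x)) → count P? ≤ n
  count-all {zero}  P? = ℕ.z≤n
  count-all {suc n} P? with P? zero
  ... | yes _ = ℕ.s≤s (count-all (P? ∘ suc))
  ... | no _  = ℕₚ.m≤n⇒m≤1+n (count-all (P? ∘ suc))
  bounded : ∀ x → count (below? x) < n
  bounded x = ℕₚ.<-≤-trans (count-< (below? x) (λ _ → yes tt) (λ _ _ → tt) x (ℕₚ.<-irrefl refl) tt)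
                           (count-all (λ (_ : Fin n) → yes tt))
  rank : Fin n → Fin n
  rank x = fromℕ< (bounded x)
  rank-mono : ∀ {x y} → ℓ x < ℓ y → rank x Fin.< rank y
  rank-mono {x} {y} lt = subst₂ _<_ (sym (toℕ-fromℕ< (bounded x))) (sym (toℕ-fromℕ< (bounded y)))
    (count-< (below? x) (below? y) (λ _ u → ℕₚ.<-trans u lt) x (ℕₚ.<-irrefl refl) lt)
  rank-inj : Injective _≡_ _≡_ rank
  rank-inj {x} {y} e with ℕₚ.<-cmp (ℓ x) (ℓ y)
  ... | tri< l _ _ = ⊥-elim (ℕₚ.<-irrefl (cong toℕ e) (rank-mono l))
  ... | tri≈ _ q _ = ℓ-inj q
  ... | tri> _ _ l = ⊥-elim (ℕₚ.<-irrefl (cong toℕ (sym e)) (rank-mono l))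
  unrank : Fin n → Fin n
  unrank i = proj₁ (injective⇒hits rank-inj i)
  reflects : ∀ {x y} → rank x Fin.< rank y → ℓ x < ℓ y
  reflects {x} {y} lt with ℕₚ.<-cmp (ℓ x) (ℓ y)
  ... | tri< l _ _ = l
  ... | tri≈ _ q _ = ⊥-elim (ℕₚ.<-irrefl (cong (toℕ ∘ rank) (ℓ-inj q)) lt)
  ... | tri> _ _ l = ⊥-elim (ℕₚ.<-asym lt (rank-mono l))

convex⇒interval : ∀ {n} (π : Partition n) → Convex (block π) → IsInterval π
convex⇒interval π convex V =
  let (p , pV , min) = least (λ i → block π i ≟ V) toℕ (nonempty π V)
      (q , qV , max) = greatest (λ i → block π i ≟ V) toℕ (nonempty π V)
  in p , q , λ i → mk⇔ (λ iV → min i iV , max i iV)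
       (λ (p≤i , i≤q) → inside p q i pV qV (ℕₚ.m≤n⇒m<n∨m≡n p≤i) (ℕₚ.m≤n⇒m<n∨m≡n i≤q))
  where
  inside : ∀ p q i → block π p ≡ V → block π q ≡ V → p Fin.< i ⊎ toℕ p ≡ toℕ i →
           i Fin.< q ⊎ toℕ i ≡ toℕ q → block π i ≡ V
  inside p q i pV qV (inj₂ e) _        = trans (cong (block π) (sym (toℕ-injective e))) pV
  inside p q i pV qV _        (inj₂ e) = trans (cong (block π) (toℕ-injective e)) qV
  inside p q i pV qV (inj₁ u) (inj₁ v) = trans (convex (trans pV (sym qV)) (u , v)) pV

-- Labels increase clockwise around white vertices, against the orientation of `whiteCyc`, so the
-- reversed order is cut there.
reverse-order : ∀ {E : Set} {P : E → Set} {C : E → E → E → Set} →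
                IsCyclicOrder P C → IsCyclicOrder P (λ a b c → C c b a)
reverse-order order = record
  { support = λ s → let (r , q , p) = support s in p , q , r
  ; cyclic  = λ s → cyclic (cyclic s)
  ; asym    = asym
  ; transit = λ s t → cyclic (transit (cyclic (cyclic t)) (cyclic (cyclic s)))
  ; total   = λ p q r u v w → total r q p (v ∘ sym) (u ∘ sym) (w ∘ sym)
  }
  where open IsCyclicOrder order

module Realise {m : ℕ} (T : MarkedFatGraph) (tree : IsTree (graph T))
               (#edges-≡ : MarkedFatGraph.#edges T ≡ suc m) where
  open MarkedFatGraph T hiding (graph)

  private
    blacks : StrictlySurjective _≡_ blackEnd
    blacks V = special V , special-at V

    whites : StrictlySurjective _≡_ whiteEnd
    whites = tree⇒whites (graph T) tree root

    module Black V = Cut (isCyclicOrderᵇ V) (λ e → blackEnd e ≟ V) (special V) (special-at V)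
    module White V = Cut (reverse-order (isCyclicOrderʷ V)) (λ e → whiteEnd e ≟ V) (proj₁ (whites V)) (proj₂ (whites V))

    rk wk : Fin #edges → ℕ
    rk x = Black.key (blackEnd x) x
    wk x = White.key (whiteEnd x) x

    rk-at : ∀ {V x} → blackEnd x ≡ V → rk x ≡ Black.key V x
    rk-at refl = refl

    wk-at : ∀ {V x} → whiteEnd x ≡ V → wk x ≡ White.key V x
    wk-at refl = refl

    keyed : KeyedTree #edges
    keyed = record
      { black = blackEnd ; white = whiteEnd ; rk = rk ; wk = wk ; root = root
      ; blacks = blacks ; whites = whites
      ; rk-inj = λ {x} {y} p q → Black.key-injective (blackEnd y) p refl (trans (sym (rk-at p)) q)
      ; wk-inj = λ {x} {y} p q → White.key-injective (whiteEnd y) p refl (trans (sym (wk-at p)) q)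
      ; connected = tree⇒connected (graph T) tree
      ; count-≡ = tree⇒count (graph T) tree root blacks
      }
    L : Labelling keyed
    L = labelling #edges-≡ keyed
    module L = Labelling L

  open Ranking (ranking L.ℓ L.injective) public

  private
    rank-cyc : ∀ {a b c} → Cyc (L.ℓ a) (L.ℓ b) (L.ℓ c) → Cyc (toℕ (rank a)) (toℕ (rank b)) (toℕ (rank c))
    rank-cyc = Cyc-map rank-mono rank-mono rank-mono

  top-partition : Partition #edges
  top-partition = record
    { #blocks = #black ; block = blackEnd ∘ unrank
    ; nonempty = λ V → let (x , p) = blacks V in rank x , trans (cong blackEnd (unrank∘rank x)) p }

  top-convex : Convex (block top-partition)
  top-convex e (u , v) = L.convex e (unrank-mono u) (unrank-mono v)

  top-NC : NC #edges
  top-NC = record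
    { partition = top-partition
    ; nonCrossing = λ V≢W a<b b<c _ aV cV bW _ →
        V≢W (trans (sym aV) (trans (sym (top-convex (trans aV (sym cV)) (a<b , b<c))) bW)) }

  bottom-NC : NC #edges
  bottom-NC = record
    { partition = record
      { #blocks = #white ; block = whiteEnd ∘ unrank
      ; nonempty = λ V → let (x , p) = whites V in rank x , trans (cong whiteEnd (unrank∘rank x)) p }
    ; nonCrossing = λ V≢W a<b b<c c<d aV cV bW dW →
        L.noncrossing (trans aV (sym cV)) (trans bW (sym dW)) (λ e → V≢W (trans (sym aV) (trans e bW)))
          (unrank-mono a<b) (unrank-mono b<c) (unrank-mono c<d) }

  NC-connected : EdgeConnected (block top-partition) (block (partition bottom-NC))
  NC-connected P onB onW x y px = subst P (rank∘unrank y) (tree⇒connected (graph T) tree (P ∘ rank)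
    (λ {x} {y} p → onB (trans (cong blackEnd (unrank∘rank x)) (trans p (cong blackEnd (sym (unrank∘rank y))))))
    (λ {x} {y} p → onW (trans (cong whiteEnd (unrank∘rank x)) (trans p (cong whiteEnd (sym (unrank∘rank y))))))
    (unrank x) (unrank y) (subst P (sym (rank∘unrank x)) px))

  NC-count : size top-NC ℕ.+ size bottom-NC ≡ suc #edges
  NC-count = tree⇒count (graph T) tree root blacks

  rank-↔ : Fin #edges ↔ Fin #edges
  rank-↔ = mk↔ₛ′ rank unrank rank∘unrank unrank∘rank

  root-least : ∀ i → (∀ j → i Fin.≤ j) → block top-partition i ≡ root
  root-least i min = decidable-stable (blackEnd (unrank i) ≟ root) λ ne →
    ℕₚ.<⇒≱ (subst (rank (special root) Fin.<_) (rank∘unrank i)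
             (rank-mono (L.root-first (special-at root) ne))) (min (rank (special root)))

  -- The order around a black vertex was cut at the special edge, which therefore has the least key.
  special-rank-least : ∀ V j → block top-partition j ≡ V → rank (special V) Fin.≤ j
  special-rank-least V j jV with unrank j ≟ special V
  ... | yes e = ℕₚ.≤-reflexive (cong toℕ (trans (cong rank (sym e)) (rank∘unrank j)))
  ... | no ne = subst (rank (special V) Fin.≤_) (rank∘unrank j) (ℕₚ.<⇒≤ (rank-mono
    (L.mono (trans (special-at V) (sym jV)) (ℕₚ.≤∧≢⇒< (subst₂ _≤_ (sym (rk-at (special-at V))) (sym (rk-at jV))
      (Black.key-least V (unrank j) jV))
      (λ e → ne (sym (Black.key-injective V (special-at V) jV
        (trans (sym (rk-at (special-at V))) (trans e (rk-at jV))))))))))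

  black-cyc : ∀ V a b c → blackCyc V a b c ⇔
              Increasing (λ i → block top-partition i ≡ V) (rank a) (rank b) (rank c)
  black-cyc V a b c = mk⇔ forward λ s →
    let (p , q , r) = proj₁ s
        (u , v , w) = CyclicOrder.distinct (increasing (λ i → block top-partition i ≡ V)) s
    in CyclicOrder.reflects (isCyclicOrderᵇ V) (increasing (λ i → block top-partition i ≡ V)) rank forward
         (trans (cong blackEnd (sym (unrank∘rank a))) p) (trans (cong blackEnd (sym (unrank∘rank b))) q)
         (trans (cong blackEnd (sym (unrank∘rank c))) r)
         (u ∘ cong rank) (v ∘ cong rank) (w ∘ cong rank) s
    where
    forward : ∀ {a b c} → blackCyc V a b c → Increasing (λ i → block top-partition i ≡ V) (rank a) (rank b) (rank c)
    forward {a} {b} {c} s =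
      let (p , q , r) = IsCyclicOrder.support (isCyclicOrderᵇ V) s in
      (trans (cong blackEnd (unrank∘rank a)) p , trans (cong blackEnd (unrank∘rank b)) q , trans (cong blackEnd (unrank∘rank c)) r) ,
      rank-cyc {a} {b} {c} (Cyc-map (mono p q) (mono q r) (mono r p) (Black.key-cyc V s))
      where
      mono : ∀ {x y} → blackEnd x ≡ V → blackEnd y ≡ V → Black.key V x < Black.key V y → L.ℓ x < L.ℓ y
      mono p q l = L.mono (trans p (sym q)) (subst₂ _<_ (sym (rk-at p)) (sym (rk-at q)) l)

  white-cyc : ∀ V a b c → whiteCyc V a b c ⇔
              Decreasing (λ i → block (partition bottom-NC) i ≡ V) (rank a) (rank b) (rank c)
  white-cyc V a b c = mk⇔ forward λ s →
    let (p , q , r) = IsCyclicOrder.support order s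
        (u , v , w) = CyclicOrder.distinct order s
    in CyclicOrder.reflects (isCyclicOrderʷ V) order rank forward
         (trans (cong whiteEnd (sym (unrank∘rank a))) p) (trans (cong whiteEnd (sym (unrank∘rank b))) q)
         (trans (cong whiteEnd (sym (unrank∘rank c))) r)
         (u ∘ cong rank) (v ∘ cong rank) (w ∘ cong rank) s
    where
    order : IsCyclicOrder (λ i → block (partition bottom-NC) i ≡ V) _
    order = decreasing (λ i → block (partition bottom-NC) i ≡ V)
    forward : ∀ {a b c} → whiteCyc V a b c → Decreasing (λ i → block (partition bottom-NC) i ≡ V) (rank a) (rank b) (rank c)
    forward {a} {b} {c} s =
      let (p , q , r) = IsCyclicOrder.support (isCyclicOrderʷ V) s in
      (trans (cong whiteEnd (unrank∘rank c)) r , trans (cong whiteEnd (unrank∘rank b)) q , trans (cong whiteEnd (unrank∘rank a)) p) ,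
      rank-cyc {c} {b} {a} (L.cyc (trans r (sym q)) (trans q (sym p))
        (subst₂ (λ k l → Cyc k l (wk a)) (sym (wk-at r)) (sym (wk-at q))
          (subst (Cyc _ _) (sym (wk-at p)) (White.key-cyc V s))))

realise : ∀ (T : 𝔗) → ∃[ M ] Isomorphism (proj₁ T) (markedΓ M)
-- A tree without edges is excluded by the special edge at its root.
realise (record { graph = record { #edges = zero } ; root = r ; special = s } , _) with s r
... | ()
realise (T@(record { graph = record { #edges = suc m } }) , tree) = (m , M) , record
  { onBlack = ↔-id _ ; onWhite = ↔-id _ ; onEdges = rank-↔
  ; blackEnd-≡ = λ e → cong blackEnd (unrank∘rank e)
  ; whiteEnd-≡ = λ e → cong whiteEnd (unrank∘rank e)
  ; blackCyc-⇔ = black-cyc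
  ; whiteCyc-⇔ = white-cyc
  ; root-≡ = root-least zero (λ _ → ℕ.z≤n)
  ; special-≡ = λ V → special-unique (m , M) V (rank (special V))
      (trans (cong blackEnd (unrank∘rank (special V))) (special-at V)) (special-rank-least V)
  }
  where
  open MarkedFatGraph T hiding (graph)
  open Realise T tree refl
  interval : IsInterval top-partition
  interval = convex⇒interval top-partition top-convex
  M : ShallowTop (suc m)
  M = record
    { top = top-NC ; bottom = bottom-NC ; topInterval = interval
    ; distance = connected⇒distance top-NC bottom-NC NC-connected NC-count interval }

-- The successor of a label

-- At a vertex with a single edge `x` and `y` coincide; at any other vertex `others` rules this out.
record Next {E : Set} (P : E → Set) (C : E → E → E → Set) (x y : E) : Set where
  constructor next
  field
    source : P x
    target : P y
    others : ∀ z → P z → z ≢ x → z ≢ y → C x y z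

module _ {E : Set} {P : E → Set} {C : E → E → E → Set} (order : IsCyclicOrder P C)
         (_≟ᴱ_ : (a b : E) → Dec (a ≡ b)) where
  open IsCyclicOrder order
  open CyclicOrder order

  next-unique : ∀ {x y y′} → Next P C x y → Next P C x y′ → y ≡ y′
  next-unique {x} {y} {y′} (next _ Py f) (next _ Py′ g) with y ≟ᴱ y′ | y ≟ᴱ x | y′ ≟ᴱ x
  ... | yes e | _        | _        = e
  ... | no ne | yes refl | yes refl = refl
  ... | no ne | yes refl | no q     = ⊥-elim (proj₁ (distinct (f y′ Py′ q (ne ∘ sym))) refl)
  ... | no ne | no p     | yes refl = ⊥-elim (proj₁ (distinct (g y Py p ne)) refl)
  ... | no ne | no p     | no q     =
    ⊥-elim (asym (cyclic (cyclic (f y′ Py′ q (ne ∘ sym)))) (cyclic (cyclic (cyclic (cyclic (cyclic (g y Py p ne)))))))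

  next-injective : ∀ {x x′ y} → Next P C x y → Next P C x′ y → x ≡ x′
  next-injective {x} {x′} {y} (next Px _ f) (next Px′ _ g) with x ≟ᴱ x′ | x ≟ᴱ y | x′ ≟ᴱ y
  ... | yes e | _        | _        = e
  ... | no ne | yes refl | yes refl = refl
  ... | no ne | yes refl | no q     = ⊥-elim (proj₁ (distinct (f x′ Px′ (ne ∘ sym) q)) refl)
  ... | no ne | no p     | yes refl = ⊥-elim (proj₁ (distinct (g x Px ne p)) refl)
  ... | no ne | no p     | no q     = ⊥-elim (asym (f x′ Px′ (ne ∘ sym) q) (g x Px ne p))

-- In the plane: from the right side of the edge x go down to its white end,
-- continue with the next edge clockwise, and repeat with its clockwise
-- neighbour at the upper end, until a special edge is reached.  When x is the
-- last edge of its block this finds the label following x.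

module _ {E : Set} (BN WN : E → E → Set) (Special : E → Set) where

  data Contour : E → E → Set where
    arrive : ∀ {x y} → WN x y → Special y → Contour x y
    turn   : ∀ {x y x′ z} → WN x y → ¬ Special y → BN x′ y → Contour x′ z → Contour x z

  data Successor : E → E → Set where
    within : ∀ {x y} → BN x y → ¬ Special y → Successor x y
    across : ∀ {x y z} → BN x y → Special y → Contour x z → Successor x z

module _ {E : Set} {BN WN : E → E → Set} {Special : E → Set}
         (BN-unique : ∀ {x y y′} → BN x y → BN x y′ → y ≡ y′)
         (BN-injective : ∀ {x x′ y} → BN x y → BN x′ y → x ≡ x′)
         (WN-unique : ∀ {x y y′} → WN x y → WN x y′ → y ≡ y′) where

  contour-unique : ∀ {x y y′} → Contour BN WN Special x y → Contour BN WN Special x y′ → y ≡ y′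
  contour-unique (arrive w s) (arrive w′ s′) = WN-unique w w′
  contour-unique (arrive w s) (turn w′ s′ _ _) with WN-unique w w′
  ... | refl = ⊥-elim (s′ s)
  contour-unique (turn w s _ _) (arrive w′ s′) with WN-unique w w′
  ... | refl = ⊥-elim (s s′)
  contour-unique (turn w _ b c) (turn w′ _ b′ c′) with WN-unique w w′
  ... | refl with BN-injective b b′
  ...   | refl = contour-unique c c′

  successor-unique : ∀ {x y y′} → Successor BN WN Special x y → Successor BN WN Special x y′ → y ≡ y′
  successor-unique (within b s) (within b′ s′) = BN-unique b b′
  successor-unique (within b s) (across b′ s′ _) with BN-unique b b′
  ... | refl = ⊥-elim (s s′)
  successor-unique (across b s _) (within b′ s′) with BN-unique b b′
  ... | refl = ⊥-elim (s′ s)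
  successor-unique (across _ _ c) (across _ _ c′) = contour-unique c c′

module _ {E F : Set} {BN WN : E → E → Set} {S : E → Set} {BN′ WN′ : F → F → Set} {S′ : F → Set}
         (ε : E → F) (black : ∀ {x y} → BN x y → BN′ (ε x) (ε y)) (white : ∀ {x y} → WN x y → WN′ (ε x) (ε y))
         (special : ∀ {x} → S x ⇔ S′ (ε x)) where

  contour-map : ∀ {x y} → Contour BN WN S x y → Contour BN′ WN′ S′ (ε x) (ε y)
  contour-map (arrive w s)   = arrive (white w) (to special s)
  contour-map (turn w s b c) = turn (white w) (s ∘ from special) (black b) (contour-map c)

  successor-map : ∀ {x y} → Successor BN WN S x y → Successor BN′ WN′ S′ (ε x) (ε y)
  successor-map (within b s)   = within (black b) (s ∘ from special)
  successor-map (across b s c) = across (black b) (to special s) (contour-map c)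

module _ (G : MarkedFatGraph) where
  open MarkedFatGraph G

  BlackNext WhiteNext : Fin #edges → Fin #edges → Set
  BlackNext x y = Next (λ e → blackEnd e ≡ blackEnd x) (blackCyc (blackEnd x)) x y
  WhiteNext x y = Next (λ e → whiteEnd e ≡ whiteEnd x) (λ a b c → whiteCyc (whiteEnd x) c b a) x y

  IsSpecial : Fin #edges → Set
  IsSpecial y = special (blackEnd y) ≡ y

  EdgeSuccessor : Fin #edges → Fin #edges → Set
  EdgeSuccessor = Successor BlackNext WhiteNext IsSpecial

  edge-successor-unique : ∀ {x y y′} → EdgeSuccessor x y → EdgeSuccessor x y′ → y ≡ y′
  edge-successor-unique = successor-unique
    (λ {x} → next-unique (isCyclicOrderᵇ (blackEnd x)) _≟_)
    (λ {x} {x′} {y} n n′ → next-injective (isCyclicOrderᵇ (blackEnd x)) _≟_ n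
      (subst (λ V → Next (λ e → blackEnd e ≡ V) (blackCyc V) x′ y)
             (trans (sym (Next.target n′)) (Next.target n)) n′))
    (λ {x} → next-unique (reverse-order (isCyclicOrderʷ (whiteEnd x))) _≟_)

module _ {T U : MarkedFatGraph} (iso : Isomorphism T U) where
  open Isomorphism iso
  private
    module T = MarkedFatGraph T
    module U = MarkedFatGraph U
    module E = Inverse onEdges
    module Bl = Inverse onBlack
    module Wh = Inverse onWhite

    lift-other : ∀ {P : Fin U.#edges → Set} → (∀ z → P (ε z)) → ∀ z → P z
    lift-other {P} h z = subst P (E.strictlyInverseˡ z) (h (E.from z))

    β-injective : ∀ {V V′} → β V ≡ β V′ → V ≡ V′
    β-injective {V} {V′} e = trans (sym (Bl.strictlyInverseʳ V)) (Bl.inverseʳ e)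

    ω-injective : ∀ {V V′} → ω V ≡ ω V′ → V ≡ V′
    ω-injective {V} {V′} e = trans (sym (Wh.strictlyInverseʳ V)) (Wh.inverseʳ e)

    ε-injective : ∀ {x y} → ε x ≡ ε y → x ≡ y
    ε-injective {x} {y} e = trans (sym (E.strictlyInverseʳ x)) (E.inverseʳ e)

    black-map : ∀ {x y} → BlackNext T x y → BlackNext U (ε x) (ε y)
    black-map {x} {y} (next _ t o) = next refl
      (trans (blackEnd-≡ y) (trans (cong β t) (sym (blackEnd-≡ x))))
      (lift-other λ z p z≢x z≢y → subst (λ V → U.blackCyc V (ε x) (ε y) (ε z)) (sym (blackEnd-≡ x))
        (to (blackCyc-⇔ _ _ _ _) (o z (β-injective (trans (sym (blackEnd-≡ z)) (trans p (blackEnd-≡ x))))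
          (z≢x ∘ cong ε) (z≢y ∘ cong ε))))

    white-map : ∀ {x y} → WhiteNext T x y → WhiteNext U (ε x) (ε y)
    white-map {x} {y} (next _ t o) = next refl
      (trans (whiteEnd-≡ y) (trans (cong ω t) (sym (whiteEnd-≡ x))))
      (lift-other λ z p z≢x z≢y → subst (λ V → U.whiteCyc V (ε z) (ε y) (ε x)) (sym (whiteEnd-≡ x))
        (to (whiteCyc-⇔ _ _ _ _) (o z (ω-injective (trans (sym (whiteEnd-≡ z)) (trans p (whiteEnd-≡ x))))
          (z≢x ∘ cong ε) (z≢y ∘ cong ε))))

    special-map : ∀ {x} → IsSpecial T x ⇔ IsSpecial U (ε x)
    special-map {x} = mk⇔ (λ s → trans eq (cong ε s)) (λ s → ε-injective (trans (sym eq) s))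
      where
      eq : U.special (U.blackEnd (ε x)) ≡ ε (T.special (T.blackEnd x))
      eq = trans (cong U.special (blackEnd-≡ x)) (special-≡ (T.blackEnd x))

  edge-successor-map : ∀ {x y} → EdgeSuccessor T x y → EdgeSuccessor U (ε x) (ε y)
  edge-successor-map = successor-map ε black-map white-map special-map

-- The contour of a meander on the line

lower : ∀ {n} {s : Fin n} (y : Fin n) → s Fin.< y → Σ[ x ∈ Fin n ] toℕ y ≡ suc (toℕ x)
lower (suc y) _ = inject₁ y , cong suc (sym (toℕ-inject₁ y))

module Line {n B W : ℕ} (f : Fin n → Fin B) (g : Fin n → Fin W)
            (convex : Convex f) (nest : Nested g) (conn : EdgeConnected f g)
            (special : Fin B → Fin n) (special-at : ∀ V → f (special V) ≡ V)
            (special-min : ∀ V j → f j ≡ V → special V Fin.≤ j) where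

  BN WN : Fin n → Fin n → Set
  BN x y = Next (λ e → f e ≡ f x) (Increasing (λ e → f e ≡ f x)) x y
  WN x y = Next (λ e → g e ≡ g x) (Increasing (λ e → g e ≡ g x)) x y

  Special : Fin n → Set
  Special y = special (f y) ≡ y

  private
    step-next : ∀ {k} (h : Fin n → Fin k) {x y} → h y ≡ h x → x Fin.< y →
                (∀ z → h z ≡ h x → x Fin.< z → z Fin.< y → ⊥) →
                Next (λ e → h e ≡ h x) (Increasing (λ e → h e ≡ h x)) x y
    step-next h {x} {y} yx x<y none = next refl yx others
      where
      others : ∀ z → h z ≡ h x → z ≢ x → z ≢ y → Increasing (λ e → h e ≡ h x) x y z
      others z zx z≢x z≢y with <-cmp z x | <-cmp z y
      ... | tri< z<x _ _ | _            = (refl , yx , zx) , inj₂ (inj₂ (z<x , x<y))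
      ... | _            | tri> _ _ y<z = (refl , yx , zx) , inj₁ (x<y , y<z)
      ... | tri≈ _ e _   | _            = ⊥-elim (z≢x e)
      ... | _            | tri≈ _ e _   = ⊥-elim (z≢y e)
      ... | tri> _ _ x<z | tri< z<y _ _ = ⊥-elim (none z zx x<z z<y)

    wrap-next : ∀ {k} (h : Fin n → Fin k) {x y} → h y ≡ h x →
                (∀ z → h z ≡ h x → y Fin.≤ z × z Fin.≤ x) →
                Next (λ e → h e ≡ h x) (Increasing (λ e → h e ≡ h x)) x y
    wrap-next h yx range = next refl yx λ z zx z≢x z≢y → (refl , yx , zx) ,
      inj₂ (inj₁ ( ℕₚ.≤∧≢⇒< (proj₁ (range z zx)) (z≢y ∘ sym ∘ toℕ-injective)
                 , ℕₚ.≤∧≢⇒< (proj₂ (range z zx)) (z≢x ∘ toℕ-injective)))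

    convex≤ : ∀ {x y z} → f x ≡ f y → x Fin.≤ z → z Fin.≤ y → f z ≡ f x
    convex≤ {x} {y} {z} xy x≤z z≤y with ℕₚ.m≤n⇒m<n∨m≡n x≤z | ℕₚ.m≤n⇒m<n∨m≡n z≤y
    ... | inj₁ x<z | inj₁ z<y = convex xy (x<z , z<y)
    ... | inj₂ e   | _        = cong f (sym (toℕ-injective e))
    ... | _        | inj₂ e   = trans (cong f (toℕ-injective e)) (sym xy)

    special-least′ : ∀ {y z} → Special y → f z ≡ f y → y Fin.≤ z
    special-least′ {y} {z} s e = subst (Fin._≤ z) s (special-min (f y) z e)

    previous : ∀ y → ¬ Special y → ∃[ x ] (toℕ y ≡ suc (toℕ x) × f x ≡ f y × BN x y)
    previous y ns =
      let s<y = ℕₚ.≤∧≢⇒< (special-min (f y) y refl) (ns ∘ toℕ-injective)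
          (x , e) = lower y s<y
          xy = trans (convex≤ {z = x} (special-at (f y)) (ℕₚ.≤-pred (subst (toℕ (special (f y)) <_) e s<y))
                        (ℕₚ.≤-trans (ℕₚ.n≤1+n (toℕ x)) (ℕₚ.≤-reflexive (sym e)))) (special-at (f y))
      in x , e , xy , step-next f (sym xy) (ℕₚ.≤-reflexive (sym e))
           (λ z _ x<z z<y → ℕₚ.<-irrefl refl (ℕₚ.<-≤-trans x<z (ℕₚ.≤-pred (subst (toℕ z <_) e z<y))))

    first : ∀ x → ∃[ y ] (g y ≡ g x × (∀ z → g z ≡ g x → y Fin.≤ z))
    first x = least (λ z → g z ≟ g x) toℕ (x , refl)

  module _ {i j : Fin n} (j≡1+i : toℕ j ≡ suc (toℕ i)) where

    private
      i<j : i Fin.< j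
      i<j = ℕₚ.≤-reflexive (sym j≡1+i)

      ≥j : ∀ {z : Fin n} → i Fin.< z → j Fin.≤ z
      ≥j {z} = subst (_≤ toℕ z) (sym j≡1+i)

    module _ (i≁j : f i ≢ f j) where

      private
        gap-f : ∀ {z w} → f z ≡ f w → z Fin.≤ i → i Fin.< w → ⊥
        gap-f {z} {w} zw z≤i i<w = i≁j (trans
          (convex≤ zw z≤i (ℕₚ.<⇒≤ i<w))
          (sym (convex≤ zw (ℕₚ.≤-trans z≤i (ℕₚ.<⇒≤ i<j)) (≥j i<w))))

        Sealed : Fin n → Set
        Sealed y = ∀ {z w} → g z ≡ g w → i Fin.< z → z Fin.< y → i Fin.< w × w Fin.< y

        -- The contour runs to the right of `i`, and white blocks meeting the open range from `i` to
        -- `y` stay in it. If `y` is special but not `j`, this range is a union of blocks of both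
        -- colours, against connectedness. If `y` is not special, the label before it is in its
        -- black block and is the last of a white block; the contour goes on at the first label `y′`
        -- of that block, and the range up to `y′` is sealed because white blocks do not cross.
        inner : ∀ k {x y} → toℕ y ≤ k → WN x y → i Fin.< y → Sealed y → Contour BN WN Special x j
        inner k {x} {y} y≤k wn i<y sealed with special (f y) ≟ y
        inner k {x} {y} y≤k wn i<y sealed | yes s with <-cmp j y
        ... | tri≈ _ refl _ = arrive wn s
        ... | tri> _ _ y<j = ⊥-elim (ℕₚ.<⇒≱ y<j (≥j i<y))
        ... | tri< j<y _ _ = ⊥-elim (ℕₚ.<-irrefl refl (proj₁ (conn (λ z → i Fin.< z × z Fin.< y)
            onF (λ e (u , v) → sealed e u v) j i (i<j , j<y))))
          where
          onF : Respects f (λ z → i Fin.< z × z Fin.< y)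
          onF {z} {w} e (i<z , z<y) with ℕₚ.<-≤-connex (toℕ i) (toℕ w) | ℕₚ.<-≤-connex (toℕ w) (toℕ y)
          ... | inj₂ w≤i | _        = ⊥-elim (gap-f (sym e) w≤i i<z)
          ... | inj₁ i<w | inj₁ w<y = i<w , w<y
          ... | _        | inj₂ y≤w = ⊥-elim (ℕₚ.<⇒≱ z<y (special-least′ s (sym (convex≤ e (ℕₚ.<⇒≤ z<y) y≤w))))
        inner zero {x} {y} y≤k wn i<y sealed | no ns = ⊥-elim (ℕₚ.<⇒≱ i<y (ℕₚ.≤-trans y≤k ℕ.z≤n))
        inner (suc k) {x} {y} y≤k wn i<y sealed | no ns =
          let (x′ , e , x′y , bn) = previous y ns
              ≤x′ : ∀ {z : Fin n} → z Fin.< y → z Fin.≤ x′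
              ≤x′ {z} z<y = ℕₚ.≤-pred (subst (toℕ z <_) e z<y)
              <y : ∀ {z : Fin n} → z Fin.≤ x′ → z Fin.< y
              <y {z} z≤x′ = subst (toℕ z <_) (sym e) (ℕ.s≤s z≤x′)
              i<x′ : i Fin.< x′
              i<x′ = ℕₚ.≤∧≢⇒< (≤x′ i<y) λ q → i≁j (trans (cong f (toℕ-injective q))
                (trans x′y (cong f (toℕ-injective (trans e (trans (cong suc (sym q)) (sym j≡1+i)))))))
              (y′ , y′x′ , min) = first x′
              range : ∀ z → g z ≡ g x′ → i Fin.< z × z Fin.< y
              range z zx′ = sealed (sym zx′) i<x′ (<y ℕₚ.≤-refl)
              sealed′ : Sealed y′
              sealed′ {z} {w} zw i<z z<y′ =
                let z≁x′ : g z ≢ g x′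
                    z≁x′ q = ℕₚ.<⇒≱ z<y′ (min z q)
                    (i<w , w<y) = sealed zw i<z (ℕₚ.<-trans z<y′ (proj₂ (range y′ y′x′)))
                in i<w , [ id , (λ y′≤w → ⊥-elim (ℕₚ.<-asym z<y′ (proj₁ (nest y′x′ (sym zw)
                     (λ q → z≁x′ (trans zw (trans q y′x′)))
                     ( ℕₚ.≤∧≢⇒< y′≤w (λ q → z≁x′ (trans zw (trans (cong g (sym (toℕ-injective q))) y′x′)))
                     , ℕₚ.≤∧≢⇒< (≤x′ w<y) (λ q → z≁x′ (trans zw (cong g (toℕ-injective q))))))))) ]′
                     (ℕₚ.<-≤-connex (toℕ w) (toℕ y′))
          in turn wn ns bn (inner k
               (ℕₚ.≤-pred (ℕₚ.≤-trans (proj₂ (range y′ y′x′)) y≤k))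
               (wrap-next g y′x′ λ z zx′ → min z zx′ , ≤x′ (proj₂ (range z zx′)))
               (proj₁ (range y′ y′x′)) sealed′)

        -- The contour moves left from `i`, and no white block joins the labels after `x` up to `i`
        -- to other labels. If the white block of `x` continues beyond `i`, its first label there is
        -- next and `inner` takes over. Otherwise `x` ends its white block, whose first label `y` is
        -- not special: else the labels before `y` and after `i` would be a union of blocks of both
        -- colours. The contour goes on from the label before `y`.
        outer : ∀ k {x} → toℕ x ≤ k → x Fin.≤ i →
                (∀ {z w} → g z ≡ g w → z Fin.≤ x ⊎ i Fin.< z → w Fin.≤ x ⊎ i Fin.< w) →
                Contour BN WN Special x j
        outer k {x} x≤k x≤i closed with any? (λ z → (g z ≟ g x) ×-dec (i <? z))
        ... | yes some =
          let (y , (yx , i<y) , min) = least (λ z → (g z ≟ g x) ×-dec (i <? z)) toℕ some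
              x<y : x Fin.< y
              x<y = ℕₚ.≤-<-trans x≤i i<y
              sealed : Sealed y
              sealed {z} {w} zw i<z z<y =
                let (x<w , w<y) = nest (sym yx) zw (λ q → ℕₚ.<⇒≱ z<y (min z (q , i<z)))
                                       (ℕₚ.≤-<-trans x≤i i<z , z<y)
                in [ (λ w≤x → ⊥-elim (ℕₚ.<⇒≱ x<w w≤x)) , (λ i<w → i<w , w<y) ]′ (closed zw (inj₂ i<z))
          in inner (toℕ y) ℕₚ.≤-refl
               (step-next g yx x<y λ z zx x<z z<y →
                 [ ℕₚ.<⇒≱ x<z , (λ i<z → ℕₚ.<⇒≱ z<y (min z (zx , i<z))) ]′ (closed (sym zx) (inj₁ ℕₚ.≤-refl)))
               i<y sealed
        ... | no none with first x
        ...   | y , yx , min = go k x≤k (special (f y) ≟ y)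
          where
          range : ∀ z → g z ≡ g x → y Fin.≤ z × z Fin.≤ x
          range z zx = min z zx , [ id , (λ i<z → ⊥-elim (none (z , zx , i<z))) ]′ (closed (sym zx) (inj₁ ℕₚ.≤-refl))
          wn : WN x y
          wn = wrap-next g yx range
          y≤x : y Fin.≤ x
          y≤x = min x refl
          Outside : Fin n → Set
          Outside z = z Fin.< y ⊎ i Fin.< z
          not-inside : ∀ {z} → Outside z → y Fin.≤ z → z Fin.≤ x → ⊥
          not-inside (inj₁ z<y) y≤z _ = ℕₚ.<⇒≱ z<y y≤z
          not-inside (inj₂ i<z) _ z≤x = ℕₚ.<⇒≱ i<z (ℕₚ.≤-trans z≤x x≤i)
          onG : Respects g Outside
          onG {z} {w} zw out with closed zw (Sum.map₁ (λ z<y → ℕₚ.≤-trans (ℕₚ.<⇒≤ z<y) y≤x) out)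
          ... | inj₂ i<w = inj₂ i<w
          ... | inj₁ w≤x with ℕₚ.<-≤-connex (toℕ w) (toℕ y)
          ...   | inj₁ w<y = inj₁ w<y
          ...   | inj₂ y≤w = ⊥-elim (not-inside out (ℕₚ.<⇒≤ (proj₁ bet)) (ℕₚ.<⇒≤ (proj₂ bet)))
            where
            w≁x : g w ≢ g x
            w≁x q = not-inside out (proj₁ (range z (trans zw q))) (proj₂ (range z (trans zw q)))
            bet : Between y x z
            bet = nest yx (sym zw) (λ q → w≁x (trans q yx))
              ( ℕₚ.≤∧≢⇒< y≤w (λ q → w≁x (trans (cong g (sym (toℕ-injective q))) yx))
              , ℕₚ.≤∧≢⇒< w≤x (λ q → w≁x (cong g (toℕ-injective q))))
          go : ∀ k → toℕ x ≤ k → Dec (Special y) → Contour BN WN Special x j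
          go k x≤k (yes s) = ⊥-elim ([ ℕₚ.<-irrefl refl , (λ i<y → ℕₚ.<⇒≱ i<y (ℕₚ.≤-trans y≤x x≤i)) ]′
            (conn Outside onF onG j y (inj₂ i<j)))
            where
            onF : Respects f Outside
            onF {z} {w} e out with ℕₚ.<-≤-connex (toℕ i) (toℕ w) | ℕₚ.<-≤-connex (toℕ w) (toℕ y)
            ... | inj₁ i<w | _        = inj₂ i<w
            ... | _        | inj₁ w<y = inj₁ w<y
            ... | inj₂ w≤i | inj₂ y≤w with out
            ...   | inj₁ z<y = ⊥-elim (ℕₚ.<⇒≱ z<y (special-least′ s (sym (convex≤ e (ℕₚ.<⇒≤ z<y) y≤w))))
            ...   | inj₂ i<z = ⊥-elim (gap-f (sym e) w≤i i<z)
          go k x≤k (no ns) with previous y ns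
          go zero x≤k (no ns) | x′ , e , _ , bn = ⊥-elim (impossible (trans (sym e) (ℕₚ.n≤0⇒n≡0 (ℕₚ.≤-trans y≤x x≤k))))
            where
            impossible : ∀ {m} → suc m ≡ 0 → ⊥
            impossible ()
          go (suc k) x≤k (no ns) | x′ , e , _ , bn = turn wn ns bn
            (outer k (ℕₚ.≤-pred (subst (_≤ suc k) e (ℕₚ.≤-trans y≤x x≤k)))
              (ℕₚ.≤-trans (ℕₚ.n≤1+n (toℕ x′)) (subst (_≤ toℕ i) e (ℕₚ.≤-trans y≤x x≤i)))
              λ zw r → Sum.map₁ (λ l → ℕₚ.≤-pred (subst (_ <_) e l))
                (onG zw (Sum.map₁ (λ l → subst (_ <_) (sym e) (ℕ.s≤s l)) r)))

      contour : Contour BN WN Special i j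
      contour = outer (toℕ i) ℕₚ.≤-refl ℕₚ.≤-refl λ {_} {w} _ _ → Sum.swap (ℕₚ.<-≤-connex (toℕ i) (toℕ w))

    -- In different black blocks, `i` ends its interval, so the edge after it is the special one and
    -- the contour takes over.
    line-successor : Successor BN WN Special i j
    line-successor with f i ≟ f j
    ... | yes ij = within
      (step-next f (sym ij) i<j λ z _ i<z z<j → ℕₚ.<⇒≱ z<j (≥j i<z))
      (λ s → ℕₚ.<⇒≱ i<j (special-least′ s ij))
    ... | no ne = across (wrap-next f (special-at (f i)) range)
      (cong special (special-at (f i))) (contour ne)
      where
      range : ∀ z → f z ≡ f i → special (f i) Fin.≤ z × z Fin.≤ i
      range z zi = special-min (f i) z zi , ℕₚ.≮⇒≥ λ i<z →
        ne (sym (convex≤ (sym zi) (ℕₚ.<⇒≤ i<j) (≥j i<z)))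

-- Meanders give trees, and trees determine the labels

module _ {m : ℕ} (M : ShallowTop (suc m)) where
  open MarkedFatGraph (markedΓ (m , M)) hiding (graph)

  meander-connected : EdgeConnected blackEnd whiteEnd
  meander-connected = far⇒connected (top M) (bottom M) (topInterval M) (proj₂ (distance M))

  meander-tree : IsTree (graph (markedΓ (m , M)))
  meander-tree = connected⇒tree (graph (markedΓ (m , M)))
    (nonempty (partition (top M))) (nonempty (partition (bottom M))) meander-connected
    (far⇒count (top M) (bottom M) (topInterval M) (proj₂ (distance M)))

  label-successor : ∀ {i j} → toℕ j ≡ suc (toℕ i) → EdgeSuccessor (markedΓ (m , M)) i j
  label-successor = Line.line-successor blackEnd whiteEnd
    (interval⇒convex (partition (top M)) (topInterval M)) (nested (bottom M))
    meander-connected special special-at (special-least (m , M))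

  special-root : special root ≡ zero
  special-root = special-unique (m , M) root zero refl (λ _ _ → ℕ.z≤n)

module _ {m : ℕ} {M N : ShallowTop (suc m)} (iso : Isomorphism (markedΓ (m , M)) (markedΓ (m , N))) where
  open Isomorphism iso
  private
    module G = MarkedFatGraph (markedΓ (m , M))
    module H = MarkedFatGraph (markedΓ (m , N))

  -- The least label is the special edge at the root, which an isomorphism preserves; from there on
  -- successors are preserved and unique.
  labels-fixed : ∀ i → ε i ≡ i
  labels-fixed = <-weakInduction (λ i → ε i ≡ i)
    (trans (cong ε (sym (special-root M))) (trans (sym (special-≡ G.root))
      (trans (cong H.special (sym root-≡)) (special-root N))))
    (λ i fixed → let one-more = cong suc (sym (toℕ-inject₁ i)) in
      edge-successor-unique (markedΓ (m , N))
        (subst (λ x → EdgeSuccessor (markedΓ (m , N)) x (ε (suc i))) fixed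
          (edge-successor-map iso (label-successor M one-more)))
        (label-successor N one-more))

  iso⇒≈ : (m , M) ≈ᴹ (m , N)
  iso⇒≈ = same
    (λ i j → mk⇔ (λ e → trans (black i) (trans (cong β e) (sym (black j))))
                 (λ e → β-injective (trans (sym (black i)) (trans e (black j)))))
    (λ i j → mk⇔ (λ e → trans (white i) (trans (cong ω e) (sym (white j))))
                 (λ e → ω-injective (trans (sym (white i)) (trans e (white j)))))
    where
    black : ∀ i → H.blackEnd i ≡ β (G.blackEnd i)
    black i = trans (cong H.blackEnd (sym (labels-fixed i))) (blackEnd-≡ i)
    white : ∀ i → H.whiteEnd i ≡ ω (G.whiteEnd i)
    white i = trans (cong H.whiteEnd (sym (labels-fixed i))) (whiteEnd-≡ i)
    β-injective : ∀ {V W} → β V ≡ β W → V ≡ W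
    β-injective {V} e = trans (sym (Inverse.strictlyInverseʳ onBlack V)) (Inverse.inverseʳ onBlack e)
    ω-injective : ∀ {V W} → ω V ≡ ω W → V ≡ W
    ω-injective {V} e = trans (sym (Inverse.strictlyInverseʳ onWhite V)) (Inverse.inverseʳ onWhite e)

forget-injective : ∀ {M N} → Isomorphism (markedΓ M) (markedΓ N) → M ≈ᴹ N
forget-injective {m , M} {n , N} iso with ↔⇒≡ (Isomorphism.onEdges iso)
... | refl = iso⇒≈ iso

≈ᴹ-isEquivalence : IsEquivalence _≈ᴹ_
≈ᴹ-isEquivalence = record
  { refl  = λ { {m , M} → same (≈-refl {σ = top M}) (≈-refl {σ = bottom M}) }
  ; sym   = λ { (same {M = M} {N} e f) → same (≈-sym {σ = top M} {top N} e) (≈-sym {σ = bottom M} {bottom N} f) }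
  ; trans = λ { (same {M = M} {N} e f) (same {N = L} e′ f′) →
      same (≈-trans {σ = top M} {top N} {top L} e e′) (≈-trans {σ = bottom M} {bottom N} {bottom L} f f′) }
  }

theorem6p2 : Σ[ isTree ∈ (∀ M → IsTree (graph (markedΓ M))) ]
    IsBijection _≈ᴹ_ _≅_ (forget isTree)
theorem6p2 = isTree , record
  { isInjection = record
    { isCongruent = record
      { cong           = forget-cong
      ; isEquivalence₁ = ≈ᴹ-isEquivalence
      ; isEquivalence₂ = record
        { refl  = λ {T} → ≅-refl {T}
        ; sym   = λ {T} {U} → ≅-sym {T} {U}
        ; trans = λ {T} {U} {V} → ≅-trans {T} {U} {V} } }
    ; injective = forget-injective }
  ; surjective = λ T → let (M , iso) = realise T in M , λ {N} N≈M →
      ≅-trans {forget isTree N} {forget isTree M} {T} (forget-cong N≈M) (≅-sym {T} {forget isTree M} iso)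
  }
  where
  isTree : ∀ M → IsTree (graph (markedΓ M))
  isTree (m , M) = meander-tree M
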